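{- As formal power series in $u$ with coefficients in $\mathbb{Q}[t]$, $$\sum_{n\ge1}\chi_{\Pi_{\Gamma_{2n+2}}}(t)\,u^n=(t-1)\sum_{n\ge1}\frac{\bigl((t-1)_n\bigr)^2u^n}{\prod_{k=1}^n\bigl(1-k(t-k)u\bigr)}.$$ Equivalently, $$\sum_{n\ge1}\chi_{L_{2n+2}}(t)\,u^n=\sum_{n\ge1}\frac{\bigl((t-2)_{n-1}\bigr)^2u^n}{\prod_{k=1}^n\bigl(1-k(t-k)u\bigr)}.$$ Here $(a)_m=a(a-1)\cdots(a-m+1)$ (and $(a)_0=1$).
   Context: For a finite set $V\subset\mathbb{Z}_{>0}$, $\Gamma_V$ is the bipartite graph on vertex set $V$ with an edge $\{u,v\}$ for each $u<v$ in $V$ with $u$ odd and $v$ even; $\Gamma_{2n}:=\Gamma_{[2n]}$ where $[2n]=\{1,\dots,2n\}$. For a finite graph $G$ with vertex set $V$, the bond lattice $\Pi_G$ is the set of partitions $\pi$ of $V$ such that the induced subgraph of $G$ on each block is connected, ordered by: $\pi\le\pi'$ iff every block of $\pi$ is contained in a block of $\pi'$. For $n\ge2$, $L_{2n}$ is the induced subposet of $\Pi_{\Gamma_{[2n]\setminus\{2,2n-1\}}}$ consisting of the partitions in which $1$ and $2n$ are in distinct blocks. For a finite ranked poset $P$ of length $\ell$ with minimum $\hat0$, Möbius function $\mu_P$ and rank function $\mathrm{rk}$, the characteristic polynomial is $\chi_P(t)=\sum_{x\in P}\mu_P(\hat0,x)t^{\ell-\mathrm{rk}(x)}$. -}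

module Defs where

open import Algebra.Bundles.Raw using (RawRing)
import Algebra.Definitions.RawSemiring as RawSemiringOps
open import Data.Bool.Properties using () renaming (_≟_ to _≟ᵇ_)
open import Data.Fin using (Fin; toℕ)
open import Data.Fin.Properties using (all?; any?)
open import Data.Fin.Subset as Sub using (Subset; _∈_; _⊆_; ⁅_⁆; _∪_; ∣_∣; inside; outside)
open import Data.Fin.Subset.Properties
  using (_∈?_; _⊆?_; ⊆-antisym; x∈⁅x⁆; x∈⁅y⁆⇒x≡y; x∈p∪q⁻; p⊆p∪q; q⊆p∪q;
         p⊂q⇒∣p∣<∣q∣; ∣p∣≤n)
open import Data.Integer as ℤ using (ℤ; 0ℤ; 1ℤ; +_)
open import Data.Irrelevant using ([_])
open import Data.List as List using (List; []; _∷_; length; map; filter; foldr; upTo; cartesianProductWith)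
import Data.List.Membership.Propositional as ListMem
open import Data.List.Membership.Propositional.Properties using (∈-cartesianProductWith⁺)
open import Data.List.Relation.Unary.All using (All; []; _∷_)
open import Data.List.Relation.Unary.AllPairs using ([]; _∷_)
open import Data.List.Relation.Unary.Any using (here; there)
open import Data.List.Relation.Unary.Unique.Propositional using (Unique)
open import Data.List.Relation.Unary.Unique.Propositional.Properties using (cartesianProductWith⁺)
open import Data.Nat as ℕ using (ℕ; zero; suc; _∸_; _⊔_; s≤s)
open import Data.Nat.Divisibility using (_∣_; _∣?_; ∣1⇒≡1; m∣m*n)
open import Data.Nat.Induction using (<-wellFounded)
import Data.Nat.Properties as ℕ
open import Data.Product using (∃; _×_; _,_; proj₁; proj₂)
open import Data.Rational as ℚ using (ℚ)
open import Data.Refinement using (Refinement; _,_; value; proof)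
open import Data.Refinement.Properties using (value-injective)
open import Data.Sum using (_⊎_; inj₁; inj₂; swap; [_,_]′)
open import Data.Vec as Vec using (Vec; []; _∷_; lookup; tabulate)
open import Data.Vec.Properties using (≡-dec; lookup∘tabulate; ∷-injective; tabulate∘lookup; tabulate-cong)
open import Function using (_∘_; id)
open import Induction.WellFounded using (Acc; acc; WellFounded; module Subrelation)
open import Level using (0ℓ)
import Relation.Binary.Construct.NonStrictToStrict as NonStrict
import Relation.Binary.Construct.On as On
open import Relation.Binary.Construct.Closure.ReflexiveTransitive using (Star; ε; _◅_; _◅◅_)
open import Relation.Binary.Core using (Rel)
open import Relation.Binary.Definitions using (Minimum; Symmetric; Irreflexive)
import Relation.Binary.Definitions as B
open import Relation.Binary.PropositionalEquality
  using (_≡_; _≢_; refl; sym; trans; cong; subst; isEquivalence; module ≡-Reasoning)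
open import Relation.Binary.Structures using (IsDecPartialOrder)
open import Relation.Nullary using (¬_; Dec; yes; no; ¬?; recompute; contradiction)
open import Relation.Nullary.Decidable using (_×-dec_; _⊎-dec_; _→-dec_; map′)
open import Relation.Unary using (Pred; Decidable)

record FinitePoset : Set₁ where
  infix 4 _≤_
  field
    Carrier           : Set
    _≤_               : Rel Carrier 0ℓ
    isDecPartialOrder : IsDecPartialOrder _≡_ _≤_
    elements          : List Carrier
    complete          : ∀ x → x ListMem.∈ elements
    unique            : Unique elements
    0̂                 : Carrier
    minimum           : Minimum _≤_ 0̂

  open IsDecPartialOrder isDecPartialOrder public
    using (_≟_; _≤?_; isPartialOrder)
    renaming (refl to ≤-refl; trans to ≤-trans; antisym to ≤-antisym)

  open NonStrict _≡_ _≤_ public using (_<_)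

  _<?_ : B.Decidable _<_
  _<?_ = NonStrict.<-decidable _≡_ _≤_ _≟_ _≤?_

  filter-⊆ : {P Q : Pred Carrier 0ℓ} (P? : Decidable P) (Q? : Decidable Q) →
             (∀ {x} → P x → Q x) → ∀ xs →
             length (filter P? xs) ℕ.≤ length (filter Q? xs)
  filter-⊆ P? Q? P⊆Q [] = ℕ.z≤n
  filter-⊆ P? Q? P⊆Q (x ∷ xs) with P? x | Q? x
  ... | yes p | yes q = s≤s (filter-⊆ P? Q? P⊆Q xs)
  ... | yes p | no ¬q = contradiction (P⊆Q p) ¬q
  ... | no ¬p | yes q = ℕ.m≤n⇒m≤1+n (filter-⊆ P? Q? P⊆Q xs)
  ... | no ¬p | no ¬q = filter-⊆ P? Q? P⊆Q xs

  filter-⊂ : {P Q : Pred Carrier 0ℓ} (P? : Decidable P) (Q? : Decidable Q) →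
             (∀ {x} → P x → Q x) → ∀ {y xs} → y ListMem.∈ xs → ¬ P y → Q y →
             length (filter P? xs) ℕ.< length (filter Q? xs)
  filter-⊂ P? Q? P⊆Q {y} {.y ∷ xs} (here refl) ¬py qy with P? y | Q? y
  ... | yes p | _     = contradiction p ¬py
  ... | no _  | yes _ = s≤s (filter-⊆ P? Q? P⊆Q xs)
  ... | no _  | no ¬q = contradiction qy ¬q
  filter-⊂ P? Q? P⊆Q {y} {x ∷ xs} (there y∈) ¬py qy with P? x | Q? x
  ... | yes p | yes q = s≤s (filter-⊂ P? Q? P⊆Q y∈ ¬py qy)
  ... | yes p | no ¬q = contradiction (P⊆Q p) ¬q
  ... | no ¬p | yes q = ℕ.m≤n⇒m≤1+n (filter-⊂ P? Q? P⊆Q y∈ ¬py qy)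
  ... | no ¬p | no ¬q = filter-⊂ P? Q? P⊆Q y∈ ¬py qy

  below : Carrier → ℕ
  below x = length (filter (_<? x) elements)

  below-mono : ∀ {x y} → x < y → below x ℕ.< below y
  below-mono {x} {y} x<y =
    filter-⊂ (_<? x) (_<? y) (λ z<x → NonStrict.<-trans _≡_ _≤_ isPartialOrder z<x x<y)
      (complete x) (λ x<x → proj₂ x<x refl) x<y

  <-wf : WellFounded _<_
  <-wf = Subrelation.wellFounded below-mono (On.wellFounded below <-wellFounded)

  -- μ(x,x) = 1 and μ(x,y) = - Σ_{x ≤ z < y} μ(x,z) for x ≠ y; the sum is empty,
  -- so that μ(x,y) = 0, when x ≰ y.
  μ-acc : ∀ x y → Acc _<_ y → ℤ
  μ-acc x y (acc rs) with x ≟ y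
  ... | yes _ = 1ℤ
  ... | no  _ = ℤ.- foldr ℤ._+_ 0ℤ (map (λ z → term z (x ≤? z ×-dec z <? y)) elements)
    where
    term : ∀ z → Dec (x ≤ z × z < y) → ℤ
    term z (yes (_ , z<y)) = μ-acc x z (rs z<y)
    term z (no _)          = 0ℤ

  μ : Carrier → Carrier → ℤ
  μ x y = μ-acc x y (<-wf y)

  -- rk y is the greatest length of a chain with top element y.  In a ranked
  -- poset all maximal chains of [0̂,y] have this length, so rk is the rank
  -- function.
  rk-acc : ∀ y → Acc _<_ y → ℕ
  rk-acc y (acc rs) = foldr _⊔_ 0 (map (λ z → term z (z <? y)) elements)
    where
    term : ∀ z → Dec (z < y) → ℕ
    term z (yes z<y) = suc (rk-acc z (rs z<y))
    term z (no _)    = 0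

  rk : Carrier → ℕ
  rk y = rk-acc y (<-wf y)

  len : ℕ
  len = foldr _⊔_ 0 (map rk elements)

refineAll : {A : Set} {P : Pred A 0ℓ} → Decidable P → List A → List (Refinement A P)
refineAll P? []       = []
refineAll P? (x ∷ xs) with P? x
... | yes p = (x , [ p ]) ∷ refineAll P? xs
... | no  _ = refineAll P? xs

refineAll-complete : {A : Set} {P : Pred A 0ℓ} (P? : Decidable P) →
                     ∀ {xs} (v : Refinement A P) → value v ListMem.∈ xs →
                     v ListMem.∈ refineAll P? xs
refineAll-complete P? {x ∷ xs} (.x , [ p ]) (here refl) with P? x
... | yes _ = here refl
... | no ¬p = contradiction (recompute (P? x) p) ¬p
refineAll-complete P? {x ∷ xs} v (there v∈) with P? x
... | yes _ = there (refineAll-complete P? v v∈)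
... | no  _ = refineAll-complete P? v v∈

refineAll-fresh : {A : Set} {P : Pred A 0ℓ} (P? : Decidable P) →
                  ∀ {xs} (v : Refinement A P) → All (value v ≢_) xs →
                  All (v ≢_) (refineAll P? xs)
refineAll-fresh P? {[]}     v []       = []
refineAll-fresh P? {x ∷ xs} v (n ∷ ns) with P? x
... | yes _ = (n ∘ cong value) ∷ refineAll-fresh P? v ns
... | no  _ = refineAll-fresh P? v ns

refineAll-unique : {A : Set} {P : Pred A 0ℓ} (P? : Decidable P) →
                   ∀ {xs} → Unique xs → Unique (refineAll P? xs)
refineAll-unique P? {[]}     []       = []
refineAll-unique P? {x ∷ xs} (n ∷ ns) with P? x
... | yes p = refineAll-fresh P? (x , [ p ]) n ∷ refineAll-unique P? ns
... | no  _ = refineAll-unique P? ns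

inducedSubposet : (P : FinitePoset) {Q : Pred (FinitePoset.Carrier P) 0ℓ} →
                  Decidable Q → Q (FinitePoset.0̂ P) → FinitePoset
inducedSubposet P {Q} Q? q₀ = record
  { Carrier           = Refinement Carrier Q
  ; _≤_               = λ v w → value v ≤ value w
  ; isDecPartialOrder = record
    { isPartialOrder = record
      { isPreorder = record
        { isEquivalence = isEquivalence
        ; reflexive     = λ { refl → ≤-refl }
        ; trans         = ≤-trans
        }
      ; antisym = λ v≤w w≤v → value-injective (≤-antisym v≤w w≤v)
      }
    ; _≟_  = λ v w → map′ value-injective (cong value) (value v ≟ value w)
    ; _≤?_ = λ v w → value v ≤? value w
    }
  ; elements = refineAll Q? elements
  ; complete = λ v → refineAll-complete Q? v (complete (value v))
  ; unique   = refineAll-unique Q? unique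
  ; 0̂        = 0̂ , [ q₀ ]
  ; minimum  = λ v → minimum (value v)
  }
  where open FinitePoset P

-- A partition of Fin n is given by the map sending each point to its block.
IsPartition : ∀ {n} → Vec (Subset n) n → Set
IsPartition π = (∀ i → i ∈ lookup π i)
              × (∀ i j → j ∈ lookup π i → lookup π j ≡ lookup π i)

_≟ˢ_ : ∀ {n} → B.DecidableEquality (Subset n)
_≟ˢ_ = ≡-dec _≟ᵇ_

isPartition? : ∀ {n} → Decidable (IsPartition {n})
isPartition? π = all? (λ i → i ∈? lookup π i)
           ×-dec all? (λ i → all? λ j → (j ∈? lookup π i) →-dec (lookup π j ≟ˢ lookup π i))

Partition : ℕ → Set
Partition n = Refinement (Vec (Subset n) n) IsPartition

block : ∀ {n} → Partition n → Fin n → Subset n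
block π i = lookup (value π) i

_⊑_ : ∀ {n} → Rel (Partition n) 0ℓ
π ⊑ π′ = ∀ i → ∃ λ j → block π i ⊆ block π′ j

discrete : ∀ n → Partition n
discrete n = tabulate ⁅_⁆ , [ refl′ , same ]
  where
  refl′ : ∀ i → i ∈ lookup (tabulate ⁅_⁆) i
  refl′ i = subst (i ∈_) (sym (lookup∘tabulate ⁅_⁆ i)) (x∈⁅x⁆ i)

  same : ∀ i j → j ∈ lookup (tabulate ⁅_⁆) i → lookup (tabulate ⁅_⁆) j ≡ lookup (tabulate ⁅_⁆) i
  same i j j∈ = cong (lookup (tabulate ⁅_⁆))
                     (x∈⁅y⁆⇒x≡y i (subst (j ∈_) (lookup∘tabulate ⁅_⁆ i) j∈))

block-discrete : ∀ {n} (i : Fin n) → block (discrete n) i ≡ ⁅ i ⁆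
block-discrete i = lookup∘tabulate ⁅_⁆ i

isPartition : ∀ {n} (π : Partition n) → IsPartition (value π)
isPartition (π , [ p ]) = recompute (isPartition? π) p

⊑-blockwise : ∀ {n} (π π′ : Partition n) → π ⊑ π′ → ∀ i → block π i ⊆ block π′ i
⊑-blockwise π π′ π⊑π′ i with π⊑π′ i
... | j , sub = subst (block π i ⊆_)
                  (sym (proj₂ (isPartition π′) j i (sub (proj₁ (isPartition π) i)))) sub

⊑-antisym : ∀ {n} {π π′ : Partition n} → π ⊑ π′ → π′ ⊑ π → π ≡ π′
⊑-antisym {n} {π} {π′} p q = value-injective (begin
  value π                     ≡⟨ tabulate∘lookup (value π) ⟨
  tabulate (lookup (value π)) ≡⟨ tabulate-cong (λ i → ⊆-antisym (⊑-blockwise π π′ p i) (⊑-blockwise π′ π q i)) ⟩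
  tabulate (lookup (value π′)) ≡⟨ tabulate∘lookup (value π′) ⟩
  value π′                    ∎)
  where open ≡-Reasoning

vecs : {A : Set} → List A → ∀ n → List (Vec A n)
vecs xs zero    = [] ∷ []
vecs xs (suc n) = cartesianProductWith _∷_ xs (vecs xs n)

vecs-complete : {A : Set} {xs : List A} → (∀ x → x ListMem.∈ xs) →
                ∀ {n} (v : Vec A n) → v ListMem.∈ vecs xs n
vecs-complete c []      = here refl
vecs-complete c (x ∷ v) = ∈-cartesianProductWith⁺ _∷_ (c x) (vecs-complete c v)

vecs-unique : {A : Set} {xs : List A} → Unique xs → ∀ n → Unique (vecs xs n)
vecs-unique u zero    = [] ∷ []
vecs-unique u (suc n) = cartesianProductWith⁺ _∷_ ∷-injective u (vecs-unique u n)

sides : List Sub.Side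
sides = inside ∷ outside ∷ []

sides-complete : ∀ x → x ListMem.∈ sides
sides-complete inside  = here refl
sides-complete outside = there (here refl)

sides-unique : Unique sides
sides-unique = ((λ ()) ∷ []) ∷ [] ∷ []

Partitions : ℕ → FinitePoset
Partitions n = record
  { Carrier           = Partition n
  ; _≤_               = _⊑_
  ; isDecPartialOrder = record
    { isPartialOrder = record
      { isPreorder = record
        { isEquivalence = isEquivalence
        ; reflexive     = λ { refl i → i , id }
        ; trans         = λ p q i → let j , s = p i ; k , t = q j in k , t ∘ s
        }
      ; antisym = λ {π} {π′} → ⊑-antisym {n} {π} {π′}
      }
    ; _≟_  = λ v w → map′ value-injective (cong value) (≡-dec _≟ˢ_ (value v) (value w))
    ; _≤?_ = λ π π′ → all? λ i → any? λ j → block π i ⊆? block π′ j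
    }
  ; elements = refineAll isPartition? (vecs (vecs sides n) n)
  ; complete = λ π → refineAll-complete isPartition? π
                       (vecs-complete (vecs-complete sides-complete) (value π))
  ; unique   = refineAll-unique isPartition? (vecs-unique (vecs-unique sides-unique n) n)
  ; 0̂        = discrete n
  ; minimum  = λ π i → i , λ {x} x∈ →
      subst (_∈ block π i) (sym (x∈⁅y⁆⇒x≡y i (subst (x ∈_) (block-discrete i) x∈)))
            (proj₁ (isPartition π) i)
  }

record Graph (n : ℕ) : Set₁ where
  field
    Adj         : Rel (Fin n) 0ℓ
    adj?        : B.Decidable Adj
    symmetric   : Symmetric Adj
    irreflexive : Irreflexive _≡_ Adj

module _ {n : ℕ} (G : Graph n) where
  open Graph G using (Adj; adj?)

  AdjWithin : Subset n → Rel (Fin n) 0ℓ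
  AdjWithin B u v = u ∈ B × v ∈ B × Adj u v

  InducedConnected : Subset n → Set
  InducedConnected B = ∀ u v → u ∈ B → v ∈ B → Star (AdjWithin B) u v

  IsBond : Partition n → Set
  IsBond π = ∀ i → InducedConnected (block π i)

module Reachability {n : ℕ} {R : Rel (Fin n) 0ℓ} (R? : B.Decidable R) (u : Fin n) where
  saturate : (S : Subset n) → u ∈ S → (∀ {v} → v ∈ S → Star R u v) →
             Acc ℕ._<_ (n ∸ ∣ S ∣) → ∀ v → Dec (Star R u v)
  saturate S u∈S sound (acc rs) v
    with any? (λ s → any? λ t → (s ∈? S) ×-dec ¬? (t ∈? S) ×-dec R? s t)
  ... | no closed = map′ sound (λ p → stays p u∈S) (v ∈? S)
    where
    stays : ∀ {x y} → Star R x y → x ∈ S → y ∈ S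
    stays ε                x∈ = x∈
    stays {x} (_◅_ {j = t} r p) x∈ with t ∈? S
    ... | yes t∈ = stays p t∈
    ... | no  t∉ = contradiction (x , t , x∈ , t∉ , r) closed
  ... | yes (s , t , s∈ , t∉ , r) =
    saturate S′ (p⊆p∪q ⁅ t ⁆ u∈S) sound′ (rs smaller) v
    where
    S′ = S ∪ ⁅ t ⁆

    sound′ : ∀ {v} → v ∈ S′ → Star R u v
    sound′ v∈ with x∈p∪q⁻ S ⁅ t ⁆ v∈
    ... | inj₁ v∈S = sound v∈S
    ... | inj₂ v∈t rewrite x∈⁅y⁆⇒x≡y t v∈t = sound s∈ ◅◅ r ◅ ε

    smaller : n ∸ ∣ S′ ∣ ℕ.< n ∸ ∣ S ∣
    smaller = ℕ.∸-monoʳ-< (p⊂q⇒∣p∣<∣q∣ (p⊆p∪q ⁅ t ⁆ , t , q⊆p∪q S ⁅ t ⁆ (x∈⁅x⁆ t) , t∉))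
                          (∣p∣≤n S′)

  star? : ∀ v → Dec (Star R u v)
  star? = saturate ⁅ u ⁆ (x∈⁅x⁆ u) (λ v∈ → subst (Star R u) (sym (x∈⁅y⁆⇒x≡y u v∈)) ε)
                   (<-wellFounded _)

isBond? : ∀ {n} (G : Graph n) → Decidable (IsBond G)
isBond? G π = all? λ i → let B = block π i in all? λ u → all? λ v →
  (u ∈? B) →-dec (v ∈? B) →-dec
    Reachability.star? (λ x y → (x ∈? B) ×-dec (y ∈? B) ×-dec Graph.adj? G x y) u v

discrete-isBond : ∀ {n} (G : Graph n) → IsBond G (discrete n)
discrete-isBond G i u v u∈ v∈ =
  subst (Star _ u) (trans (eq u∈) (sym (eq v∈))) ε
  where
  eq : ∀ {x} → x ∈ block (discrete _) i → x ≡ i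
  eq {x} x∈ = x∈⁅y⁆⇒x≡y i (subst (x ∈_) (block-discrete i) x∈)

bondLattice : ∀ {n} → Graph n → FinitePoset
bondLattice {n} G = inducedSubposet (Partitions n) (isBond? G) (discrete-isBond G)

Edge : Rel ℕ 0ℓ
Edge u v = u ℕ.< v × ¬ (2 ∣ u) × 2 ∣ v

edge? : B.Decidable Edge
edge? u v = (u ℕ.<? v) ×-dec ¬? (2 ∣? u) ×-dec (2 ∣? v)

-- A finite set V of positive integers is listed without repetition; the vertex
-- i : Fin (length V) stands for the integer List.lookup V i.
Γ : (V : List ℕ) → Graph (length V)
Γ V = record
  { Adj         = λ i j → Edge (# i) (# j) ⊎ Edge (# j) (# i)
  ; adj?        = λ i j → edge? (# i) (# j) ⊎-dec edge? (# j) (# i)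
  ; symmetric   = swap
  ; irreflexive = λ { refl → [ ℕ.<-irrefl refl ∘ proj₁ , ℕ.<-irrefl refl ∘ proj₁ ]′ }
  }
  where
  # : Fin (length V) → ℕ
  # = List.lookup V

⟦_⟧ : ℕ → List ℕ
⟦ m ⟧ = map suc (upTo m)

⟦_⟧∖[_,_] : ℕ → ℕ → ℕ → List ℕ
⟦ m ⟧∖[ a , b ] = filter (λ v → ¬? (v ℕ.≟ a) ×-dec ¬? (v ℕ.≟ b)) ⟦ m ⟧

DistinctBlocks : (V : List ℕ) (a b : ℕ) → Partition (length V) → Set
DistinctBlocks V a b π = ∀ i j → List.lookup V i ≡ a → List.lookup V j ≡ b → block π i ≢ block π j

distinctBlocks? : ∀ V a b → Decidable (DistinctBlocks V a b)
distinctBlocks? V a b π = all? λ i → all? λ j →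
  (List.lookup V i ℕ.≟ a) →-dec (List.lookup V j ℕ.≟ b) →-dec ¬? (block π i ≟ˢ block π j)

discrete-distinct : ∀ V {a b} → a ≢ b → DistinctBlocks V a b (discrete (length V))
discrete-distinct V a≢b i j refl refl eq = a≢b (cong (List.lookup V) i≡j)
  where
  i≡j : i ≡ j
  i≡j = x∈⁅y⁆⇒x≡y j (subst (i ∈_) (trans (sym (block-discrete i)) (trans eq (block-discrete j))) (x∈⁅x⁆ i))

1≢2n : ∀ n → 1 ≢ 2 ℕ.* n
1≢2n n eq with ∣1⇒≡1 (subst (2 ∣_) (sym eq) (m∣m*n {2} n))
... | ()

-- L n is the poset L₂ₙ, of interest for n ≥ 2.
L : ℕ → FinitePoset
L n = inducedSubposet (bondLattice (Γ V))
        (λ π → distinctBlocks? V 1 (2 ℕ.* n) (value π))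
        (discrete-distinct V (1≢2n n))
  where
  V = ⟦ 2 ℕ.* n ⟧∖[ 2 , 2 ℕ.* n ∸ 1 ]

module Polynomial (R : RawRing 0ℓ 0ℓ) where
  private
    module R = RawRing R

  -- Coefficient lists, constant term first; trailing zeros are allowed.
  Poly : Set
  Poly = List R.Carrier

  coeff : Poly → ℕ → R.Carrier
  coeff []      _       = R.0#
  coeff (a ∷ p) zero    = a
  coeff (a ∷ p) (suc i) = coeff p i

  _+ᵖ_ : Poly → Poly → Poly
  []      +ᵖ q       = q
  (a ∷ p) +ᵖ []      = a ∷ p
  (a ∷ p) +ᵖ (b ∷ q) = (a R.+ b) ∷ (p +ᵖ q)

  _*ᵖ_ : Poly → Poly → Poly
  []      *ᵖ q = []
  (a ∷ p) *ᵖ q = map (a R.*_) q +ᵖ (R.0# ∷ (p *ᵖ q))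

  ring : RawRing 0ℓ 0ℓ
  ring = record
    { Carrier = Poly
    ; _≈_     = λ p q → ∀ i → coeff p i R.≈ coeff q i
    ; _+_     = _+ᵖ_
    ; _*_     = _*ᵖ_
    ; -_      = map R.-_
    ; 0#      = []
    ; 1#      = R.1# ∷ []
    }

ℚ[t] : RawRing 0ℓ 0ℓ
ℚ[t] = Polynomial.ring ℚ.+-*-rawRing

open RawRing ℚ[t] using () renaming
  (Carrier to Poly; _+_ to _+ᵗ_; _*_ to _*ᵗ_; -_ to -ᵗ_; 0# to 0ᵗ)
open RawSemiringOps (RawRing.rawSemiring ℚ[t]) using ()
  renaming (product to productᵗ; _^_ to _^ᵗ_) public

fromℤ : ℤ → Poly
fromℤ z = (z ℚ./ 1) ∷ []

fromℕ : ℕ → Poly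
fromℕ k = fromℤ (+ k)

t : Poly
t = ℚ.0ℚ ∷ ℚ.1ℚ ∷ []

infixl 6 _-ᵗ_
_-ᵗ_ : Poly → Poly → Poly
p -ᵗ q = p +ᵗ (-ᵗ q)

falling : Poly → ℕ → Poly
falling a m = productᵗ {m} (λ i → a -ᵗ fromℕ (toℕ i))

χ : FinitePoset → Poly
χ P = foldr _+ᵗ_ 0ᵗ (map (λ x → fromℤ (μ 0̂ x) *ᵗ (t ^ᵗ (len ∸ rk x))) elements)
  where open FinitePoset P

module PowerSeries (R : RawRing 0ℓ 0ℓ) where
  private
    module R = RawRing R
    open RawSemiringOps R.rawSemiring using (sum)

  Series : Set
  Series = ℕ → R.Carrier

  const : R.Carrier → Series
  const a zero    = a
  const a (suc _) = R.0#

  u : Series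
  u 1 = R.1#
  u _ = R.0#

  ring : RawRing 0ℓ 0ℓ
  ring = record
    { Carrier = Series
    ; _≈_     = λ f g → ∀ n → f n R.≈ g n
    ; _+_     = λ f g n → f n R.+ g n
    ; _*_     = λ f g n → sum {suc n} (λ i → f (toℕ i) R.* g (n ∸ toℕ i))
    ; -_      = λ f n → R.- f n
    ; 0#      = const R.0#
    ; 1#      = const R.1#
    }

  -- The inverse of a series f with constant coefficient 1, from
  -- g₀ = 1 and gₙ₊₁ = - Σ_{i ≤ n} fᵢ₊₁ gₙ₋ᵢ.  recipPrefix f n is (gₙ, …, g₀).
  recipPrefix : Series → ∀ n → Vec R.Carrier (suc n)
  recipPrefix f zero    = R.1# ∷ []
  recipPrefix f (suc n) =
    (R.- sum {suc n} (λ i → f (suc (toℕ i)) R.* lookup (recipPrefix f n) i)) ∷ recipPrefix f n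

  recip : Series → Series
  recip f n = Vec.head (recipPrefix f n)

  -- ∑≥1 a is Σ_{n≥1} aₙ uⁿ for any sequence of series aₙ: the coefficient of
  -- uᴺ is Σ_{n=1}^{N} [u^(N-n)] aₙ.
  ∑≥1 : (ℕ → Series) → Series
  ∑≥1 a N = sum {N} (λ i → a (suc (toℕ i)) (N ∸ suc (toℕ i)))

ℚ[t]⟦u⟧ : RawRing 0ℓ 0ℓ
ℚ[t]⟦u⟧ = PowerSeries.ring ℚ[t]

open RawSemiringOps (RawRing.rawSemiring ℚ[t]⟦u⟧) using () renaming (product to productᵘ)
open PowerSeries ℚ[t] using (Series; const; u; recip)

-- ∏_{k=1}^{n} (1 - k(t-k)u)
denominator : ℕ → Series
denominator n = productᵘ {n} λ i → let k = fromℕ (suc (toℕ i)) in 1# - const (k *ᵗ (t -ᵗ k)) * u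
  where
  open RawRing ℚ[t]⟦u⟧
  infixl 6 _-_
  _-_ : Series → Series → Series
  f - g = f + (- g)

{-# OPTIONS --safe #-}

-- Both identities are checked coefficientwise at every integer t = q ≥ 2.
--
-- Left-hand sides.  Summing the colourings with q colours that take prescribed distinct
-- values on a set of pinned vertices over the bond partitions on whose blocks they are
-- constant, Möbius inversion gives Σ_π μ(0̂,π) q^(len − rk π) = number of proper colourings
-- with the prescribed values, where π runs over the bond partitions that separate the pinned
-- vertices: for Π_Γ one pins the vertex 1, for L₂ₙ the vertices 1 and 2n.  The proper colourings
-- of Γ_V are counted by colouring the vertices in increasing order; only the number k of
-- colours used on odd vertices matters.  For L, two consecutive vertices v, v+1 with v odd keep
-- k in k(q−k) ways and raise it in (q−1−k)² ways.  For Π_Γ the same walks appear, with the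
-- additional factor (q−1)³.
--
-- Right-hand sides.  The coefficients of 1/∏(1−k(q−k)u) are the complete homogeneous
-- polynomials in the k(q−k), so that the right-hand sides expand the weights of the same walks
-- according to the number of steps that raise k.
module Submission where

open import Defs
open import Algebra.Bundles.Raw using (RawRing)
import Algebra.Definitions.RawSemiring as RawSemiringOps
open import Data.Bool using (if_then_else_)
open import Data.Fin as Fin using (Fin; zero; suc; toℕ)
import Data.Fin.Properties as Fin
open import Data.Fin.Subset using (Subset; _∈_; _∉_; ⁅_⁆; _∪_; ∣_∣; ⊥; inside; outside)
open import Data.Fin.Subset.Properties
  using (_∈?_; ⊆-antisym; x∈⁅y⁆⇒x≡y; x∈⁅x⁆; x∈p∪q⁻; x∈p∪q⁺; p⊆p∪q; ∉⊥; ∣⊥∣≡0)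
open import Data.Integer as ℤ using (ℤ; +_; 0ℤ; 1ℤ)
import Data.Integer.Properties as ℤ
import Data.Integer.Solver as ℤ
open import Data.Irrelevant using ([_])
open import Data.List as List using (List; []; _∷_; _++_; length; map; foldr; filter; allFin; applyUpTo; cartesianProductWith)
import Data.List.Membership.Propositional as ListMem
open import Data.List.Membership.Propositional.Properties using (∈-allFin; ∈-lookup)
open import Data.List.Properties
  using (map-cong; map-tabulate; map-applyUpTo; length-tabulate; filter-accept; filter-reject)
open import Data.List.Relation.Unary.All as All using (All; []; _∷_)
open import Data.List.Relation.Unary.AllPairs using (AllPairs; []; _∷_)
open import Data.List.Relation.Unary.Any as Any using (here; there)
open import Data.List.Relation.Unary.Any.Properties using (lookup-index)
open import Data.List.Relation.Unary.Unique.Propositional using (Unique)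
open import Data.List.Relation.Unary.Unique.Propositional.Properties using (allFin⁺)
open import Data.Maybe using (Maybe; just; nothing)
open import Data.Maybe.Properties using (just-injective) renaming (≡-dec to ≡-decᵐ)
open import Data.Nat as ℕ using (ℕ; zero; suc; _∸_; _⊔_; z≤n; s≤s) renaming (_+_ to _+ⁿ_; _*_ to _*ⁿ_)
open import Data.Nat.Divisibility using (_∣_; _∣?_; ∣1⇒≡1; ∣-refl; ∣m∣n⇒∣m+n; ∣m+n∣m⇒∣n)
import Data.Nat.Properties as ℕ
open import Data.Product using (_×_; _,_; proj₁; proj₂; ∃)
open import Data.Rational as ℚ using (ℚ; 0ℚ; 1ℚ)
import Data.Rational.Properties as ℚ
import Data.Rational.Solver as ℚ
import Data.Rational.Unnormalised as ℚᵘ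
import Data.Rational.Unnormalised.Properties as ℚᵘ
open import Data.Refinement using (_,_; value)
open import Data.Sum using (_⊎_; inj₁; inj₂; [_,_]′)
open import Data.Vec as Vec using (Vec; []; _∷_; lookup; tabulate)
open import Data.Vec.Properties using (lookup∘tabulate; []=⇒lookup; lookup⇒[]=)
open import Function using (_∘_; id)
open import Induction.WellFounded using (Acc; acc)
open import Level using (0ℓ)
open import Relation.Binary.Construct.Closure.ReflexiveTransitive as Star using (Star; ε; _◅_; _◅◅_; reverse)
open import Relation.Binary.Core using (Rel)
import Relation.Binary.Definitions as B
open import Relation.Binary.PropositionalEquality hiding (isEquivalence; [_])
open import Relation.Binary.Structures using (IsEquivalence)
open import Relation.Nullary using (¬_; Dec; yes; no; ¬?; contradiction; does; recompute)
open import Relation.Nullary.Decidable using (_×-dec_; _→-dec_; _⊎-dec_; decidable-stable)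
open import Relation.Unary using (Decidable)
open Polynomial ℚ.+-*-rawRing using (coeff)
open PowerSeries ℚ[t] using (Series; const; u; recip; recipPrefix; ∑≥1)
open RawRing ℚ[t] using () renaming
  (Carrier to Poly; _+_ to _+ᵗ_; _*_ to _*ᵗ_; -_ to -ᵗ_; 0# to 0ᵗ; 1# to 1ᵗ)
open RawRing ℚ[t]⟦u⟧ using (_≈_; _*_)
open RawSemiringOps (RawRing.rawSemiring ℚ[t]) using () renaming (sum to sumᵗ)
open RawSemiringOps (RawRing.rawSemiring ℚ[t]⟦u⟧) using () renaming (product to productᵘ)

-- A connected graph has `q χ(q)` proper colourings with `q` colours, and prescribing the colour of
-- one vertex removes the factor `q`. The same device reaches L₂ₙ, which is only a part of a bond
-- lattice: if 1 and 2n receive distinct colours, the components of the monochromatic edges separate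
-- them and so form an element of L₂ₙ, and Möbius inversion can be done inside that poset. This asks
-- for two colours, hence `q ≥ 2`; infinitely many values still determine a polynomial.
--
-- The obstacle is the exponent `len ∸ rk`. Counting colourings produces the number `β` of blocks
-- without pinned vertices, whereas `rk` is defined through longest chains. Both are reconciled by
-- showing that `β` drops strictly along the order, that every interval offers a step along which it
-- drops by at most one, and that it reaches 0.

private
  module Q = ℚ.+-*-Solver
  module S = RawRing ℚ[t]⟦u⟧
  module Z = ℤ.+-*-Solver

-- Evaluation of polynomials

ι : ℤ → ℚ
ι z = z ℚ./ 1

private
  toℚᵘ-ι : ∀ z → ℚ.toℚᵘ (ι z) ℚᵘ.≃ ℚᵘ.mkℚᵘ z 0
  toℚᵘ-ι z = ℚ.toℚᵘ-fromℚᵘ (ℚᵘ.mkℚᵘ z 0)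

ι-+ : ∀ a b → ι (a ℤ.+ b) ≡ ι a ℚ.+ ι b
ι-+ a b = ℚ.toℚᵘ-injective (begin
  ℚ.toℚᵘ (ι (a ℤ.+ b))                  ≈⟨ toℚᵘ-ι (a ℤ.+ b) ⟩
  ℚᵘ.mkℚᵘ (a ℤ.+ b) 0                   ≈⟨ ℚᵘ.*≡* (cong (ℤ._* 1ℤ) (sym (cong₂ ℤ._+_ (ℤ.*-identityʳ a) (ℤ.*-identityʳ b)))) ⟩
  ℚᵘ.mkℚᵘ a 0 ℚᵘ.+ ℚᵘ.mkℚᵘ b 0          ≈⟨ ℚᵘ.+-cong (toℚᵘ-ι a) (toℚᵘ-ι b) ⟨
  ℚ.toℚᵘ (ι a) ℚᵘ.+ ℚ.toℚᵘ (ι b)        ≈⟨ ℚ.toℚᵘ-homo-+ (ι a) (ι b) ⟨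
  ℚ.toℚᵘ (ι a ℚ.+ ι b)                  ∎)
  where open ℚᵘ.≃-Reasoning

ι-* : ∀ a b → ι (a ℤ.* b) ≡ ι a ℚ.* ι b
ι-* a b = ℚ.toℚᵘ-injective (begin
  ℚ.toℚᵘ (ι (a ℤ.* b))                  ≈⟨ toℚᵘ-ι (a ℤ.* b) ⟩
  ℚᵘ.mkℚᵘ a 0 ℚᵘ.* ℚᵘ.mkℚᵘ b 0          ≈⟨ ℚᵘ.*-cong (toℚᵘ-ι a) (toℚᵘ-ι b) ⟨
  ℚ.toℚᵘ (ι a) ℚᵘ.* ℚ.toℚᵘ (ι b)        ≈⟨ ℚ.toℚᵘ-homo-* (ι a) (ι b) ⟨
  ℚ.toℚᵘ (ι a ℚ.* ι b)                  ∎)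
  where open ℚᵘ.≃-Reasoning

ι-suc-cancel : ∀ m y → ι (+ suc m) ℚ.* y ≡ 0ℚ → y ≡ 0ℚ
ι-suc-cancel m y eq = begin
  y                     ≡⟨ ℚ.*-identityˡ y ⟨
  1ℚ ℚ.* y              ≡⟨ cong (ℚ._* y) (ℚ.*-inverseˡ x) ⟨
  (ℚ.1/ x ℚ.* x) ℚ.* y  ≡⟨ ℚ.*-assoc (ℚ.1/ x) x y ⟩
  ℚ.1/ x ℚ.* (x ℚ.* y)  ≡⟨ cong (ℚ.1/ x ℚ.*_) eq ⟩
  ℚ.1/ x ℚ.* 0ℚ         ≡⟨ ℚ.*-zeroʳ (ℚ.1/ x) ⟩
  0ℚ                    ∎
  where
  open ≡-Reasoning
  x = ι (+ suc m)
  instance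
    x≢0 : ℚ.NonZero x
    x≢0 = ℚ.pos⇒nonZero x {{ℚ.normalize-pos (suc m) 1}}

eval : Poly → ℚ → ℚ
eval []      x = 0ℚ
eval (a ∷ p) x = a ℚ.+ x ℚ.* eval p x

module _ (x : ℚ) where
  eval-+ : ∀ p q → eval (p +ᵗ q) x ≡ eval p x ℚ.+ eval q x
  eval-+ []      q       = sym (ℚ.+-identityˡ (eval q x))
  eval-+ (a ∷ p) []      = sym (ℚ.+-identityʳ _)
  eval-+ (a ∷ p) (b ∷ q) rewrite eval-+ p q =
    Q.solve 5 (λ a b x p q → (a Q.:+ b) Q.:+ x Q.:* (p Q.:+ q) Q.:= (a Q.:+ x Q.:* p) Q.:+ (b Q.:+ x Q.:* q))
      refl a b x (eval p x) (eval q x)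

  eval-map-* : ∀ a q → eval (map (a ℚ.*_) q) x ≡ a ℚ.* eval q x
  eval-map-* a []      = sym (ℚ.*-zeroʳ a)
  eval-map-* a (b ∷ q) rewrite eval-map-* a q =
    Q.solve 4 (λ a b x q → a Q.:* b Q.:+ x Q.:* (a Q.:* q) Q.:= a Q.:* (b Q.:+ x Q.:* q))
      refl a b x (eval q x)

  eval-* : ∀ p q → eval (p *ᵗ q) x ≡ eval p x ℚ.* eval q x
  eval-* []      q = sym (ℚ.*-zeroˡ (eval q x))
  eval-* (a ∷ p) q
    rewrite eval-+ (map (a ℚ.*_) q) (0ℚ ∷ (p *ᵗ q)) | eval-map-* a q | eval-* p q =
    Q.solve 4 (λ a x p q → a Q.:* q Q.:+ (Q.con 0ℚ Q.:+ x Q.:* (p Q.:* q)) Q.:= (a Q.:+ x Q.:* p) Q.:* q)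
      refl a x (eval p x) (eval q x)

  eval-neg : ∀ p → eval (-ᵗ p) x ≡ ℚ.- eval p x
  eval-neg []      = refl
  eval-neg (a ∷ p) rewrite eval-neg p =
    Q.solve 3 (λ a x p → Q.:- a Q.:+ x Q.:* (Q.:- p) Q.:= Q.:- (a Q.:+ x Q.:* p)) refl a x (eval p x)

  eval-- : ∀ p q → eval (p -ᵗ q) x ≡ eval p x ℚ.- eval q x
  eval-- p q = trans (eval-+ p (-ᵗ q)) (cong (eval p x ℚ.+_) (eval-neg q))

  eval-fromℤ : ∀ z → eval (fromℤ z) x ≡ ι z
  eval-fromℤ z = trans (cong (ι z ℚ.+_) (ℚ.*-zeroʳ x)) (ℚ.+-identityʳ (ι z))

  eval-1 : eval 1ᵗ x ≡ 1ℚ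
  eval-1 = eval-fromℤ 1ℤ

  eval-t : eval t x ≡ x
  eval-t = Q.solve 1 (λ x → Q.con 0ℚ Q.:+ x Q.:* (Q.con 1ℚ Q.:+ x Q.:* Q.con 0ℚ) Q.:= x) refl x

-- Synthetic division: the coefficients of `(p − p(a)) / (x − a)`, which are the values at `a` of
-- the proper tails of `p`.
quotient : Poly → ℚ → Poly
quotient []          a = []
quotient (c ∷ [])    a = []
quotient (c ∷ d ∷ p) a = eval (d ∷ p) a ∷ quotient (d ∷ p) a

eval-quotient : ∀ p a x → eval p x ≡ eval p a ℚ.+ (x ℚ.- a) ℚ.* eval (quotient p a) x
eval-quotient [] a x = Q.solve 2 (λ a x → Q.con 0ℚ Q.:= Q.con 0ℚ Q.:+ (x Q.:- a) Q.:* Q.con 0ℚ) refl a x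
eval-quotient (c ∷ []) a x =
  Q.solve 3 (λ c a x → c Q.:+ x Q.:* Q.con 0ℚ Q.:= (c Q.:+ a Q.:* Q.con 0ℚ) Q.:+ (x Q.:- a) Q.:* Q.con 0ℚ) refl c a x
eval-quotient (c ∷ d ∷ p) a x =
  trans (cong (λ y → c ℚ.+ x ℚ.* y) (eval-quotient (d ∷ p) a x))
    (Q.solve 5 (λ c a x e s → c Q.:+ x Q.:* (e Q.:+ (x Q.:- a) Q.:* s)
                         Q.:= (c Q.:+ a Q.:* e) Q.:+ (x Q.:- a) Q.:* (e Q.:+ x Q.:* s))
       refl c a x (eval (d ∷ p) a) (eval (quotient (d ∷ p) a) x))

-- The head of the quotient is the value of the tail at `a`. Once it vanishes, the value of the
-- whole list at `a` is its constant coefficient.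
quotient-zero : ∀ p a → eval p a ≡ 0ℚ → All (_≡ 0ℚ) (quotient p a) → All (_≡ 0ℚ) p
quotient-zero []          a e z = []
quotient-zero (c ∷ [])    a e z = trans (Q.solve 2 (λ c a → c Q.:= c Q.:+ a Q.:* Q.con 0ℚ) refl c a) e ∷ []
quotient-zero (c ∷ d ∷ p) a e (z₀ ∷ z) =
  trans (Q.solve 2 (λ c a → c Q.:= c Q.:+ a Q.:* Q.con 0ℚ) refl c a)
        (trans (cong (λ y → c ℚ.+ a ℚ.* y) (sym z₀)) e)
  ∷ quotient-zero (d ∷ p) a z₀ z

length-quotient : ∀ n p a → length p ℕ.≤ suc n → length (quotient p a) ℕ.≤ n
length-quotient n       []          a le = z≤n
length-quotient n       (c ∷ [])    a le = z≤n
length-quotient (suc n) (c ∷ d ∷ p) a (s≤s le) = s≤s (length-quotient n (d ∷ p) a le)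

-- Dividing out the root `a` leaves a shorter list that vanishes at `a + 1`, `a + 2`, ..., because
-- `ι (+ suc m)` can be cancelled there. Requiring all integers from `a` on as roots lets the
-- hypothesis pass to the quotient by a mere shift.
roots⇒zero : ∀ n p a → length p ℕ.≤ n → (∀ m → eval p (ι (+ (m ℕ.+ a))) ≡ 0ℚ) → All (_≡ 0ℚ) p
roots⇒zero zero    []      a le ev = []
roots⇒zero (suc n) p       a le ev =
  quotient-zero p (ι (+ a)) (ev 0)
    (roots⇒zero n (quotient p (ι (+ a))) (suc a) (length-quotient n p _ le) λ m →
      ι-suc-cancel m _ (begin
        ι (+ suc m) ℚ.* eval (quotient p α) (ξ m)
          ≡⟨ cong (ℚ._* eval (quotient p α) (ξ m)) (diff m) ⟨
        (ξ m ℚ.- α) ℚ.* eval (quotient p α) (ξ m)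
          ≡⟨ ℚ.+-identityˡ _ ⟨
        0ℚ ℚ.+ (ξ m ℚ.- α) ℚ.* eval (quotient p α) (ξ m)
          ≡⟨ cong (ℚ._+ (ξ m ℚ.- α) ℚ.* eval (quotient p α) (ξ m)) (ev 0) ⟨
        eval p α ℚ.+ (ξ m ℚ.- α) ℚ.* eval (quotient p α) (ξ m)
          ≡⟨ eval-quotient p α (ξ m) ⟨
        eval p (ξ m)
          ≡⟨ cong (λ k → eval p (ι (+ k))) (ℕ.+-suc m a) ⟩
        eval p (ι (+ (suc m ℕ.+ a)))
          ≡⟨ ev (suc m) ⟩
        0ℚ ∎))
  where
  open ≡-Reasoning
  α = ι (+ a)
  ξ : ℕ → ℚ
  ξ m = ι (+ (m ℕ.+ suc a))
  diff : ∀ m → ξ m ℚ.- α ≡ ι (+ suc m)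
  diff m = begin
    ξ m ℚ.- α                  ≡⟨ cong (λ k → ι (+ k) ℚ.- α) (ℕ.+-suc m a) ⟩
    ι (+ suc m ℤ.+ + a) ℚ.- α  ≡⟨ cong (ℚ._- α) (ι-+ (+ suc m) (+ a)) ⟩
    (ι (+ suc m) ℚ.+ α) ℚ.- α  ≡⟨ Q.solve 2 (λ y a → (y Q.:+ a) Q.:- a Q.:= y) refl (ι (+ suc m)) α ⟩
    ι (+ suc m)                ∎

coeff-+ : ∀ p q i → coeff (p +ᵗ q) i ≡ coeff p i ℚ.+ coeff q i
coeff-+ []      q       i       = sym (ℚ.+-identityˡ _)
coeff-+ (a ∷ p) []      i       = sym (ℚ.+-identityʳ _)
coeff-+ (a ∷ p) (b ∷ q) zero    = refl
coeff-+ (a ∷ p) (b ∷ q) (suc i) = coeff-+ p q i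

coeff-neg : ∀ p i → coeff (-ᵗ p) i ≡ ℚ.- coeff p i
coeff-neg []      i       = refl
coeff-neg (a ∷ p) zero    = refl
coeff-neg (a ∷ p) (suc i) = coeff-neg p i

coeff-zero : ∀ {p} → All (_≡ 0ℚ) p → ∀ i → coeff p i ≡ 0ℚ
coeff-zero []       i       = refl
coeff-zero (z ∷ zs) zero    = z
coeff-zero (z ∷ zs) (suc i) = coeff-zero zs i

-- Equality holds only coefficientwise, since the two lists may differ by trailing zeros.
eval-injective : ∀ p q a → (∀ m → eval p (ι (+ (m ℕ.+ a))) ≡ eval q (ι (+ (m ℕ.+ a)))) →
                 ∀ i → coeff p i ≡ coeff q i
eval-injective p q a ev i = begin
  coeff p i                                ≡⟨ Q.solve 2 (λ x y → x Q.:= (x Q.:- y) Q.:+ y) refl (coeff p i) (coeff q i) ⟩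
  (coeff p i ℚ.- coeff q i) ℚ.+ coeff q i  ≡⟨ cong (ℚ._+ coeff q i) difference ⟩
  0ℚ ℚ.+ coeff q i                         ≡⟨ ℚ.+-identityˡ _ ⟩
  coeff q i                                ∎
  where
  open ≡-Reasoning
  vanishes : ∀ m → eval (p -ᵗ q) (ι (+ (m ℕ.+ a))) ≡ 0ℚ
  vanishes m = trans (eval-- (ι (+ (m ℕ.+ a))) p q)
    (trans (cong (ℚ._- _) (ev m)) (ℚ.+-inverseʳ (eval q (ι (+ (m ℕ.+ a))))))
  difference : coeff p i ℚ.- coeff q i ≡ 0ℚ
  difference = begin
    coeff p i ℚ.+ ℚ.- coeff q i    ≡⟨ cong (coeff p i ℚ.+_) (coeff-neg q i) ⟨
    coeff p i ℚ.+ coeff (-ᵗ q) i   ≡⟨ coeff-+ p (-ᵗ q) i ⟨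
    coeff (p -ᵗ q) i               ≡⟨ coeff-zero (roots⇒zero _ (p -ᵗ q) a ℕ.≤-refl vanishes) i ⟩
    0ℚ                             ∎
-- Evaluation of power series

∑< : ℕ → (ℕ → ℚ) → ℚ
∑< zero    f = 0ℚ
∑< (suc n) f = f 0 ℚ.+ ∑< n (f ∘ suc)

∑<-cong : ∀ n {f g : ℕ → ℚ} → (∀ i → i ℕ.< n → f i ≡ g i) → ∑< n f ≡ ∑< n g
∑<-cong zero    eq = refl
∑<-cong (suc n) eq = cong₂ ℚ._+_ (eq 0 (s≤s z≤n)) (∑<-cong n λ i i<n → eq (suc i) (s≤s i<n))

∑<-last : ∀ n f → ∑< (suc n) f ≡ ∑< n f ℚ.+ f n
∑<-last zero    f = ℚ.+-comm (f 0) 0ℚ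
∑<-last (suc n) f = trans (cong (f 0 ℚ.+_) (∑<-last n (f ∘ suc))) (sym (ℚ.+-assoc (f 0) _ _))

∑<-+ : ∀ n f g → ∑< n (λ i → f i ℚ.+ g i) ≡ ∑< n f ℚ.+ ∑< n g
∑<-+ zero    f g = refl
∑<-+ (suc n) f g rewrite ∑<-+ n (f ∘ suc) (g ∘ suc) =
  Q.solve 4 (λ a b c d → (a Q.:+ b) Q.:+ (c Q.:+ d) Q.:= (a Q.:+ c) Q.:+ (b Q.:+ d))
    refl (f 0) (g 0) (∑< n (f ∘ suc)) (∑< n (g ∘ suc))

∑<-* : ∀ n c f → ∑< n (λ i → c ℚ.* f i) ≡ c ℚ.* ∑< n f
∑<-* zero    c f = sym (ℚ.*-zeroʳ c)
∑<-* (suc n) c f rewrite ∑<-* n c (f ∘ suc) = sym (ℚ.*-distribˡ-+ c (f 0) _)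

∑<-0* : ∀ n f → ∑< n (λ i → 0ℚ ℚ.* f i) ≡ 0ℚ
∑<-0* n f = trans (∑<-* n 0ℚ f) (ℚ.*-zeroˡ (∑< n f))

-- Convolution and the inverse of a product of linear series

infixl 7 _⋆_
_⋆_ : (ℕ → ℚ) → (ℕ → ℚ) → ℕ → ℚ
(f ⋆ g) n = ∑< (suc n) (λ i → f i ℚ.* g (n ∸ i))

⋆-congˡ : ∀ {f g} → (∀ n → f n ≡ g n) → ∀ h n → (f ⋆ h) n ≡ (g ⋆ h) n
⋆-congˡ eq h n = ∑<-cong (suc n) λ i _ → cong (ℚ._* h (n ∸ i)) (eq i)

⋆-congʳ : ∀ f {g h} → (∀ n → g n ≡ h n) → ∀ n → (f ⋆ g) n ≡ (f ⋆ h) n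
⋆-congʳ f eq n = ∑<-cong (suc n) λ i _ → cong (f i ℚ.*_) (eq (n ∸ i))

constant : ℚ → ℕ → ℚ
constant c zero    = c
constant c (suc _) = 0ℚ

linear : ℚ → ℕ → ℚ
linear c 0             = 1ℚ
linear c 1             = ℚ.- c
linear c (suc (suc _)) = 0ℚ

constant-⋆ : ∀ c f n → (constant c ⋆ f) n ≡ c ℚ.* f n
constant-⋆ c f n = trans (cong (c ℚ.* f n ℚ.+_) (∑<-0* n (λ i → f (n ∸ suc i)))) (ℚ.+-identityʳ _)

linear-⋆-zero : ∀ c f → (linear c ⋆ f) 0 ≡ f 0
linear-⋆-zero c f = trans (ℚ.+-identityʳ _) (ℚ.*-identityˡ _)

linear-⋆-suc : ∀ c f n → (linear c ⋆ f) (suc n) ≡ f (suc n) ℚ.- c ℚ.* f n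
linear-⋆-suc c f n =
  trans (cong (λ z → 1ℚ ℚ.* f (suc n) ℚ.+ (ℚ.- c ℚ.* f n ℚ.+ z)) (∑<-0* n (λ i → f (n ∸ suc i))))
    (Q.solve 3 (λ c a b → Q.con 1ℚ Q.:* a Q.:+ (Q.:- c Q.:* b Q.:+ Q.con 0ℚ) Q.:= a Q.:- c Q.:* b)
       refl c (f (suc n)) (f n))

-- The complete homogeneous symmetric polynomial of degree `j` in `y 0`, ..., `y (l − 1)`; the
-- recursion sorts the monomials by whether `y 0` divides them.
homogeneous : (ℕ → ℚ) → ℕ → ℕ → ℚ
homogeneous y zero    j       = constant 1ℚ j
homogeneous y (suc l) zero    = 1ℚ
homogeneous y (suc l) (suc j) = y 0 ℚ.* homogeneous y (suc l) j ℚ.+ homogeneous (y ∘ suc) l (suc j)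

homogeneous-zero : ∀ y l → homogeneous y l 0 ≡ 1ℚ
homogeneous-zero y zero    = refl
homogeneous-zero y (suc l) = refl

linearProduct : (ℕ → ℚ) → ℕ → ℕ → ℚ
linearProduct y zero    = constant 1ℚ
linearProduct y (suc l) = linear (y 0) ⋆ linearProduct (y ∘ suc) l

linearProduct-zero : ∀ y l → linearProduct y l 0 ≡ 1ℚ
linearProduct-zero y zero    = refl
linearProduct-zero y (suc l) =
  trans (linear-⋆-zero (y 0) (linearProduct (y ∘ suc) l)) (linearProduct-zero (y ∘ suc) l)

-- Write `c` for the first variable. The factor `1 − cu` of `D₊` subtracts `c (D ⋆ h₊) n`, and the
-- recursion of `h₊` adds exactly this term to `(D ⋆ h) (suc n)`. Both effects are expressed through
-- convolutions with the same `D`, so they cancel and the induction hypothesis remains.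
linearProduct-⋆-homogeneous : ∀ y l n → (linearProduct y l ⋆ homogeneous y l) n ≡ constant 1ℚ n
linearProduct-⋆-homogeneous y zero    n       = trans (constant-⋆ 1ℚ (constant 1ℚ) n) (ℚ.*-identityˡ _)
linearProduct-⋆-homogeneous y (suc l) zero    =
  trans (ℚ.+-identityʳ _) (trans (ℚ.*-identityʳ _) (linearProduct-zero y (suc l)))
linearProduct-⋆-homogeneous y (suc l) (suc n) = begin
  (D₊ ⋆ h₊) (suc n)
    ≡⟨⟩
  D₊ 0 ℚ.* h₊ (suc n) ℚ.+ ∑< (suc n) (λ i → D₊ (suc i) ℚ.* h₊ (n ∸ i))
    ≡⟨ cong₂ ℚ._+_ (cong (ℚ._* h₊ (suc n)) (linear-⋆-zero c D))
         (∑<-cong (suc n) λ i _ → trans (cong (ℚ._* h₊ (n ∸ i)) (linear-⋆-suc c D i))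
            (Q.solve 4 (λ a c b h → (a Q.:- c Q.:* b) Q.:* h Q.:= a Q.:* h Q.:+ (Q.:- c) Q.:* (b Q.:* h))
               refl (D (suc i)) c (D i) (h₊ (n ∸ i)))) ⟩
  D 0 ℚ.* h₊ (suc n) ℚ.+ ∑< (suc n) (λ i → D (suc i) ℚ.* h₊ (n ∸ i) ℚ.+ (ℚ.- c) ℚ.* (D i ℚ.* h₊ (n ∸ i)))
    ≡⟨ cong (D 0 ℚ.* h₊ (suc n) ℚ.+_) (trans (∑<-+ (suc n) (λ i → D (suc i) ℚ.* h₊ (n ∸ i)) (λ i → (ℚ.- c) ℚ.* (D i ℚ.* h₊ (n ∸ i))))
           (cong (∑< (suc n) (λ i → D (suc i) ℚ.* h₊ (n ∸ i)) ℚ.+_) (∑<-* (suc n) (ℚ.- c) (λ i → D i ℚ.* h₊ (n ∸ i))))) ⟩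
  D 0 ℚ.* h₊ (suc n) ℚ.+ (∑< (suc n) (λ i → D (suc i) ℚ.* h₊ (n ∸ i)) ℚ.+ (ℚ.- c) ℚ.* (D ⋆ h₊) n)
    ≡⟨ ℚ.+-assoc (D 0 ℚ.* h₊ (suc n)) _ _ ⟨
  (D ⋆ h₊) (suc n) ℚ.+ (ℚ.- c) ℚ.* (D ⋆ h₊) n
    ≡⟨ cong (ℚ._+ (ℚ.- c) ℚ.* (D ⋆ h₊) n) split ⟩
  (c ℚ.* (D ⋆ h₊) n ℚ.+ (D ⋆ h) (suc n)) ℚ.+ (ℚ.- c) ℚ.* (D ⋆ h₊) n
    ≡⟨ Q.solve 3 (λ c s r → (c Q.:* s Q.:+ r) Q.:+ (Q.:- c) Q.:* s Q.:= r) refl c ((D ⋆ h₊) n) ((D ⋆ h) (suc n)) ⟩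
  (D ⋆ h) (suc n)
    ≡⟨ linearProduct-⋆-homogeneous (y ∘ suc) l (suc n) ⟩
  0ℚ ∎
  where
  open ≡-Reasoning
  c  = y 0
  D  = linearProduct (y ∘ suc) l
  D₊ = linearProduct y (suc l)
  h  = homogeneous (y ∘ suc) l
  h₊ = homogeneous y (suc l)
  split : (D ⋆ h₊) (suc n) ≡ c ℚ.* (D ⋆ h₊) n ℚ.+ (D ⋆ h) (suc n)
  split = begin
    (D ⋆ h₊) (suc n)
      -- The last summand is split off because the recursion of `h₊` starts at degree 1; in degree 0
      -- both `h₊` and `h` equal 1.
      ≡⟨ ∑<-last (suc n) (λ i → D i ℚ.* h₊ (suc n ∸ i)) ⟩
    ∑< (suc n) (λ i → D i ℚ.* h₊ (suc n ∸ i)) ℚ.+ D (suc n) ℚ.* h₊ (n ∸ n)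
      ≡⟨ cong₂ ℚ._+_ (trans (∑<-cong (suc n) step) (∑<-+ (suc n) (λ i → c ℚ.* (D i ℚ.* h₊ (n ∸ i))) (λ i → D i ℚ.* h (suc n ∸ i))))
           (cong (D (suc n) ℚ.*_) (trans (cong h₊ (ℕ.n∸n≡0 n)) (sym (trans (cong h (ℕ.n∸n≡0 n)) (homogeneous-zero (y ∘ suc) l))))) ⟩
    (∑< (suc n) (λ i → c ℚ.* (D i ℚ.* h₊ (n ∸ i))) ℚ.+ ∑< (suc n) (λ i → D i ℚ.* h (suc n ∸ i))) ℚ.+ D (suc n) ℚ.* h (n ∸ n)
      ≡⟨ ℚ.+-assoc (∑< (suc n) (λ i → c ℚ.* (D i ℚ.* h₊ (n ∸ i)))) _ _ ⟩
    ∑< (suc n) (λ i → c ℚ.* (D i ℚ.* h₊ (n ∸ i))) ℚ.+ (∑< (suc n) (λ i → D i ℚ.* h (suc n ∸ i)) ℚ.+ D (suc n) ℚ.* h (n ∸ n))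
      ≡⟨ cong₂ ℚ._+_ (∑<-* (suc n) c (λ i → D i ℚ.* h₊ (n ∸ i))) (sym (∑<-last (suc n) (λ i → D i ℚ.* h (suc n ∸ i)))) ⟩
    c ℚ.* (D ⋆ h₊) n ℚ.+ (D ⋆ h) (suc n) ∎
    where
    step : ∀ i → i ℕ.< suc n → D i ℚ.* h₊ (suc n ∸ i) ≡ c ℚ.* (D i ℚ.* h₊ (n ∸ i)) ℚ.+ D i ℚ.* h (suc n ∸ i)
    step i (s≤s i≤n) rewrite ℕ.+-∸-assoc 1 i≤n =
      Q.solve 4 (λ d c a b → d Q.:* (c Q.:* a Q.:+ b) Q.:= c Q.:* (d Q.:* a) Q.:+ d Q.:* b)
        refl (D i) c (h₊ (n ∸ i)) (h (suc (n ∸ i)))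

-- Weighted walks and their expansion by the number of raises

prefixProduct : (ℕ → ℚ) → ℕ → ℚ
prefixProduct s zero    = 1ℚ
prefixProduct s (suc i) = s 0 ℚ.* prefixProduct (s ∘ suc) i

-- The total weight of the walks of n steps on ℕ that start at 0, where step k → k has
-- weight y k and step k → k + 1 has weight z k.
walks : (ℕ → ℚ) → (ℕ → ℚ) → ℕ → ℚ
walks y z zero    = 1ℚ
walks y z (suc n) = y 0 ℚ.* walks y z n ℚ.+ z 0 ℚ.* walks (y ∘ suc) (z ∘ suc) n

walks-cong : ∀ n {y y′ z z′} → (∀ i → y i ≡ y′ i) → (∀ i → z i ≡ z′ i) → walks y z n ≡ walks y′ z′ n
walks-cong zero    p q = refl
walks-cong (suc n) p q =
  cong₂ ℚ._+_ (cong₂ ℚ._*_ (p 0) (walks-cong n p q)) (cong₂ ℚ._*_ (q 0) (walks-cong n (p ∘ suc) (q ∘ suc)))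

-- A walk with `i` raises visits the levels `0`, ..., `i`. Its raises contribute a fixed product of
-- squares, while its `n ∸ i` stays can be distributed over these levels at will and contribute
-- every monomial of that degree in `y 0`, ..., `y i`. The recursion of `homogeneous` on its first
-- variable is the case distinction on the first step of the walk.
walks-expansion : ∀ y s n →
  ∑< (suc n) (λ i → (prefixProduct s i ℚ.* prefixProduct s i) ℚ.* homogeneous y (suc i) (n ∸ i))
    ≡ walks y (λ i → s i ℚ.* s i) n
walks-expansion y s zero    = refl
walks-expansion y s (suc n) = begin
  ∑< (2 ℕ.+ n) (λ i → P i ℚ.* h (suc i) (suc n ∸ i))
    ≡⟨ ∑<-last (suc n) (λ i → P i ℚ.* h (suc i) (suc n ∸ i)) ⟩
  ∑< (suc n) (λ i → P i ℚ.* h (suc i) (suc n ∸ i)) ℚ.+ P (suc n) ℚ.* h (2 ℕ.+ n) (n ∸ n)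
    ≡⟨ cong₂ ℚ._+_ (trans (∑<-cong (suc n) step) (∑<-+ (suc n) (λ i → y 0 ℚ.* (P i ℚ.* h (suc i) (n ∸ i))) (λ i → P i ℚ.* h′ i (suc n ∸ i))))
         (cong (P (suc n) ℚ.*_) (trans (cong (h (2 ℕ.+ n)) (ℕ.n∸n≡0 n)) (sym (cong (h′ (suc n)) (ℕ.n∸n≡0 n))))) ⟩
  (∑< (suc n) (λ i → y 0 ℚ.* (P i ℚ.* h (suc i) (n ∸ i))) ℚ.+ ∑< (suc n) (λ i → P i ℚ.* h′ i (suc n ∸ i)))
    ℚ.+ P (suc n) ℚ.* h′ (suc n) (n ∸ n)
    ≡⟨ ℚ.+-assoc (∑< (suc n) (λ i → y 0 ℚ.* (P i ℚ.* h (suc i) (n ∸ i)))) _ _ ⟩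
  ∑< (suc n) (λ i → y 0 ℚ.* (P i ℚ.* h (suc i) (n ∸ i)))
    ℚ.+ (∑< (suc n) (λ i → P i ℚ.* h′ i (suc n ∸ i)) ℚ.+ P (suc n) ℚ.* h′ (suc n) (n ∸ n))
    ≡⟨ cong₂ ℚ._+_ (∑<-* (suc n) (y 0) (λ i → P i ℚ.* h (suc i) (n ∸ i))) (sym (∑<-last (suc n) (λ i → P i ℚ.* h′ i (suc n ∸ i)))) ⟩
  y 0 ℚ.* ∑< (suc n) (λ i → P i ℚ.* h (suc i) (n ∸ i)) ℚ.+ ∑< (2 ℕ.+ n) (λ i → P i ℚ.* h′ i (suc n ∸ i))
    -- The summand `i = 0` is zero: there is no monomial of positive degree in no variables.
    ≡⟨ cong (y 0 ℚ.* ∑< (suc n) (λ i → P i ℚ.* h (suc i) (n ∸ i)) ℚ.+_) (trans (ℚ.+-identityˡ _)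
         (trans (∑<-cong (suc n) (λ i _ → shift i)) (∑<-* (suc n) (s 0 ℚ.* s 0) (λ i → P′ i ℚ.* h′ (suc i) (n ∸ i))))) ⟩
  y 0 ℚ.* ∑< (suc n) (λ i → P i ℚ.* h (suc i) (n ∸ i))
    ℚ.+ (s 0 ℚ.* s 0) ℚ.* ∑< (suc n) (λ i → P′ i ℚ.* h′ (suc i) (n ∸ i))
    ≡⟨ cong₂ (λ a b → y 0 ℚ.* a ℚ.+ (s 0 ℚ.* s 0) ℚ.* b) (walks-expansion y s n) (walks-expansion (y ∘ suc) (s ∘ suc) n) ⟩
  walks y (λ i → s i ℚ.* s i) (suc n) ∎
  where
  open ≡-Reasoning
  P P′ : ℕ → ℚ
  P i  = prefixProduct s i ℚ.* prefixProduct s i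
  P′ i = prefixProduct (s ∘ suc) i ℚ.* prefixProduct (s ∘ suc) i
  h  = homogeneous y
  h′ = homogeneous (y ∘ suc)
  step : ∀ i → i ℕ.< suc n → P i ℚ.* h (suc i) (suc n ∸ i) ≡ y 0 ℚ.* (P i ℚ.* h (suc i) (n ∸ i)) ℚ.+ P i ℚ.* h′ i (suc n ∸ i)
  step i (s≤s i≤n) rewrite ℕ.+-∸-assoc 1 i≤n =
    Q.solve 4 (λ d c a b → d Q.:* (c Q.:* a Q.:+ b) Q.:= c Q.:* (d Q.:* a) Q.:+ d Q.:* b)
      refl (P i) (y 0) (h (suc i) (n ∸ i)) (h′ i (suc (n ∸ i)))
  shift : ∀ i → P (suc i) ℚ.* h′ (suc i) (n ∸ i) ≡ (s 0 ℚ.* s 0) ℚ.* (P′ i ℚ.* h′ (suc i) (n ∸ i))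
  shift i = Q.solve 3 (λ s p h → ((s Q.:* p) Q.:* (s Q.:* p)) Q.:* h Q.:= (s Q.:* s) Q.:* ((p Q.:* p) Q.:* h))
              refl (s 0) (prefixProduct (s ∘ suc) i) (h′ (suc i) (n ∸ i))

-- Values of the series of the statement at a rational point

module Evaluation (x : ℚ) where

  eval-sum : ∀ n (v : Fin n → Poly) (g : ℕ → ℚ) → (∀ i → eval (v i) x ≡ g (toℕ i)) →
             eval (sumᵗ {n} v) x ≡ ∑< n g
  eval-sum zero    v g eq = refl
  eval-sum (suc n) v g eq =
    trans (eval-+ x (v Fin.zero) (sumᵗ {n} (v ∘ Fin.suc))) (cong₂ ℚ._+_ (eq Fin.zero) (eval-sum n (v ∘ Fin.suc) (g ∘ suc) (eq ∘ Fin.suc)))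

  evalˢ : Series → ℕ → ℚ
  evalˢ f n = eval (f n) x

  evalˢ-* : ∀ f g n → evalˢ (f S.* g) n ≡ (evalˢ f ⋆ evalˢ g) n
  evalˢ-* f g n = eval-sum (suc n) (λ i → f (toℕ i) *ᵗ g (n ∸ toℕ i)) (λ i → evalˢ f i ℚ.* evalˢ g (n ∸ i))
    (λ i → eval-* x (f (toℕ i)) (g (n ∸ toℕ i)))

  evalˢ-const : ∀ a n → evalˢ (const a) n ≡ constant (eval a x) n
  evalˢ-const a zero    = refl
  evalˢ-const a (suc n) = refl

  evalˢ-const-* : ∀ a f n → evalˢ (const a S.* f) n ≡ eval a x ℚ.* evalˢ f n
  evalˢ-const-* a f n =
    trans (evalˢ-* (const a) f n)
      (trans (⋆-congˡ (evalˢ-const a) (evalˢ f) n) (constant-⋆ (eval a x) (evalˢ f) n))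

  evalˢ-∑≥1 : ∀ a n → evalˢ (∑≥1 a) n ≡ ∑< n (λ i → evalˢ (a (suc i)) (n ∸ suc i))
  evalˢ-∑≥1 a n = eval-sum n (λ i → a (suc (toℕ i)) (n ∸ suc (toℕ i))) _ (λ i → refl)

  evalˢ-linear : ∀ c n → evalˢ (S.1# S.+ S.- (const c S.* u)) n ≡ linear (eval c x) n
  evalˢ-linear c n =
    trans (eval-+ x (S.1# n) (-ᵗ ((const c S.* u) n)))
      (trans (cong (eval (S.1# n) x ℚ.+_) (trans (eval-neg x ((const c S.* u) n)) (cong ℚ.-_ (evalˢ-const-* c u n))))
         (coefficients n))
    where
    coefficients : ∀ n → eval (S.1# n) x ℚ.+ ℚ.- (eval c x ℚ.* evalˢ u n) ≡ linear (eval c x) n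
    coefficients 0 = trans (cong (ℚ._+ ℚ.- (eval c x ℚ.* 0ℚ)) (eval-1 x))
      (Q.solve 1 (λ c → Q.con 1ℚ Q.:+ (Q.:- (c Q.:* Q.con 0ℚ)) Q.:= Q.con 1ℚ) refl (eval c x))
    coefficients 1 = trans (cong (λ y → 0ℚ ℚ.+ ℚ.- (eval c x ℚ.* y)) (eval-1 x))
      (Q.solve 1 (λ c → Q.con 0ℚ Q.:+ (Q.:- (c Q.:* Q.con 1ℚ)) Q.:= Q.:- c) refl (eval c x))
    coefficients (suc (suc n)) =
      Q.solve 1 (λ c → Q.con 0ℚ Q.:+ (Q.:- (c Q.:* Q.con 0ℚ)) Q.:= Q.con 0ℚ) refl (eval c x)

  evalˢ-product : ∀ n (F : ℕ → Series) y → (∀ i j → evalˢ (F i) j ≡ linear (y i) j) →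
                  ∀ j → evalˢ (productᵘ {n} (F ∘ toℕ)) j ≡ linearProduct y n j
  evalˢ-product zero    F y eq zero    = eval-1 x
  evalˢ-product zero    F y eq (suc j) = refl
  evalˢ-product (suc n) F y eq j =
    trans (evalˢ-* (F 0) (productᵘ {n} (F ∘ suc ∘ toℕ)) j)
      (trans (⋆-congˡ (eq 0) (evalˢ (productᵘ {n} (F ∘ suc ∘ toℕ))) j)
             (⋆-congʳ (linear (y 0)) (evalˢ-product n (F ∘ suc) (y ∘ suc) (eq ∘ suc)) j))

  module _ (f : Series) (h : ℕ → ℚ) (f₀ : evalˢ f 0 ≡ 1ℚ)
           (inverse : ∀ n → (evalˢ f ⋆ h) n ≡ constant 1ℚ n) where
    private
      h₀ : h 0 ≡ 1ℚ
      h₀ = trans (sym (ℚ.*-identityˡ (h 0)))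
             (trans (cong (ℚ._* h 0) (sym f₀)) (trans (sym (ℚ.+-identityʳ _)) (inverse 0)))

      h-suc : ∀ n → ℚ.- ∑< (suc n) (λ i → evalˢ f (suc i) ℚ.* h (n ∸ i)) ≡ h (suc n)
      h-suc n = begin
        ℚ.- s                                            ≡⟨ Q.solve 2 (λ s a → Q.:- s Q.:= Q.con 1ℚ Q.:* a Q.:- (Q.con 1ℚ Q.:* a Q.:+ s)) refl s (h (suc n)) ⟩
        1ℚ ℚ.* h (suc n) ℚ.- (1ℚ ℚ.* h (suc n) ℚ.+ s)    ≡⟨ cong (λ z → 1ℚ ℚ.* h (suc n) ℚ.- z) (trans (cong (λ z → z ℚ.* h (suc n) ℚ.+ s) (sym f₀)) (inverse (suc n))) ⟩
        1ℚ ℚ.* h (suc n) ℚ.- 0ℚ                          ≡⟨ Q.solve 1 (λ a → Q.con 1ℚ Q.:* a Q.:- Q.con 0ℚ Q.:= a) refl (h (suc n)) ⟩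
        h (suc n)                                        ∎
        where
        open ≡-Reasoning
        s = ∑< (suc n) (λ i → evalˢ f (suc i) ℚ.* h (n ∸ i))

      eval-prefix : ∀ n i → eval (lookup (recipPrefix f n) i) x ≡ h (n ∸ toℕ i)
      eval-prefix zero    Fin.zero    = trans (eval-1 x) (sym h₀)
      eval-prefix (suc n) Fin.zero    =
        trans (eval-neg x (sumᵗ {suc n} v))
          (trans (cong ℚ.-_ (eval-sum (suc n) v (λ i → evalˢ f (suc i) ℚ.* h (n ∸ i)) λ i →
                    trans (eval-* x (f (suc (toℕ i))) (lookup (recipPrefix f n) i))
                          (cong (evalˢ f (suc (toℕ i)) ℚ.*_) (eval-prefix n i))))
                 (h-suc n))
        where
        v : Fin (suc n) → Poly
        v i = f (suc (toℕ i)) *ᵗ lookup (recipPrefix f n) i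
      eval-prefix (suc n) (Fin.suc i) = eval-prefix n i

    -- The recursion behind `recip` determines each coefficient from the previous ones, so every
    -- convolution inverse `h` of the evaluated series coincides with the evaluated reciprocal.
    evalˢ-recip : ∀ n → evalˢ (recip f) n ≡ h n
    evalˢ-recip zero    = eval-prefix zero Fin.zero
    evalˢ-recip (suc n) = eval-prefix (suc n) Fin.zero

  node : ℕ → ℚ
  node i = ι (+ suc i) ℚ.* (x ℚ.- ι (+ suc i))

  evalˢ-recip-denominator : ∀ n j → evalˢ (recip (denominator n)) j ≡ homogeneous node n j
  evalˢ-recip-denominator n =
    evalˢ-recip (denominator n) (homogeneous node n)
      (trans (eq 0) (linearProduct-zero node n))
      (λ j → trans (⋆-congˡ eq (homogeneous node n) j) (linearProduct-⋆-homogeneous node n j))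
    where
    k : ℕ → Poly
    k i = fromℕ (suc i)
    eval-k : ∀ i → eval (k i *ᵗ (t -ᵗ k i)) x ≡ node i
    eval-k i = trans (eval-* x (k i) (t -ᵗ k i)) (cong₂ ℚ._*_ (eval-fromℤ x (+ suc i))
      (trans (eval-- x t (k i)) (cong₂ ℚ._-_ (eval-t x) (eval-fromℤ x (+ suc i)))))
    eq : ∀ j → evalˢ (denominator n) j ≡ linearProduct node n j
    eq = evalˢ-product n (λ i → S.1# S.+ S.- (const (k i *ᵗ (t -ᵗ k i)) S.* u)) node
           (λ i j → trans (evalˢ-linear (k i *ᵗ (t -ᵗ k i)) j) (cong (λ c → linear c j) (eval-k i)))

  eval-falling : ∀ a m → eval (falling a m) x ≡ prefixProduct (λ i → eval a x ℚ.- ι (+ i)) m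
  eval-falling a m = go m (λ i → a -ᵗ fromℕ i) _ (λ i → trans (eval-- x a (fromℕ i)) (cong (λ z → eval a x ℚ.- z) (eval-fromℤ x (+ i))))
    where
    go : ∀ m (F : ℕ → Poly) s → (∀ i → eval (F i) x ≡ s i) → eval (productᵗ {m} (F ∘ toℕ)) x ≡ prefixProduct s m
    go zero    F s eq = eval-1 x
    go (suc m) F s eq = trans (eval-* x (F 0) (productᵗ {m} (F ∘ suc ∘ toℕ))) (cong₂ ℚ._*_ (eq 0) (go m (F ∘ suc) (s ∘ suc) (eq ∘ suc)))

  eval-square : ∀ p → eval (p ^ᵗ 2) x ≡ eval p x ℚ.* eval p x
  eval-square p =
    trans (eval-* x p (p ^ᵗ 1)) (cong (eval p x ℚ.*_)
      (trans (eval-* x p (RawRing.1# ℚ[t])) (trans (cong (eval p x ℚ.*_) (eval-1 x)) (ℚ.*-identityʳ _))))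
-- Finite sums of integers

𝟙 : {X : Set} → Dec X → ℤ
𝟙 d = if does d then 1ℤ else 0ℤ

private variable
  X Y : Set

𝟙-cong : (a? : Dec X) (b? : Dec Y) → (X → Y) → (Y → X) → 𝟙 a? ≡ 𝟙 b?
𝟙-cong (yes a) (yes b) f g = refl
𝟙-cong (yes a) (no ¬b) f g = contradiction (f a) ¬b
𝟙-cong (no ¬a) (yes b) f g = contradiction (g b) ¬a
𝟙-cong (no ¬a) (no ¬b) f g = refl

𝟙-yes : (a? : Dec X) → X → 𝟙 a? ≡ 1ℤ
𝟙-yes (yes _) a = refl
𝟙-yes (no ¬a) a = contradiction a ¬a

𝟙-no : (a? : Dec X) → ¬ X → 𝟙 a? ≡ 0ℤ
𝟙-no (yes a) ¬a = contradiction a ¬a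
𝟙-no (no _)  ¬a = refl

𝟙-× : (a? : Dec X) (b? : Dec Y) → 𝟙 (a? ×-dec b?) ≡ 𝟙 a? ℤ.* 𝟙 b?
𝟙-× (yes _) b? = sym (ℤ.*-identityˡ (𝟙 b?))
𝟙-× (no _)  b? = sym (ℤ.*-zeroˡ (𝟙 b?))

𝟙-¬ : (a? : Dec X) → 𝟙 (¬? a?) ≡ 1ℤ ℤ.- 𝟙 a?
𝟙-¬ (yes _) = refl
𝟙-¬ (no _)  = refl

𝟙-*-cong : (a? : Dec X) {x y : ℤ} → (X → x ≡ y) → 𝟙 a? ℤ.* x ≡ 𝟙 a? ℤ.* y
𝟙-*-cong (yes a) eq = cong (1ℤ ℤ.*_) (eq a)
𝟙-*-cong (no _) {x} {y} eq = trans (ℤ.*-zeroˡ x) (sym (ℤ.*-zeroˡ y))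

∑ : List X → (X → ℤ) → ℤ
∑ xs f = foldr ℤ._+_ 0ℤ (map f xs)

∑-cong : ∀ (xs : List X) {f g} → (∀ x → f x ≡ g x) → ∑ xs f ≡ ∑ xs g
∑-cong []       eq = refl
∑-cong (x ∷ xs) eq = cong₂ ℤ._+_ (eq x) (∑-cong xs eq)

∑-zero : ∀ (xs : List X) → ∑ xs (λ _ → 0ℤ) ≡ 0ℤ
∑-zero []       = refl
∑-zero (x ∷ xs) = trans (ℤ.+-identityˡ _) (∑-zero xs)

∑-+ : ∀ (xs : List X) f g → ∑ xs (λ x → f x ℤ.+ g x) ≡ ∑ xs f ℤ.+ ∑ xs g
∑-+ []       f g = refl
∑-+ (x ∷ xs) f g rewrite ∑-+ xs f g =
  Z.solve 4 (λ a b c d → (a Z.:+ b) Z.:+ (c Z.:+ d) Z.:= (a Z.:+ c) Z.:+ (b Z.:+ d))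
    refl (f x) (g x) (∑ xs f) (∑ xs g)

∑-*ˡ : ∀ (xs : List X) c f → ∑ xs (λ x → c ℤ.* f x) ≡ c ℤ.* ∑ xs f
∑-*ˡ []       c f = sym (ℤ.*-zeroʳ c)
∑-*ˡ (x ∷ xs) c f rewrite ∑-*ˡ xs c f = sym (ℤ.*-distribˡ-+ c (f x) _)

∑-*ʳ : ∀ (xs : List X) c f → ∑ xs (λ x → f x ℤ.* c) ≡ ∑ xs f ℤ.* c
∑-*ʳ xs c f = trans (∑-cong xs λ x → ℤ.*-comm (f x) c) (trans (∑-*ˡ xs c f) (ℤ.*-comm c _))

∑-const : ∀ (xs : List X) c → ∑ xs (λ _ → c) ≡ + length xs ℤ.* c
∑-const []       c = refl
∑-const (x ∷ xs) c rewrite ∑-const xs c = sym (ℤ.suc-* (+ length xs) c)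

∑-swap : ∀ (xs : List X) (ys : List Y) (f : X → Y → ℤ) →
         ∑ xs (λ x → ∑ ys (f x)) ≡ ∑ ys (λ y → ∑ xs (λ x → f x y))
∑-swap []       ys f = sym (∑-zero ys)
∑-swap (x ∷ xs) ys f rewrite ∑-swap xs ys f = sym (∑-+ ys (f x) _)

∑-++ : ∀ (xs ys : List X) f → ∑ (xs ++ ys) f ≡ ∑ xs f ℤ.+ ∑ ys f
∑-++ []       ys f = sym (ℤ.+-identityˡ _)
∑-++ (x ∷ xs) ys f rewrite ∑-++ xs ys f = sym (ℤ.+-assoc (f x) _ _)

∑-map : ∀ (g : X → Y) xs f → ∑ (map g xs) f ≡ ∑ xs (f ∘ g)
∑-map g []       f = refl
∑-map g (x ∷ xs) f = cong (λ s → f (g x) ℤ.+ s) (∑-map g xs f)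

∑-cartesianProductWith : ∀ {C : Set} (g : X → Y → C) xs ys f →
  ∑ (cartesianProductWith g xs ys) f ≡ ∑ xs (λ x → ∑ ys (λ y → f (g x y)))
∑-cartesianProductWith g []       ys f = refl
∑-cartesianProductWith g (x ∷ xs) ys f =
  trans (∑-++ (map (g x) ys) (cartesianProductWith g xs ys) f)
        (cong₂ ℤ._+_ (∑-map (g x) ys f) (∑-cartesianProductWith g xs ys f))

∑-delta : (_≟_ : B.DecidableEquality X) → ∀ {xs y} → Unique xs → y ListMem.∈ xs → (f : X → ℤ) →
          ∑ xs (λ x → 𝟙 (x ≟ y) ℤ.* f x) ≡ f y
∑-delta {X} _≟_ {x ∷ xs} {y} (n ∷ u) (here refl) f =
  trans (cong₂ ℤ._+_ (trans (cong (ℤ._* f x) (𝟙-yes (x ≟ x) refl)) (ℤ.*-identityˡ (f x)))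
                     (rest xs n))
        (ℤ.+-identityʳ (f x))
  where
  rest : ∀ zs → All (x ≢_) zs → ∑ zs (λ z → 𝟙 (z ≟ x) ℤ.* f z) ≡ 0ℤ
  rest []       []       = refl
  rest (z ∷ zs) (n ∷ ns) = trans (cong₂ ℤ._+_ (trans (cong (ℤ._* f z) (𝟙-no (z ≟ x) (n ∘ sym))) (ℤ.*-zeroˡ (f z))) (rest zs ns)) refl
∑-delta _≟_ {x ∷ xs} {y} (n ∷ u) (there y∈) f =
  trans (cong₂ ℤ._+_ (trans (cong (ℤ._* f x) (𝟙-no (x ≟ y) (All.lookup n y∈))) (ℤ.*-zeroˡ (f x)))
                     (∑-delta _≟_ u y∈ f))
        (ℤ.+-identityˡ (f y))

-- Möbius function and rank

max : List X → (X → ℕ) → ℕ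
max xs f = foldr _⊔_ 0 (map f xs)

max-upper : ∀ {xs : List X} {x} f → x ListMem.∈ xs → f x ℕ.≤ max xs f
max-upper f (here refl) = ℕ.m≤m⊔n _ _
max-upper f (there x∈)  = ℕ.m≤n⇒m≤o⊔n _ (max-upper f x∈)

max-least : ∀ (xs : List X) f {b} → (∀ x → f x ℕ.≤ b) → max xs f ℕ.≤ b
max-least []       f le = ℕ.z≤n
max-least (x ∷ xs) f le = ℕ.⊔-lub (le x) (max-least xs f le)

module PosetProperties (P : FinitePoset) where
  open FinitePoset P

  -- The local functions `term` of Defs cannot be named here.  In each mutual block the
  -- type of the second lemma is inferred from its use in the first.
  mutual
    μ-acc-irrelevant : ∀ x y (a b : Acc _<_ y) → μ-acc x y a ≡ μ-acc x y b
    μ-acc-irrelevant x y (acc rs) (acc rs′) with x ≟ y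
    ... | yes _   = refl
    ... | no  x≢y = cong (λ l → ℤ.- foldr ℤ._+_ 0ℤ l) (map-cong (μ-term-irrelevant x y rs rs′ x≢y) elements)

    μ-term-irrelevant : ∀ x y (rs rs′ : ∀ {z} → z < y → Acc _<_ z) (x≢y : x ≢ y) z → _
    μ-term-irrelevant x y rs rs′ x≢y z with x ≤? z ×-dec z <? y
    ... | yes (_ , z<y) = μ-acc-irrelevant x z (rs z<y) (rs′ z<y)
    ... | no  _         = refl

  mutual
    μ-acc-unfold : ∀ x y (a : Acc _<_ y) → x ≢ y →
      μ-acc x y a ≡ ℤ.- ∑ elements (λ z → 𝟙 (x ≤? z ×-dec z <? y) ℤ.* μ x z)
    μ-acc-unfold x y (acc rs) x≢y with x ≟ y
    ... | yes x≡y = contradiction x≡y x≢y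
    ... | no  x≢y′ = cong (λ l → ℤ.- foldr ℤ._+_ 0ℤ l) (map-cong (μ-term-unfold x y rs x≢y′) elements)

    μ-term-unfold : ∀ x y (rs : ∀ {z} → z < y → Acc _<_ z) (x≢y : x ≢ y) z → _
    μ-term-unfold x y rs x≢y z with x ≤? z | z ≤? y | z ≟ y
    ... | yes _ | yes z≤y | no z≢y = trans (μ-acc-irrelevant x z (rs (z≤y , z≢y)) (<-wf z)) (sym (ℤ.*-identityˡ (μ x z)))
    ... | no  _ | _       | _      = sym (ℤ.*-zeroˡ (μ x z))
    ... | yes _ | no _    | _      = sym (ℤ.*-zeroˡ (μ x z))
    ... | yes _ | yes _   | yes _  = sym (ℤ.*-zeroˡ (μ x z))

  μ-refl : ∀ x → μ x x ≡ 1ℤ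
  μ-refl x = go (<-wf x)
    where
    go : ∀ a → μ-acc x x a ≡ 1ℤ
    go (acc rs) with x ≟ x
    ... | yes _   = refl
    ... | no  x≢x = contradiction refl x≢x

  -- For `y ≢ 0̂` this is the recursion of `μ`, with the summand `z ≡ y` brought to the other side.
  ∑μ-below : ∀ y → ∑ elements (λ z → 𝟙 (z ≤? y) ℤ.* μ 0̂ z) ≡ 𝟙 (y ≟ 0̂)
  ∑μ-below y with y ≟ 0̂
  ... | yes refl = trans (∑-cong elements λ z → cong (ℤ._* μ 0̂ z)
                     (𝟙-cong (z ≤? 0̂) (z ≟ 0̂) (λ z≤0̂ → ≤-antisym z≤0̂ (minimum z)) (λ { refl → ≤-refl })))
                   (trans (∑-delta _≟_ unique (complete 0̂) (μ 0̂)) (μ-refl 0̂))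
  ... | no y≢0̂ = begin
    ∑ elements (λ z → 𝟙 (z ≤? y) ℤ.* μ 0̂ z)
      ≡⟨ ∑-cong elements split ⟩
    ∑ elements (λ z → 𝟙 (z ≟ y) ℤ.* μ 0̂ z ℤ.+ 𝟙 (0̂ ≤? z ×-dec z <? y) ℤ.* μ 0̂ z)
      ≡⟨ ∑-+ elements _ _ ⟩
    ∑ elements (λ z → 𝟙 (z ≟ y) ℤ.* μ 0̂ z) ℤ.+ s
      ≡⟨ cong (ℤ._+ s) (trans (∑-delta _≟_ unique (complete y) (μ 0̂)) (μ-acc-unfold 0̂ y (<-wf y) (y≢0̂ ∘ sym))) ⟩
    ℤ.- s ℤ.+ s
      ≡⟨ ℤ.+-inverseˡ s ⟩
    0ℤ ∎
    where
    open ≡-Reasoning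
    s = ∑ elements (λ z → 𝟙 (0̂ ≤? z ×-dec z <? y) ℤ.* μ 0̂ z)
    split : ∀ z → 𝟙 (z ≤? y) ℤ.* μ 0̂ z ≡ 𝟙 (z ≟ y) ℤ.* μ 0̂ z ℤ.+ 𝟙 (0̂ ≤? z ×-dec z <? y) ℤ.* μ 0̂ z
    split z = trans (cong (ℤ._* μ 0̂ z) indicator) (ℤ.*-distribʳ-+ (μ 0̂ z) (𝟙 (z ≟ y)) (𝟙 (0̂ ≤? z ×-dec z <? y)))
      where
      indicator : 𝟙 (z ≤? y) ≡ 𝟙 (z ≟ y) ℤ.+ 𝟙 (0̂ ≤? z ×-dec z <? y)
      indicator = go (z ≤? y) (z ≟ y) (0̂ ≤? z ×-dec z <? y)
        where
        go : (a : Dec (z ≤ y)) (b : Dec (z ≡ y)) (c : Dec (0̂ ≤ z × z < y)) → 𝟙 a ≡ 𝟙 b ℤ.+ 𝟙 c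
        go a (yes refl) c = trans (𝟙-yes a ≤-refl) (cong (λ s → 1ℤ ℤ.+ s) (sym (𝟙-no c λ { (_ , _ , y≢y) → y≢y refl })))
        go a (no z≢y)   c = trans (𝟙-cong a c (λ z≤y → minimum z , z≤y , z≢y) (proj₁ ∘ proj₂)) (sym (ℤ.+-identityˡ _))

  mutual
    rk-acc-irrelevant : ∀ y (a b : Acc _<_ y) → rk-acc y a ≡ rk-acc y b
    rk-acc-irrelevant y (acc rs) (acc rs′) = cong (foldr _⊔_ 0) (map-cong (rk-term-irrelevant y rs rs′) elements)

    rk-term-irrelevant : ∀ y (rs rs′ : ∀ {z} → z < y → Acc _<_ z) z → _
    rk-term-irrelevant y rs rs′ z with z <? y
    ... | yes z<y = cong suc (rk-acc-irrelevant z (rs z<y) (rs′ z<y))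
    ... | no  _   = refl

  rankAbove : ∀ {y z} → Dec (z < y) → ℕ
  rankAbove {z = z} (yes _) = suc (rk z)
  rankAbove         (no _)  = 0

  mutual
    rk-acc-unfold : ∀ y (a : Acc _<_ y) → rk-acc y a ≡ max elements (λ z → rankAbove (z <? y))
    rk-acc-unfold y (acc rs) = cong (foldr _⊔_ 0) (map-cong (rk-term-unfold y rs) elements)

    rk-term-unfold : ∀ y (rs : ∀ {z} → z < y → Acc _<_ z) z → _
    rk-term-unfold y rs z with z <? y
    ... | yes z<y = cong suc (rk-acc-irrelevant z (rs z<y) (<-wf z))
    ... | no  _   = refl

  rk-lower : ∀ {z y} → z < y → suc (rk z) ℕ.≤ rk y
  rk-lower {z} {y} z<y = begin
    suc (rk z)                                ≤⟨ bound (z <? y) ⟩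
    rankAbove (z <? y)                        ≤⟨ max-upper (λ w → rankAbove (w <? y)) (complete z) ⟩
    max elements (λ w → rankAbove (w <? y))   ≡⟨ rk-acc-unfold y (<-wf y) ⟨
    rk y                                      ∎
    where
    open ℕ.≤-Reasoning
    bound : (d : Dec (z < y)) → suc (rk z) ℕ.≤ rankAbove d
    bound (yes _)  = ℕ.≤-refl
    bound (no z≮y) = contradiction z<y z≮y

  rk-upper : ∀ {y b} → (∀ {z} → z < y → suc (rk z) ℕ.≤ b) → rk y ℕ.≤ b
  rk-upper {y} {b} le = begin
    rk y                                      ≡⟨ rk-acc-unfold y (<-wf y) ⟩
    max elements (λ z → rankAbove (z <? y))   ≤⟨ max-least elements (λ z → rankAbove (z <? y)) (λ z → bound (z <? y)) ⟩
    b                                         ∎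
    where
    open ℕ.≤-Reasoning
    bound : ∀ {z} (d : Dec (z < y)) → rankAbove d ℕ.≤ b
    bound (yes z<y) = le z<y
    bound (no _)    = ℕ.z≤n

  -- Identifies a candidate `β` for `len ∸ rk` from two inequalities. By `strict`, each step of a
  -- chain costs at least one unit of `β`, so that `rk y + β y` is at most `β 0̂`. By `step`, from
  -- any element one can climb towards `y` losing at most one unit while `rk` gains at least one, so
  -- that `rk + β` is monotone and at least its value at `0̂`. `top` turns this into the length of
  -- the poset.
  module Corank
    (β : Carrier → ℕ)
    (strict : ∀ {x y} → x < y → β y ℕ.< β x)
    (step : ∀ {x y} → x < y → ∃ λ z → x < z × z ≤ y × β x ℕ.≤ suc (β z))
    (top : ∃ λ x → β x ≡ 0)
    where

    private
      upper : ∀ y → Acc _<_ y → rk y ℕ.+ β y ℕ.≤ β 0̂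
      upper y (acc rs) with y ≟ 0̂
      ... | yes refl = ℕ.+-monoˡ-≤ (β 0̂) (rk-upper λ {z} z<0̂ → contradiction (≤-antisym (proj₁ z<0̂) (minimum z)) (proj₂ z<0̂))
      ... | no y≢0̂ = ℕ.≤-trans (ℕ.+-monoˡ-≤ (β y) (rk-upper {b = β 0̂ ∸ β y} λ {z} z<y →
                       ℕ.m+n≤o⇒m≤o∸n (suc (rk z))
                         (ℕ.≤-trans (ℕ.≤-reflexive (sym (ℕ.+-suc (rk z) (β y))))
                           (ℕ.≤-trans (ℕ.+-monoʳ-≤ (rk z) (strict z<y)) (upper z (rs z<y))))))
                     (ℕ.≤-reflexive (ℕ.m∸n+n≡m (ℕ.<⇒≤ (strict (minimum y , y≢0̂ ∘ sym)))))

      lower : ∀ n x {y} → β x ℕ.≤ n → x ≤ y → rk x ℕ.+ β x ℕ.≤ rk y ℕ.+ β y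
      lower n x {y} le x≤y with x ≟ y
      ... | yes refl = ℕ.≤-refl
      ... | no x≢y with n | step (x≤y , x≢y)
      ...   | zero  | z , x<z , z≤y , c = contradiction (ℕ.<-≤-trans (strict x<z) le) λ ()
      ...   | suc n | z , x<z , z≤y , c = ℕ.≤-trans
              (ℕ.≤-trans (ℕ.+-monoʳ-≤ (rk x) c) (ℕ.≤-trans (ℕ.≤-reflexive (ℕ.+-suc (rk x) (β z))) (ℕ.+-monoˡ-≤ (β z) (rk-lower x<z))))
              (lower n z (ℕ.≤-pred (ℕ.<-≤-trans (strict x<z) le)) z≤y)

    rk+β : ∀ x → rk x ℕ.+ β x ≡ β 0̂
    rk+β x = ℕ.≤-antisym (upper x (<-wf x))
      (ℕ.≤-trans (ℕ.m≤n+m (β 0̂) (rk 0̂)) (lower _ 0̂ ℕ.≤-refl (minimum x)))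

    len≡ : len ≡ β 0̂
    len≡ = ℕ.≤-antisym
      (max-least elements rk λ x → ℕ.≤-trans (ℕ.m≤m+n (rk x) (β x)) (ℕ.≤-reflexive (rk+β x)))
      (ℕ.≤-trans (ℕ.≤-reflexive (trans (sym (rk+β (proj₁ top))) (trans (cong (rk (proj₁ top) ℕ.+_) (proj₂ top)) (ℕ.+-identityʳ _))))
                 (max-upper rk (complete (proj₁ top))))

    len∸rk : ∀ x → len ∸ rk x ≡ β x
    len∸rk x = trans (cong (_∸ rk x) (trans len≡ (sym (rk+β x)))) (ℕ.m+n∸m≡n (rk x) (β x))

-- Colourings constant on the classes of an equivalence relation

count : ∀ {N} {P : Fin N → Set} → Decidable P → ℕ
count {zero}  P? = 0
count {suc N} P? = (if does (P? zero) then 1 else 0) ℕ.+ count (P? ∘ suc)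

count-mono : ∀ {N} {P Q : Fin N → Set} (P? : Decidable P) (Q? : Decidable Q) → (∀ i → P i → Q i) → count P? ℕ.≤ count Q?
count-mono {N = zero}  P? Q? sub = z≤n
count-mono {N = suc N} P? Q? sub with P? zero | Q? zero
... | yes p | yes q = s≤s (count-mono (P? ∘ suc) (Q? ∘ suc) (sub ∘ suc))
... | yes p | no ¬q = contradiction (sub zero p) ¬q
... | no ¬p | yes q = ℕ.m≤n⇒m≤1+n (count-mono (P? ∘ suc) (Q? ∘ suc) (sub ∘ suc))
... | no ¬p | no ¬q = count-mono (P? ∘ suc) (Q? ∘ suc) (sub ∘ suc)

count-cong : ∀ {N} {P Q : Fin N → Set} (P? : Decidable P) (Q? : Decidable Q) → (∀ i → P i → Q i) → (∀ i → Q i → P i) → count P? ≡ count Q?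
count-cong P? Q? f g = ℕ.≤-antisym (count-mono P? Q? f) (count-mono Q? P? g)

count-strict : ∀ {N} {P Q : Fin N → Set} (P? : Decidable P) (Q? : Decidable Q) → (∀ i → P i → Q i) →
               ∀ i → ¬ P i → Q i → count P? ℕ.< count Q?
count-strict P? Q? sub zero ¬p₀ q₀ with P? zero | Q? zero
... | yes p | _     = contradiction p ¬p₀
... | no ¬p | yes q = s≤s (count-mono (P? ∘ suc) (Q? ∘ suc) (sub ∘ suc))
... | no ¬p | no ¬q = contradiction q₀ ¬q
count-strict P? Q? sub (suc i) ¬pᵢ qᵢ with P? zero | Q? zero
... | yes p | yes q = s≤s (count-strict (P? ∘ suc) (Q? ∘ suc) (sub ∘ suc) i ¬pᵢ qᵢ)
... | yes p | no ¬q = contradiction (sub zero p) ¬q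
... | no ¬p | yes q = ℕ.m≤n⇒m≤1+n (count-strict (P? ∘ suc) (Q? ∘ suc) (sub ∘ suc) i ¬pᵢ qᵢ)
... | no ¬p | no ¬q = count-strict (P? ∘ suc) (Q? ∘ suc) (sub ∘ suc) i ¬pᵢ qᵢ

count-≤-suc : ∀ {N} {P Q : Fin N → Set} (P? : Decidable P) (Q? : Decidable Q) →
              (∀ i j → P i → ¬ Q i → P j → ¬ Q j → i ≡ j) → count P? ℕ.≤ suc (count Q?)
count-≤-suc {N = zero}  P? Q? one = z≤n
count-≤-suc {N = suc N} {Q = Q} P? Q? one with P? zero | Q? zero
... | yes p | yes q = s≤s (count-≤-suc (P? ∘ suc) (Q? ∘ suc) (λ i j pᵢ ¬qᵢ pⱼ ¬qⱼ → Fin.suc-injective (one _ _ pᵢ ¬qᵢ pⱼ ¬qⱼ)))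
... | yes p | no ¬q = s≤s (count-mono (P? ∘ suc) (Q? ∘ suc) tail)
  where
  tail : ∀ i → _ → Q (suc i)
  tail i pᵢ with Q? (suc i)
  ... | yes qᵢ = qᵢ
  ... | no ¬qᵢ = contradiction (one zero (suc i) p ¬q pᵢ ¬qᵢ) λ ()
... | no ¬p | yes q = ℕ.m≤n⇒m≤1+n (count-≤-suc (P? ∘ suc) (Q? ∘ suc) (λ i j pᵢ ¬qᵢ pⱼ ¬qⱼ → Fin.suc-injective (one _ _ pᵢ ¬qᵢ pⱼ ¬qⱼ)))
... | no ¬p | no ¬q = count-≤-suc (P? ∘ suc) (Q? ∘ suc) (λ i j pᵢ ¬qᵢ pⱼ ¬qⱼ → Fin.suc-injective (one _ _ pᵢ ¬qᵢ pⱼ ¬qⱼ))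

count-none : ∀ {N} {P : Fin N → Set} (P? : Decidable P) → (∀ i → ¬ P i) → count P? ≡ 0
count-none {N = zero}  P? none = refl
count-none {N = suc N} P? none with P? zero
... | yes p = contradiction p (none zero)
... | no _  = count-none (P? ∘ suc) (none ∘ suc)

module _ (q : ℕ) where

  ∑-allFin-delta : ∀ (c : Fin q) f → ∑ (allFin q) (λ x → 𝟙 (x Fin.≟ c) ℤ.* f x) ≡ f c
  ∑-allFin-delta c = ∑-delta Fin._≟_ (allFin⁺ q) (∈-allFin c)

  ∑-allFin-const : ∀ c → ∑ (allFin q) (λ _ → c) ≡ + q ℤ.* c
  ∑-allFin-const c = trans (∑-const (allFin q) c) (cong (λ n → + n ℤ.* c) (length-tabulate {n = q} id))

  ∑-allFin-pick : ∀ (c : Fin q) s → ∑ (allFin q) (λ x → s ℤ.* 𝟙 (x Fin.≟ c)) ≡ s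
  ∑-allFin-pick c s = trans (∑-cong (allFin q) λ x → ℤ.*-comm s (𝟙 (x Fin.≟ c))) (∑-allFin-delta c (λ _ → s))

  colourings : ∀ N → List (Vec (Fin q) N)
  colourings = vecs (allFin q)

module ConstantOnClasses {q : ℕ} where

  module _ {N} (E : Rel (Fin N) 0ℓ) (pin : Fin N → Maybe (Fin q)) where

    Compatible : Vec (Fin q) N → Set
    Compatible κ = (∀ i j → E i j → lookup κ i ≡ lookup κ j) × (∀ i c → pin i ≡ just c → lookup κ i ≡ c)

    -- When `pin` is constant on the classes, each class without a prescribed colour has exactly one
    -- such element, its greatest.
    Free : Fin N → Set
    Free i = pin i ≡ nothing × (∀ j → E i j → j Fin.≤ i)

    module _ (E? : B.Decidable E) where

      compatible? : Decidable Compatible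
      compatible? κ = Fin.all? (λ i → Fin.all? λ j → E? i j →-dec (lookup κ i Fin.≟ lookup κ j))
                ×-dec Fin.all? (λ i → Fin.all? λ c → ≡-decᵐ Fin._≟_ (pin i) (just c) →-dec (lookup κ i Fin.≟ c))

      free? : Decidable Free
      free? i = ≡-decᵐ Fin._≟_ (pin i) nothing ×-dec Fin.all? λ j → E? i j →-dec (j Fin.≤? i)

  -- The vertex `zero` is removed. Its colour is forced by a later member of its class, forced by
  -- its pin, or arbitrary, and only in the last case is it free. Greatest representatives suit this
  -- order: the removal of `zero` does not change which other vertices are free.
  ∑-compatible : ∀ N (E : Rel (Fin N) 0ℓ) (E? : B.Decidable E) → IsEquivalence E →
    (pin : Fin N → Maybe (Fin q)) → (∀ {i j} → E i j → pin i ≡ pin j) →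
    ∑ (colourings q N) (λ κ → 𝟙 (compatible? E pin E? κ)) ≡ (+ q) ℤ.^ count (free? E pin E?)
  ∑-compatible zero    E E? eq pin inv =
    trans (ℤ.+-identityʳ (𝟙 (compatible? E pin E? [])))
          (𝟙-yes (compatible? E pin E? []) ((λ ()) , λ ()))
  ∑-compatible (suc N) E E? eq pin inv = begin
    ∑ (colourings q (suc N)) (λ κ → 𝟙 (compatible? E pin E? κ))
      ≡⟨ ∑-cartesianProductWith _∷_ (allFin q) (colourings q N) (λ κ → 𝟙 (compatible? E pin E? κ)) ⟩
    ∑ (allFin q) (λ x → ∑ (colourings q N) (λ v → 𝟙 (compatible? E pin E? (x ∷ v))))
      ≡⟨ ∑-swap (allFin q) (colourings q N) (λ x v → 𝟙 (compatible? E pin E? (x ∷ v))) ⟩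
    ∑ (colourings q N) (λ v → ∑ (allFin q) (λ x → 𝟙 (compatible? E pin E? (x ∷ v))))
      ≡⟨ ∑-cong (colourings q N) head ⟩
    ∑ (colourings q N) (λ v → weight ℤ.* 𝟙 (compatible? E′ pin′ E′? v))
      ≡⟨ ∑-*ˡ (colourings q N) weight (λ v → 𝟙 (compatible? E′ pin′ E′? v)) ⟩
    weight ℤ.* ∑ (colourings q N) (λ v → 𝟙 (compatible? E′ pin′ E′? v))
      ≡⟨ cong (weight ℤ.*_) (∑-compatible N E′ E′? eq′ pin′ inv) ⟩
    weight ℤ.* (+ q) ℤ.^ count (free? E′ pin′ E′?)
      ≡⟨ cong (λ k → weight ℤ.* (+ q) ℤ.^ k)
           (count-cong (free? E′ pin′ E′?) (free? E pin E? ∘ suc)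
              (λ { i (p , m) → p , λ { zero _ → z≤n ; (suc j) e → s≤s (m j e) } })
              (λ { i (p , m) → p , λ j e → ℕ.≤-pred (m (suc j) e) })) ⟩
    weight ℤ.* (+ q) ℤ.^ count (free? E pin E? ∘ suc)
      ≡⟨ ℤ.^-distribˡ-+-* (+ q) (if does (free? E pin E? zero) then 1 else 0) (count (free? E pin E? ∘ suc)) ⟨
    (+ q) ℤ.^ count (free? E pin E?) ∎
    where
    open ≡-Reasoning
    module E = IsEquivalence eq
    E′ : Rel (Fin N) 0ℓ
    E′ i j = E (suc i) (suc j)
    E′? : B.Decidable E′
    E′? i j = E? (suc i) (suc j)
    eq′ : IsEquivalence E′
    eq′ = record { refl = E.refl ; sym = E.sym ; trans = E.trans }
    pin′ : Fin N → Maybe (Fin q)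
    pin′ = pin ∘ suc
    weight : ℤ
    weight = (+ q) ℤ.^ (if does (free? E pin E? zero) then 1 else 0)

    weight-free : Free E pin zero → weight ≡ + q
    weight-free f = go (free? E pin E? zero)
      where
      go : (d : Dec (Free E pin zero)) → (+ q) ℤ.^ (if does d then 1 else 0) ≡ + q
      go (yes _) = ℤ.*-identityʳ (+ q)
      go (no ¬f) = contradiction f ¬f

    weight-fixed : ¬ Free E pin zero → weight ≡ 1ℤ
    weight-fixed ¬f = go (free? E pin E? zero)
      where
      go : (d : Dec (Free E pin zero)) → (+ q) ℤ.^ (if does d then 1 else 0) ≡ 1ℤ
      go (yes f) = contradiction f ¬f
      go (no _)  = refl

    restrict : ∀ {x v} → Compatible E pin (x ∷ v) → Compatible E′ pin′ v
    restrict (k , p) = (λ i j → k (suc i) (suc j)) , λ i → p (suc i)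

    fixed : ∀ v c → ¬ Free E pin zero →
            (∀ {x} → Compatible E pin (x ∷ v) → x ≡ c) →
            (Compatible E′ pin′ v → Compatible E pin (c ∷ v)) →
            ∑ (allFin q) (λ x → 𝟙 (compatible? E pin E? (x ∷ v))) ≡ weight ℤ.* 𝟙 (compatible? E′ pin′ E′? v)
    fixed v c ¬f force extend = begin
      ∑ (allFin q) (λ x → 𝟙 (compatible? E pin E? (x ∷ v)))
        ≡⟨ ∑-cong (allFin q) (λ x → trans
             (𝟙-cong (compatible? E pin E? (x ∷ v)) (compatible? E′ pin′ E′? v ×-dec (x Fin.≟ c))
                (λ k → restrict k , force k) (λ { (k , refl) → extend k }))
             (𝟙-× (compatible? E′ pin′ E′? v) (x Fin.≟ c))) ⟩
      ∑ (allFin q) (λ x → 𝟙 (compatible? E′ pin′ E′? v) ℤ.* 𝟙 (x Fin.≟ c))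
        ≡⟨ ∑-allFin-pick q c (𝟙 (compatible? E′ pin′ E′? v)) ⟩
      𝟙 (compatible? E′ pin′ E′? v)
        ≡⟨ ℤ.*-identityˡ _ ⟨
      1ℤ ℤ.* 𝟙 (compatible? E′ pin′ E′? v)
        ≡⟨ cong (ℤ._* 𝟙 (compatible? E′ pin′ E′? v)) (weight-fixed ¬f) ⟨
      weight ℤ.* 𝟙 (compatible? E′ pin′ E′? v) ∎

    head : ∀ v → ∑ (allFin q) (λ x → 𝟙 (compatible? E pin E? (x ∷ v))) ≡ weight ℤ.* 𝟙 (compatible? E′ pin′ E′? v)
    head v = go (Fin.any? λ j → E? zero (suc j)) (pin zero) refl
      where
      go : Dec (∃ λ j → E zero (suc j)) → ∀ m → pin zero ≡ m →
           ∑ (allFin q) (λ x → 𝟙 (compatible? E pin E? (x ∷ v))) ≡ weight ℤ.* 𝟙 (compatible? E′ pin′ E′? v)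
      go (yes (j , e)) _ _ = fixed v (lookup v j)
            (λ { (_ , m) → contradiction (m (suc j) e) λ () })
            (λ { (k , _) → k zero (suc j) e })
            (λ { (k , p) → (λ { zero    zero    _  → refl
                              ; zero    (suc b) e′ → k j b (E.trans (E.sym e) e′)
                              ; (suc a) zero    e′ → k a j (E.trans e′ e)
                              ; (suc a) (suc b) e′ → k a b e′ })
                         , (λ { zero c pc → p j c (trans (sym (inv e)) pc)
                              ; (suc a) c pc → p a c pc }) })
      go (no alone) (just c) pin₀ = fixed v c
            (λ { (p , _) → contradiction (trans (sym pin₀) p) λ () })
            (λ { (_ , p) → p zero c pin₀ })
            (λ { (k , p) → (λ { zero    zero    _  → refl
                              ; zero    (suc b) e′ → contradiction (b , e′) alone
                              ; (suc a) zero    e′ → contradiction (a , E.sym e′) alone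
                              ; (suc a) (suc b) e′ → k a b e′ })
                         , (λ { zero d pd → just-injective (trans (sym pin₀) pd)
                              ; (suc a) d pd → p a d pd }) })
      go (no alone) nothing pin₀ = begin
        ∑ (allFin q) (λ x → 𝟙 (compatible? E pin E? (x ∷ v)))
          ≡⟨ ∑-cong (allFin q) (λ x → 𝟙-cong (compatible? E pin E? (x ∷ v)) (compatible? E′ pin′ E′? v) restrict
               (λ { (k , p) → (λ { zero    zero    _  → refl
                                 ; zero    (suc b) e′ → contradiction (b , e′) alone
                                 ; (suc a) zero    e′ → contradiction (a , E.sym e′) alone
                                 ; (suc a) (suc b) e′ → k a b e′ })
                            , (λ { zero d pd → contradiction (trans (sym pin₀) pd) λ ()
                                 ; (suc a) d pd → p a d pd }) })) ⟩
        ∑ (allFin q) (λ _ → 𝟙 (compatible? E′ pin′ E′? v))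
          ≡⟨ ∑-allFin-const q _ ⟩
        + q ℤ.* 𝟙 (compatible? E′ pin′ E′? v)
          ≡⟨ cong (ℤ._* 𝟙 (compatible? E′ pin′ E′? v)) (weight-free (pin₀ , λ { zero _ → z≤n ; (suc j) e → contradiction (j , e) alone })) ⟨
        weight ℤ.* 𝟙 (compatible? E′ pin′ E′? v) ∎
-- Bond posets and proper colourings

module _ {N : ℕ} (π : Partition N) where

  block-refl : ∀ i → i ∈ block π i
  block-refl = proj₁ (isPartition π)

  block-≡ : ∀ {i j} → j ∈ block π i → block π j ≡ block π i
  block-≡ {i} {j} = proj₂ (isPartition π) i j

  block-sym : ∀ {i j} → j ∈ block π i → i ∈ block π j
  block-sym {i} j∈ = subst (i ∈_) (sym (block-≡ j∈)) (block-refl i)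

  block-trans : ∀ {i j k} → j ∈ block π i → k ∈ block π j → k ∈ block π i
  block-trans {k = k} j∈ k∈ = subst (k ∈_) (block-≡ j∈) k∈

  block-isEquivalence : IsEquivalence (λ i j → j ∈ block π i)
  block-isEquivalence = record { refl = block-refl _ ; sym = block-sym ; trans = block-trans }

module Components {N : ℕ} {R : Rel (Fin N) 0ℓ} (R? : B.Decidable R) (R-sym : B.Symmetric R) where

  private
    star? : B.Decidable (Star R)
    star? = Reachability.star? R?

    component : Fin N → Subset N
    component i = tabulate (λ j → does (star? i j))

    ∈⇒star : ∀ {i j} → j ∈ component i → Star R i j
    ∈⇒star {i} {j} j∈ = go (star? i j) (trans (sym (lookup∘tabulate _ j)) ([]=⇒lookup j∈))
      where
      go : (d : Dec (Star R i j)) → does d ≡ inside → Star R i j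
      go (yes p) _ = p

    star⇒∈ : ∀ {i j} → Star R i j → j ∈ component i
    star⇒∈ {i} {j} p = lookup⇒[]= j (component i) (trans (lookup∘tabulate _ j) (go (star? i j)))
      where
      go : (d : Dec (Star R i j)) → does d ≡ inside
      go (yes _) = refl
      go (no ¬p) = contradiction p ¬p

    lookup-component : ∀ i → lookup (tabulate component) i ≡ component i
    lookup-component = lookup∘tabulate component

    isPart : IsPartition (tabulate component)
    isPart = (λ i → subst (i ∈_) (sym (lookup-component i)) (star⇒∈ ε))
           , λ i j j∈ → let p = ∈⇒star (subst (j ∈_) (lookup-component i) j∈) in
               trans (lookup-component j) (trans (⊆-antisym
                 (λ k∈ → star⇒∈ (p ◅◅ ∈⇒star k∈))
                 (λ k∈ → star⇒∈ (reverse R-sym p ◅◅ ∈⇒star k∈)))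
               (sym (lookup-component i)))

  components : Partition N
  components = tabulate component , [ isPart ]

  block⇒star : ∀ {i j} → j ∈ block components i → Star R i j
  block⇒star {i} {j} j∈ = ∈⇒star (subst (j ∈_) (lookup-component i) j∈)

  star⇒block : ∀ {i j} → Star R i j → j ∈ block components i
  star⇒block {i} {j} p = subst (j ∈_) (sym (lookup-component i)) (star⇒∈ p)

  components-isBond : (G : Graph N) → (∀ {i j} → R i j → Graph.Adj G i j) → IsBond G components
  components-isBond G R⇒Adj i u v u∈ v∈ = go (block-sym components u∈) (reverse R-sym (block⇒star u∈) ◅◅ block⇒star v∈)
    where
    go : ∀ {a b} → i ∈ block components a → Star R a b → Star (AdjWithin G (block components i)) a b
    go i∈a ε = ε
    go {a} i∈a (_◅_ {j = c} r p) =
      (block-sym components i∈a , block-sym components i∈c , R⇒Adj r) ◅ go i∈c p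
      where
      i∈c : i ∈ block components c
      i∈c = block-trans components (star⇒block (R-sym r ◅ ε)) i∈a

-- A common setting for both posets of the theorem. `separated` and `lift` say that the elements are
-- the bond partitions with at most one pinned vertex in each block, and `top` provides an element
-- whose blocks all contain one. `pin-injective` makes the prescribed colours distinct.
module BondPoset
  {N q : ℕ} (G : Graph N) (P : FinitePoset)
  (part : FinitePoset.Carrier P → Partition N)
  (≤⇒⊑ : ∀ {x y} → FinitePoset._≤_ P x y → part x ⊑ part y)
  (⊑⇒≤ : ∀ {x y} → part x ⊑ part y → FinitePoset._≤_ P x y)
  (part-0̂ : part (FinitePoset.0̂ P) ≡ discrete N)
  (bond : ∀ x → IsBond G (part x))
  (pin : Fin N → Maybe (Fin q))
  (pin-injective : ∀ {i j c} → pin i ≡ just c → pin j ≡ just c → i ≡ j)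
  (separated : ∀ x {i j c d} → pin i ≡ just c → pin j ≡ just d → j ∈ block (part x) i → i ≡ j)
  (lift : ∀ π → IsBond G π → (∀ {i j c d} → pin i ≡ just c → pin j ≡ just d → j ∈ block π i → i ≡ j) →
          ∃ λ x → part x ≡ π)
  (top : ∃ λ x → ∀ i → ∃ λ j → ∃ λ c → j ∈ block (part x) i × pin j ≡ just c)
  where

  open FinitePoset P
  open Graph G
  open PosetProperties P
  open ConstantOnClasses {q}

  _∼[_]_ : Fin N → Carrier → Fin N → Set
  i ∼[ x ] j = j ∈ block (part x) i

  ≤⇒∼ : ∀ {x y i j} → x ≤ y → i ∼[ x ] j → i ∼[ y ] j
  ≤⇒∼ {x} {y} {i} x≤y = ⊑-blockwise (part x) (part y) (≤⇒⊑ x≤y) i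

  ∼⇒≤ : ∀ {x y} → (∀ {i j} → i ∼[ x ] j → i ∼[ y ] j) → x ≤ y
  ∼⇒≤ sub = ⊑⇒≤ λ i → i , sub

  private
    ∼-refl : ∀ x i → i ∼[ x ] i
    ∼-refl x = block-refl (part x)

    ∼-sym : ∀ x {i j} → i ∼[ x ] j → j ∼[ x ] i
    ∼-sym x = block-sym (part x)

    ∼-trans : ∀ x {i j k} → i ∼[ x ] j → j ∼[ x ] k → i ∼[ x ] k
    ∼-trans x = block-trans (part x)

    ∼? : ∀ x i j → Dec (i ∼[ x ] j)
    ∼? x i j = j ∈? block (part x) i

    _≟ᵐ_ : B.DecidableEquality (Maybe (Fin q))
    _≟ᵐ_ = ≡-decᵐ Fin._≟_

  Root : Carrier → Fin N → Set
  Root x i = ∀ j → i ∼[ x ] j → pin j ≡ nothing × j Fin.≤ i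

  root? : ∀ x → Decidable (Root x)
  root? x i = Fin.all? λ j → ∼? x i j →-dec (pin j ≟ᵐ nothing) ×-dec (j Fin.≤? i)

  -- q ^ β x is the number of colourings constant on the blocks of x with the prescribed colours,
  -- since each block without pinned points has one root.
  β : Carrier → ℕ
  β x = count (root? x)

  Unpinned : Carrier → Fin N → Set
  Unpinned x i = ∀ j → i ∼[ x ] j → pin j ≡ nothing

  unpinned? : ∀ x → Decidable (Unpinned x)
  unpinned? x i = Fin.all? λ j → ∼? x i j →-dec (pin j ≟ᵐ nothing)

  pinned : ∀ x i → ¬ Unpinned x i → ∃ λ j → ∃ λ c → i ∼[ x ] j × pin j ≡ just c
  pinned x i ¬u with Fin.any? (λ j → ∼? x i j ×-dec ¬? (pin j ≟ᵐ nothing))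
  ... | no none = contradiction (λ j i∼j → decidable-stable (pin j ≟ᵐ nothing) λ p → none (j , i∼j , p)) ¬u
  ... | yes (j , i∼j , p) with pin j in eq
  ...   | just c  = j , c , i∼j , eq
  ...   | nothing = contradiction refl p

  greatest : ∀ x i → ∃ λ r → i ∼[ x ] r × (∀ j → i ∼[ x ] j → j Fin.≤ r)
  greatest x i = go (N ∸ toℕ i) i (∼-refl x i) ℕ.≤-refl
    where
    go : ∀ n k → i ∼[ x ] k → N ∸ toℕ k ℕ.≤ n → ∃ λ r → i ∼[ x ] r × (∀ j → i ∼[ x ] j → j Fin.≤ r)
    go n k i∼k le with Fin.any? (λ j → ∼? x i j ×-dec (k Fin.<? j))
    ... | no none = k , i∼k , λ j i∼j → ℕ.≮⇒≥ λ k<j → none (j , i∼j , k<j)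
    ... | yes (j , i∼j , k<j) with n
    ...   | zero  = contradiction (ℕ.<-≤-trans (ℕ.m<n⇒0<n∸m (Fin.toℕ<n k)) le) λ ()
    ...   | suc n = go n j i∼j (ℕ.≤-pred (ℕ.<-≤-trans (ℕ.∸-monoʳ-< k<j (ℕ.<⇒≤ (Fin.toℕ<n j))) le))

  distinguish : ∀ {x y} → x < y → ∃ λ i → ∃ λ j → i ∼[ y ] j × ¬ i ∼[ x ] j
  distinguish {x} {y} (x≤y , x≢y) with Fin.any? (λ i → Fin.any? λ j → ∼? y i j ×-dec ¬? (∼? x i j))
  ... | yes w   = w
  ... | no none = contradiction (≤-antisym x≤y (∼⇒≤ λ {i} {j} i∼j → decidable-stable (∼? x i j) λ ≁ → none (i , j , i∼j , ≁))) x≢y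

  root-antitone : ∀ {x y} → x ≤ y → ∀ i → Root y i → Root x i
  root-antitone x≤y i r j i∼j = r j (≤⇒∼ x≤y i∼j)

  -- Some root of x is lost in y: a block of y that splits in x contains at most one pinned
  -- point and at most one root.
  β-strict : ∀ {x y} → x < y → β y ℕ.< β x
  β-strict {x} {y} x<y@(x≤y , _) = lose (Fin.any? λ k → root? x k ×-dec ¬? (root? y k))
    where
    module _ (stays : ∀ k → Root x k → Root y k) where
      -- If no root is lost, the root `a` of the block of `i` in `x` is also a root of `y`. Its
      -- block in `y` is therefore unpinned, so the block of `j` in `x` has a root `b` too. Both are
      -- the greatest element of one block of `y`, hence equal.
      keep : ∀ {i j} → Unpinned x i → i ∼[ y ] j → i ∼[ x ] j
      keep {i} {j} uᵢ i∼j =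
        let a , i∼a , maxᵢ = greatest x i
            b , j∼b , maxⱼ = greatest x j
            rootₐ = stays a λ k a∼k → uᵢ k (∼-trans x i∼a a∼k) , maxᵢ k (∼-trans x i∼a a∼k)
            a∼ʸj = ∼-trans y (∼-sym y (≤⇒∼ x≤y i∼a)) i∼j
            root-b = stays b λ k b∼k → proj₁ (rootₐ k (∼-trans y a∼ʸj (≤⇒∼ x≤y (∼-trans x j∼b b∼k))))
                                     , maxⱼ k (∼-trans x j∼b b∼k)
            a∼ʸb = ∼-trans y a∼ʸj (≤⇒∼ x≤y j∼b)
            a≡b = Fin.≤-antisym (proj₂ (root-b a (∼-sym y a∼ʸb))) (proj₂ (rootₐ b a∼ʸb))
        in ∼-trans x i∼a (∼-sym x (subst (j ∼[ x ]_) (sym a≡b) j∼b))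

      join : ∀ {i j} → i ∼[ y ] j → Dec (Unpinned x i) → Dec (Unpinned x j) → i ∼[ x ] j
      join i∼j (yes uᵢ) _        = keep uᵢ i∼j
      join i∼j (no _)  (yes uⱼ)  = ∼-sym x (keep uⱼ (∼-sym y i∼j))
      -- Both blocks of `x` contain a pinned vertex; these lie in one block of `y` and so coincide.
      join {i} {j} i∼j (no pᵢ) (no pⱼ) =
        let k , c , i∼k , pk = pinned x i pᵢ
            l , d , j∼l , pl = pinned x j pⱼ
            k≡l = separated y pk pl (∼-trans y (∼-sym y (≤⇒∼ x≤y i∼k)) (∼-trans y i∼j (≤⇒∼ x≤y j∼l)))
        in ∼-trans x i∼k (∼-sym x (subst (j ∼[ x ]_) (sym k≡l) j∼l))

    lose : Dec (∃ λ k → Root x k × ¬ Root y k) → β y ℕ.< β x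
    lose (yes (k , r , ¬r)) = count-strict (root? y) (root? x) (root-antitone x≤y) k ¬r r
    lose (no none) = let i , j , i∼j , i≁j = distinguish x<y in contradiction
      (join (λ k r → decidable-stable (root? y k) λ ¬r → none (k , r , ¬r)) i∼j (unpinned? x i) (unpinned? x j)) i≁j

  crossing : ∀ x {S : Subset N} {i j} → Star (AdjWithin G S) i j → ¬ i ∼[ x ] j →
             ∃ λ u → ∃ λ v → AdjWithin G S u v × ¬ u ∼[ x ] v
  crossing x ε i≁i = contradiction (∼-refl x _) i≁i
  crossing x {i = i} (_◅_ {j = k} e p) i≁j with ∼? x i k
  ... | no i≁k  = i , k , e , i≁k
  ... | yes i∼k = crossing x p (i≁j ∘ ∼-trans x i∼k)

  module Merge (x : Carrier) {u v : Fin N} (adj : Adj u v) where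

    -- The edges inside blocks of `x` together with the edge `uv`. As the blocks of `x` are
    -- connected, the components unite the blocks of `u` and `v` and keep the others; being spanned
    -- by edges of the graph, they are bonds.
    Link : Rel (Fin N) 0ℓ
    Link a b = Adj a b × (a ∼[ x ] b ⊎ (a ≡ u × b ≡ v) ⊎ (a ≡ v × b ≡ u))

    link? : B.Decidable Link
    link? a b = adj? a b ×-dec (∼? x a b ⊎-dec ((a Fin.≟ u) ×-dec (b Fin.≟ v)) ⊎-dec ((a Fin.≟ v) ×-dec (b Fin.≟ u)))

    link-sym : B.Symmetric Link
    link-sym (e , inj₁ a∼b)                      = symmetric e , inj₁ (∼-sym x a∼b)
    link-sym (e , inj₂ (inj₁ (refl , refl)))     = symmetric e , inj₂ (inj₂ (refl , refl))
    link-sym (e , inj₂ (inj₂ (refl , refl)))     = symmetric e , inj₂ (inj₁ (refl , refl))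

    Touched : Fin N → Set
    Touched a = a ∼[ x ] u ⊎ a ∼[ x ] v

    star⇒∼ˣ : ∀ {a b} → Star Link a b → a ∼[ x ] b ⊎ (Touched a × Touched b)
    star⇒∼ˣ ε = inj₁ (∼-refl x _)
    star⇒∼ˣ ((_ , inj₁ a∼c) ◅ p) =
      [ inj₁ ∘ ∼-trans x a∼c
      , (λ (t , t′) → inj₂ ([ inj₁ ∘ ∼-trans x a∼c , inj₂ ∘ ∼-trans x a∼c ]′ t , t′)) ]′ (star⇒∼ˣ p)
    star⇒∼ˣ ((_ , inj₂ (inj₁ (refl , refl))) ◅ p) =
      inj₂ (inj₁ (∼-refl x u) , [ inj₂ ∘ ∼-sym x , proj₂ ]′ (star⇒∼ˣ p))
    star⇒∼ˣ ((_ , inj₂ (inj₂ (refl , refl))) ◅ p) =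
      inj₂ (inj₂ (∼-refl x v) , [ inj₁ ∘ ∼-sym x , proj₂ ]′ (star⇒∼ˣ p))

    touched? : Decidable Touched
    touched? k = ∼? x k u ⊎-dec ∼? x k v

    module _ (z : Carrier) (∼ᶻ⇒star : ∀ {a b} → a ∼[ z ] b → Star Link a b) where

      lost-touched : ∀ k → Root x k → ¬ Root z k → Touched k
      lost-touched k r ¬r = decidable-stable (touched? k) λ ¬t →
        ¬r λ j k∼j → [ r j , (λ (t , _) → contradiction t ¬t) ]′ (star⇒∼ˣ (∼ᶻ⇒star k∼j))

      greater-root : ∀ {k l} → Root x k → Root x l → (∀ j → Touched j → k ∼[ x ] j ⊎ l ∼[ x ] j) →
                     k Fin.≤ l → Root z l
      greater-root {k} {l} rk rl cover k≤l j l∼j =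
        [ rl j , (λ (_ , t) → [ (λ k∼j → let n , j≤k = rk j k∼j in n , ℕ.≤-trans j≤k k≤l) , rl j ]′ (cover j t)) ]′
          (star⇒∼ˣ (∼ᶻ⇒star l∼j))

      opposite : ∀ {k l} → Root x k → ¬ Root z k → Root x l → ¬ Root z l →
                 (∀ j → Touched j → k ∼[ x ] j ⊎ l ∼[ x ] j) → k ≡ l
      opposite {k} {l} rk ¬rk rl ¬rl cover =
        [ (λ k≤l → contradiction (greater-root rk rl cover k≤l) ¬rl)
        , (λ l≤k → contradiction (greater-root rl rk (λ j → [ inj₂ , inj₁ ]′ ∘ cover j) l≤k) ¬rk) ]′
          (ℕ.≤-total (toℕ k) (toℕ l))

      same : ∀ {k l} → Root x k → Root x l → k ∼[ x ] l → k ≡ l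
      same {k} {l} rk rl k∼l = Fin.≤-antisym (proj₂ (rl k (∼-sym x k∼l))) (proj₂ (rk l k∼l))

      -- A lost root belongs to one of the two united blocks. If both of these have a root, the
      -- greater one is greatest in the unpinned union and survives; two lost roots must therefore
      -- come from the same block, where roots are unique.
      lost-unique : ∀ k l → Root x k → ¬ Root z k → Root x l → ¬ Root z l → k ≡ l
      lost-unique k l rk ¬rk rl ¬rl = go (lost-touched k rk ¬rk) (lost-touched l rl ¬rl)
        where
        go : Touched k → Touched l → k ≡ l
        go (inj₁ k∼u) (inj₁ l∼u) = same rk rl (∼-trans x k∼u (∼-sym x l∼u))
        go (inj₂ k∼v) (inj₂ l∼v) = same rk rl (∼-trans x k∼v (∼-sym x l∼v))
        go (inj₁ k∼u) (inj₂ l∼v) = opposite rk ¬rk rl ¬rl λ j →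
          [ (λ j∼u → inj₁ (∼-trans x k∼u (∼-sym x j∼u))) , (λ j∼v → inj₂ (∼-trans x l∼v (∼-sym x j∼v))) ]′
        go (inj₂ k∼v) (inj₁ l∼u) = opposite rk ¬rk rl ¬rl λ j →
          [ (λ j∼u → inj₂ (∼-trans x l∼u (∼-sym x j∼u))) , (λ j∼v → inj₁ (∼-trans x k∼v (∼-sym x j∼v))) ]′

  -- Some block of `y` splits in `x`. As it is connected, one of its edges joins different blocks of
  -- `x`, and merging along this edge loses at most one root. The merged partition belongs to the
  -- poset because it refines `y` and inherits the separation of pinned vertices.
  β-step : ∀ {x y} → x < y → ∃ λ z → x < z × z ≤ y × β x ℕ.≤ suc (β z)
  β-step {x} {y} x<y@(x≤y , _) =
    let i , j , i∼j , i≁j = distinguish x<y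
        u , v , (u∈ , v∈ , e) , u≁v = crossing x (bond y i i j (∼-refl y i) i∼j) i≁j
    in merge e u≁v (∼-trans y (∼-sym y u∈) v∈)
    where
    merge : ∀ {u v} → Adj u v → ¬ u ∼[ x ] v → u ∼[ y ] v → ∃ λ z → x < z × z ≤ y × β x ℕ.≤ suc (β z)
    merge {u} {v} adj u≁v u∼ʸv = assemble
      (lift components (components-isBond G proj₁) λ pᵢ pⱼ i∼j → separated y pᵢ pⱼ (link⇒∼ʸ (block⇒star i∼j)))
      where
      open Merge x adj
      open Components link? link-sym

      link⇒∼ʸ : ∀ {a b} → Star Link a b → a ∼[ y ] b
      link⇒∼ʸ ε = ∼-refl y _
      link⇒∼ʸ ((_ , inj₁ a∼b) ◅ p)                  = ∼-trans y (≤⇒∼ x≤y a∼b) (link⇒∼ʸ p)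
      link⇒∼ʸ ((_ , inj₂ (inj₁ (refl , refl))) ◅ p) = ∼-trans y u∼ʸv (link⇒∼ʸ p)
      link⇒∼ʸ ((_ , inj₂ (inj₂ (refl , refl))) ◅ p) = ∼-trans y (∼-sym y u∼ʸv) (link⇒∼ʸ p)

      assemble : (∃ λ z → part z ≡ components) → ∃ λ z → x < z × z ≤ y × β x ℕ.≤ suc (β z)
      assemble (z , eq) =
        z , (x≤z , λ { refl → u≁v (star⇒∼ᶻ ((adj , inj₂ (inj₁ (refl , refl))) ◅ ε)) })
          , ∼⇒≤ (λ a∼b → link⇒∼ʸ (∼ᶻ⇒star a∼b))
          , count-≤-suc (root? x) (root? z) (lost-unique z ∼ᶻ⇒star)
        where
        ∼ᶻ⇒star : ∀ {a b} → a ∼[ z ] b → Star Link a b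
        ∼ᶻ⇒star {a} {b} a∼b = block⇒star (subst (λ π → b ∈ block π a) eq a∼b)

        star⇒∼ᶻ : ∀ {a b} → Star Link a b → a ∼[ z ] b
        star⇒∼ᶻ {a} {b} p = subst (λ π → b ∈ block π a) (sym eq) (star⇒block p)

        x≤z : x ≤ z
        x≤z = ∼⇒≤ λ {i} i∼j → star⇒∼ᶻ (Star.map
          (λ { (a∈ , b∈ , e) → e , inj₁ (∼-trans x (∼-sym x a∈) b∈) }) (bond x i i _ (∼-refl x i) i∼j))

  β-top : ∃ λ x → β x ≡ 0
  β-top = let x , hits = top in x , count-none (root? x) λ i r →
    let j , c , i∼j , pj = hits i in contradiction (trans (sym pj) (proj₁ (r j i∼j))) λ ()

  open Corank β β-strict β-step β-top using (len∸rk)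

  -- Möbius inversion over colourings

  Constant : Carrier → Vec (Fin q) N → Set
  Constant x κ = ∀ i j → i ∼[ x ] j → lookup κ i ≡ lookup κ j

  constant? : ∀ x → Decidable (Constant x)
  constant? x κ = Fin.all? λ i → Fin.all? λ j → ∼? x i j →-dec (lookup κ i Fin.≟ lookup κ j)

  Pinned : Vec (Fin q) N → Set
  Pinned κ = ∀ i c → pin i ≡ just c → lookup κ i ≡ c

  pinned? : Decidable Pinned
  pinned? κ = Fin.all? λ i → Fin.all? λ c → (pin i ≟ᵐ just c) →-dec (lookup κ i Fin.≟ c)

  Proper : Vec (Fin q) N → Set
  Proper κ = ∀ i j → Adj i j → lookup κ i ≢ lookup κ j

  proper? : Decidable Proper
  proper? κ = Fin.all? λ i → Fin.all? λ j → adj? i j →-dec ¬? (lookup κ i Fin.≟ lookup κ j)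

  ∑-constant : ∀ x → ∑ (colourings q N) (λ κ → 𝟙 (pinned? κ) ℤ.* 𝟙 (constant? x κ)) ≡ (+ q) ℤ.^ (len ∸ rk x)
  ∑-constant x = begin
    ∑ (colourings q N) (λ κ → 𝟙 (pinned? κ) ℤ.* 𝟙 (constant? x κ))
      ≡⟨ ∑-cong (colourings q N) (λ κ → trans (sym (𝟙-× (pinned? κ) (constant? x κ)))
           (𝟙-cong (pinned? κ ×-dec constant? x κ) (compatible? _ colour (∼? x) κ)
             (λ { (p , k) → k , λ i c ci → let j , i∼j , pj = colour-just i ci in trans (k i j i∼j) (p j c pj) })
             (λ { (k , p) → (λ i c pi → p i c (just-colour pi)) , k }))) ⟩
    ∑ (colourings q N) (λ κ → 𝟙 (compatible? _ colour (∼? x) κ))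
      ≡⟨ ∑-compatible N _ (∼? x) (block-isEquivalence (part x)) colour colour-cong ⟩
    (+ q) ℤ.^ count (free? _ colour (∼? x))
      ≡⟨ cong ((+ q) ℤ.^_) (count-cong (free? _ colour (∼? x)) (root? x)
           (λ { i (n , m) j i∼j → colour-nothing i n j i∼j , m j i∼j })
           (λ i r → nothing-colour i (λ j → proj₁ ∘ r j) , λ j → proj₂ ∘ r j)) ⟩
    (+ q) ℤ.^ β x
      ≡⟨ cong ((+ q) ℤ.^_) (len∸rk x) ⟨
    (+ q) ℤ.^ (len ∸ rk x) ∎
    where
    open ≡-Reasoning

    pick : ∀ {i} → Dec (Unpinned x i) → Maybe (Fin q)
    pick (yes _)     = nothing
    pick {i} (no ¬u) = just (proj₁ (proj₂ (pinned x i ¬u)))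

    -- `∑-compatible` wants a prescription that is constant on classes, so the colour of a pinned
    -- vertex is spread over its block; by `separated` a block receives only one.
    colour : Fin N → Maybe (Fin q)
    colour i = pick (unpinned? x i)

    colour-just : ∀ i {c} → colour i ≡ just c → ∃ λ j → i ∼[ x ] j × pin j ≡ just c
    colour-just i = go (unpinned? x i)
      where
      go : ∀ {c} d → pick {i} d ≡ just c → ∃ λ j → i ∼[ x ] j × pin j ≡ just c
      go (no ¬u) refl = let j , c , i∼j , pj = pinned x i ¬u in j , i∼j , pj

    colour-nothing : ∀ i → colour i ≡ nothing → Unpinned x i
    colour-nothing i = go (unpinned? x i)
      where
      go : ∀ d → pick {i} d ≡ nothing → Unpinned x i
      go (yes u) _ = u

    nothing-colour : ∀ i → Unpinned x i → colour i ≡ nothing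
    nothing-colour i u = go (unpinned? x i)
      where
      go : ∀ d → pick {i} d ≡ nothing
      go (yes _) = refl
      go (no ¬u) = contradiction u ¬u

    pin-colour : ∀ {i j c} → i ∼[ x ] j → pin j ≡ just c → colour i ≡ just c
    pin-colour {i} {j} {c} i∼j pj with colour i in eq
    ... | nothing = contradiction (trans (sym pj) (colour-nothing i eq j i∼j)) λ ()
    ... | just d  with colour-just i eq
    ...   | k , i∼k , pk = trans (sym pk) (trans (cong pin (separated x pk pj (∼-trans x (∼-sym x i∼k) i∼j))) pj)

    just-colour : ∀ {i c} → pin i ≡ just c → colour i ≡ just c
    just-colour {i} = pin-colour (∼-refl x i)

    colour-cong : ∀ {i j} → i ∼[ x ] j → colour i ≡ colour j
    colour-cong {i} {j} i∼j with colour j in eq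
    ... | nothing = nothing-colour i λ k i∼k → colour-nothing j eq k (∼-trans x (∼-sym x i∼j) i∼k)
    ... | just c  = let k , j∼k , pk = colour-just j eq in pin-colour (∼-trans x i∼j j∼k) pk

  -- The elements on whose blocks `κ` is constant form the principal ideal below `x̂`, the partition
  -- into components of the monochromatic edges: a connected block with constant colour is joined by
  -- such edges. `x̂` belongs to the poset because distinct pinned vertices have distinct colours in
  -- `κ`.
  module Monochromatic (κ : Vec (Fin q) N) (pκ : Pinned κ) where

    Mono : Rel (Fin N) 0ℓ
    Mono a b = Adj a b × lookup κ a ≡ lookup κ b

    mono? : B.Decidable Mono
    mono? a b = adj? a b ×-dec (lookup κ a Fin.≟ lookup κ b)

    mono-sym : B.Symmetric Mono
    mono-sym (e , eq) = symmetric e , sym eq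

    open Components mono? mono-sym

    mono⇒≡ : ∀ {a b} → Star Mono a b → lookup κ a ≡ lookup κ b
    mono⇒≡ ε              = refl
    mono⇒≡ ((_ , eq) ◅ p) = trans eq (mono⇒≡ p)

    lifted : ∃ λ x → part x ≡ components
    lifted = lift components (components-isBond G proj₁) λ {i} {j} {c} {d} pᵢ pⱼ i∼j →
      pin-injective pᵢ (trans pⱼ (cong just (trans (sym (pκ j d pⱼ)) (trans (sym (mono⇒≡ (block⇒star i∼j))) (pκ i c pᵢ)))))

    x̂ : Carrier
    x̂ = proj₁ lifted

    ∼⇒mono : ∀ {a b} → a ∼[ x̂ ] b → Star Mono a b
    ∼⇒mono {a} {b} a∼b = block⇒star (subst (λ π → b ∈ block π a) (proj₂ lifted) a∼b)

    mono⇒∼ : ∀ {a b} → Star Mono a b → a ∼[ x̂ ] b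
    mono⇒∼ {a} {b} p = subst (λ π → b ∈ block π a) (sym (proj₂ lifted)) (star⇒block p)

    constant⇒≤ : ∀ {x} → Constant x κ → x ≤ x̂
    constant⇒≤ {x} k = ∼⇒≤ λ {i} {j} i∼j → mono⇒∼ (Star.map
      (λ { {a} {b} (a∈ , b∈ , e) → e , k a b (∼-trans x (∼-sym x a∈) b∈) }) (bond x i i j (∼-refl x i) i∼j))

    ≤⇒constant : ∀ {x} → x ≤ x̂ → Constant x κ
    ≤⇒constant x≤x̂ i j i∼j = mono⇒≡ (∼⇒mono (≤⇒∼ x≤x̂ i∼j))

    0̂⇒proper : x̂ ≡ 0̂ → Proper κ
    0̂⇒proper x̂≡0̂ i j e eq = irreflexive (sym (x∈⁅y⁆⇒x≡y i (subst (j ∈_) (block-discrete i)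
      (subst (λ π → j ∈ block π i) (trans (cong part x̂≡0̂) part-0̂) (mono⇒∼ ((e , eq) ◅ ε)))))) e

    proper⇒0̂ : Proper κ → x̂ ≡ 0̂
    proper⇒0̂ p = ≤-antisym (∼⇒≤ λ i∼j → stuck (∼⇒mono i∼j)) (minimum x̂)
      where
      stuck : ∀ {a b} → Star Mono a b → a ∼[ 0̂ ] b
      stuck ε                  = ∼-refl 0̂ _
      stuck ((e , eq) ◅ _) = contradiction eq (p _ _ e)

    ∑-μ-constant : ∑ elements (λ x → 𝟙 (constant? x κ) ℤ.* μ 0̂ x) ≡ 𝟙 (proper? κ)
    ∑-μ-constant = trans
      (∑-cong elements λ x → cong (ℤ._* μ 0̂ x) (𝟙-cong (constant? x κ) (x ≤? x̂) constant⇒≤ ≤⇒constant))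
      (trans (∑μ-below x̂) (𝟙-cong (x̂ ≟ 0̂) (proper? κ) 0̂⇒proper proper⇒0̂))

  ∑-μ : ∑ elements (λ x → μ 0̂ x ℤ.* (+ q) ℤ.^ (len ∸ rk x))
        ≡ ∑ (colourings q N) (λ κ → 𝟙 (pinned? κ ×-dec proper? κ))
  ∑-μ = begin
    ∑ elements (λ x → μ 0̂ x ℤ.* (+ q) ℤ.^ (len ∸ rk x))
      ≡⟨ ∑-cong elements (λ x → trans (cong (μ 0̂ x ℤ.*_) (sym (∑-constant x)))
           (sym (∑-*ˡ (colourings q N) (μ 0̂ x) (λ κ → 𝟙 (pinned? κ) ℤ.* 𝟙 (constant? x κ))))) ⟩
    ∑ elements (λ x → ∑ (colourings q N) (λ κ → μ 0̂ x ℤ.* (𝟙 (pinned? κ) ℤ.* 𝟙 (constant? x κ))))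
      ≡⟨ ∑-swap elements (colourings q N) (λ x κ → μ 0̂ x ℤ.* (𝟙 (pinned? κ) ℤ.* 𝟙 (constant? x κ))) ⟩
    ∑ (colourings q N) (λ κ → ∑ elements (λ x → μ 0̂ x ℤ.* (𝟙 (pinned? κ) ℤ.* 𝟙 (constant? x κ))))
      ≡⟨ ∑-cong (colourings q N) inner ⟩
    ∑ (colourings q N) (λ κ → 𝟙 (pinned? κ ×-dec proper? κ)) ∎
    where
    open ≡-Reasoning
    inner : ∀ κ → ∑ elements (λ x → μ 0̂ x ℤ.* (𝟙 (pinned? κ) ℤ.* 𝟙 (constant? x κ))) ≡ 𝟙 (pinned? κ ×-dec proper? κ)
    inner κ = begin
      ∑ elements (λ x → μ 0̂ x ℤ.* (𝟙 (pinned? κ) ℤ.* 𝟙 (constant? x κ)))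
        ≡⟨ ∑-cong elements (λ x → rearrange (μ 0̂ x) (𝟙 (pinned? κ)) (𝟙 (constant? x κ))) ⟩
      ∑ elements (λ x → 𝟙 (pinned? κ) ℤ.* (𝟙 (constant? x κ) ℤ.* μ 0̂ x))
        ≡⟨ ∑-*ˡ elements (𝟙 (pinned? κ)) (λ x → 𝟙 (constant? x κ) ℤ.* μ 0̂ x) ⟩
      𝟙 (pinned? κ) ℤ.* ∑ elements (λ x → 𝟙 (constant? x κ) ℤ.* μ 0̂ x)
        -- Only a pinned `κ` has an element `x̂`; the indicator in front supplies this hypothesis.
        ≡⟨ 𝟙-*-cong (pinned? κ) (Monochromatic.∑-μ-constant κ) ⟩
      𝟙 (pinned? κ) ℤ.* 𝟙 (proper? κ)
        ≡⟨ 𝟙-× (pinned? κ) (proper? κ) ⟨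
      𝟙 (pinned? κ ×-dec proper? κ) ∎
      where
      rearrange : ∀ a b c → a ℤ.* (b ℤ.* c) ≡ b ℤ.* (c ℤ.* a)
      rearrange a b c = trans (ℤ.*-comm a (b ℤ.* c)) (ℤ.*-assoc b c a)
-- Counting colourings of Γ V vertex by vertex

∑-allFin-suc : ∀ q (f : Fin (suc q) → ℤ) → ∑ (allFin (suc q)) f ≡ f zero ℤ.+ ∑ (allFin q) (f ∘ suc)
∑-allFin-suc q f = cong (λ s → f zero ℤ.+ s)
  (trans (cong (λ xs → ∑ xs f) (sym (map-tabulate id suc))) (∑-map suc (allFin q) f))

∑-∈ : ∀ {q} (S : Subset q) → ∑ (allFin q) (λ x → 𝟙 (x ∈? S)) ≡ + ∣ S ∣
∑-∈ {zero}  []      = refl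
∑-∈ {suc q} (s ∷ S) = trans (∑-allFin-suc q (λ x → 𝟙 (x ∈? (s ∷ S)))) (trans
  (cong (λ z → 𝟙 (zero ∈? (s ∷ S)) ℤ.+ z)
    (trans (∑-cong (allFin q) λ x → 𝟙-cong (suc x ∈? (s ∷ S)) (x ∈? S) (λ { (Vec.there p) → p }) Vec.there) (∑-∈ S)))
  (head s))
  where
  head : ∀ s → 𝟙 (zero ∈? (s ∷ S)) ℤ.+ + ∣ S ∣ ≡ + ∣ s ∷ S ∣
  head inside  = refl
  head outside = refl

module _ {q : ℕ} where

  ∪-absorb : ∀ {S : Subset q} {x} → x ∈ S → S ∪ ⁅ x ⁆ ≡ S
  ∪-absorb {S} {x} x∈S = ⊆-antisym
    (λ {y} y∈ → [ id , (λ y∈x → subst (_∈ S) (sym (x∈⁅y⁆⇒x≡y x y∈x)) x∈S) ]′ (x∈p∪q⁻ S ⁅ x ⁆ y∈))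
    (p⊆p∪q ⁅ x ⁆)

  ∣∪⁅⁆∣ : ∀ {S : Subset q} {x} → x ∉ S → + ∣ S ∪ ⁅ x ⁆ ∣ ≡ + ∣ S ∣ ℤ.+ 1ℤ
  ∣∪⁅⁆∣ {S} {x} x∉S = begin
    + ∣ S ∪ ⁅ x ⁆ ∣
      ≡⟨ ∑-∈ (S ∪ ⁅ x ⁆) ⟨
    ∑ (allFin q) (λ y → 𝟙 (y ∈? (S ∪ ⁅ x ⁆)))
      ≡⟨ ∑-cong (allFin q) (λ y → split y (y ∈? (S ∪ ⁅ x ⁆)) (y ∈? S) (y Fin.≟ x)) ⟩
    ∑ (allFin q) (λ y → 𝟙 (y ∈? S) ℤ.+ 1ℤ ℤ.* 𝟙 (y Fin.≟ x))
      ≡⟨ ∑-+ (allFin q) (λ y → 𝟙 (y ∈? S)) (λ y → 1ℤ ℤ.* 𝟙 (y Fin.≟ x)) ⟩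
    ∑ (allFin q) (λ y → 𝟙 (y ∈? S)) ℤ.+ ∑ (allFin q) (λ y → 1ℤ ℤ.* 𝟙 (y Fin.≟ x))
      ≡⟨ cong₂ ℤ._+_ (∑-∈ S) (∑-allFin-pick q x 1ℤ) ⟩
    + ∣ S ∣ ℤ.+ 1ℤ ∎
    where
    open ≡-Reasoning
    split : ∀ y (a : Dec (y ∈ S ∪ ⁅ x ⁆)) (b : Dec (y ∈ S)) (c : Dec (y ≡ x)) → 𝟙 a ≡ 𝟙 b ℤ.+ 1ℤ ℤ.* 𝟙 c
    split y a (yes y∈S) (yes refl) = contradiction y∈S x∉S
    split y a (yes y∈S) (no _)     = 𝟙-yes a (x∈p∪q⁺ (inj₁ y∈S))
    split y a (no _)    (yes refl) = 𝟙-yes a (x∈p∪q⁺ (inj₂ (x∈⁅x⁆ y)))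
    split y a (no y∉S)  (no y≢x)   = 𝟙-no a λ y∈ → [ y∉S , y≢x ∘ x∈⁅y⁆⇒x≡y x ]′ (x∈p∪q⁻ S ⁅ x ⁆ y∈)

  ∑-∉ : ∀ (S : Subset q) → ∑ (allFin q) (λ x → 𝟙 (¬? (x ∈? S))) ≡ + q ℤ.- + ∣ S ∣
  ∑-∉ S = begin
    ∑ (allFin q) (λ x → 𝟙 (¬? (x ∈? S)))
      ≡⟨ ∑-cong (allFin q) (λ x → trans (𝟙-¬ (x ∈? S)) (cong (λ z → 1ℤ ℤ.+ z) (sym (ℤ.-1*i≡-i (𝟙 (x ∈? S)))))) ⟩
    ∑ (allFin q) (λ x → 1ℤ ℤ.+ ℤ.-1ℤ ℤ.* 𝟙 (x ∈? S))
      ≡⟨ ∑-+ (allFin q) (λ _ → 1ℤ) (λ x → ℤ.-1ℤ ℤ.* 𝟙 (x ∈? S)) ⟩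
    ∑ (allFin q) (λ _ → 1ℤ) ℤ.+ ∑ (allFin q) (λ x → ℤ.-1ℤ ℤ.* 𝟙 (x ∈? S))
      ≡⟨ cong₂ ℤ._+_ (trans (∑-allFin-const q 1ℤ) (ℤ.*-identityʳ (+ q)))
           (trans (∑-*ˡ (allFin q) ℤ.-1ℤ (λ x → 𝟙 (x ∈? S))) (trans (cong (ℤ.-1ℤ ℤ.*_) (∑-∈ S)) (ℤ.-1*i≡-i (+ ∣ S ∣)))) ⟩
    + q ℤ.- + ∣ S ∣ ∎
    where open ≡-Reasoning

  -- One odd vertex is coloured: a colour from `S` leaves the set of used colours as it is, any
  -- other one enlarges it. It is applied to functions of the size of `S`, with `A` and `B` their
  -- values at the two levels that a step of the walk can reach.
  ∑-insert : ∀ (f : Subset q → ℤ) S A B →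
    (∀ x → x ∉ S → f (S ∪ ⁅ x ⁆) ≡ B) → f S ≡ A →
    ∑ (allFin q) (λ x → f (S ∪ ⁅ x ⁆)) ≡ + ∣ S ∣ ℤ.* A ℤ.+ (+ q ℤ.- + ∣ S ∣) ℤ.* B
  ∑-insert f S A B new old = begin
    ∑ (allFin q) (λ x → f (S ∪ ⁅ x ⁆))
      ≡⟨ ∑-cong (allFin q) (λ x → split x (x ∈? S)) ⟩
    ∑ (allFin q) (λ x → 𝟙 (x ∈? S) ℤ.* A ℤ.+ 𝟙 (¬? (x ∈? S)) ℤ.* B)
      ≡⟨ ∑-+ (allFin q) (λ x → 𝟙 (x ∈? S) ℤ.* A) (λ x → 𝟙 (¬? (x ∈? S)) ℤ.* B) ⟩
    ∑ (allFin q) (λ x → 𝟙 (x ∈? S) ℤ.* A) ℤ.+ ∑ (allFin q) (λ x → 𝟙 (¬? (x ∈? S)) ℤ.* B)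
      ≡⟨ cong₂ ℤ._+_ (trans (∑-*ʳ (allFin q) A (λ x → 𝟙 (x ∈? S))) (cong (ℤ._* A) (∑-∈ S)))
                     (trans (∑-*ʳ (allFin q) B (λ x → 𝟙 (¬? (x ∈? S)))) (cong (ℤ._* B) (∑-∉ S))) ⟩
    + ∣ S ∣ ℤ.* A ℤ.+ (+ q ℤ.- + ∣ S ∣) ℤ.* B ∎
    where
    open ≡-Reasoning
    split : ∀ x (d : Dec (x ∈ S)) → f (S ∪ ⁅ x ⁆) ≡ 𝟙 d ℤ.* A ℤ.+ 𝟙 (¬? d) ℤ.* B
    split x (yes x∈S) = trans (trans (cong f (∪-absorb x∈S)) old)
      (Z.solve 2 (λ a b → a Z.:= Z.con 1ℤ Z.:* a Z.:+ Z.con 0ℤ Z.:* b) refl A B)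
    split x (no x∉S) = trans (new x x∉S)
      (Z.solve 2 (λ a b → b Z.:= Z.con 0ℤ Z.:* a Z.:+ Z.con 1ℤ Z.:* b) refl A B)

-- Recursion over pairs of consecutive vertices

-- The parity of the successor is included because the vertices are consumed in pairs `v`, `suc v`.
Odd : ℕ → Set
Odd v = ¬ (2 ∣ v) × (2 ∣ suc v)

odd-2+ : ∀ {v} → Odd v → Odd (2 ℕ.+ v)
odd-2+ (odd , even) = (λ d → odd (∣m+n∣m⇒∣n d ∣-refl)) , ∣m∣n⇒∣m+n ∣-refl even

-- The integer counterpart of `walks`, started at level `k`. An explicit level in ℤ makes the
-- comparison with a pair of vertices an identity for the ring solver.
weight : ℤ → ℤ → ℕ → ℤ
weight z k zero    = 1ℤ
weight z k (suc n) = k ℤ.* (z ℤ.- k) ℤ.* weight z k n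
                 ℤ.+ (z ℤ.- 1ℤ ℤ.- k) ℤ.* (z ℤ.- 1ℤ ℤ.- k) ℤ.* weight z (k ℤ.+ 1ℤ) n

module Colouring {q : ℕ} (pin : ℕ → Maybe (Fin q)) where

  Allowed : ℕ → Fin q → Set
  Allowed v x = ∀ c → pin v ≡ just c → x ≡ c

  allowed? : ∀ v → Decidable (Allowed v)
  allowed? v x = Fin.all? λ c → ≡-decᵐ Fin._≟_ (pin v) (just c) →-dec (x Fin.≟ c)

  -- Colourings with prescribed colours, proper on Γ V, whose even vertices avoid the colours in S.
  Good : ∀ V → Subset q → Vec (Fin q) (length V) → Set
  Good V S κ = (∀ i → Allowed (List.lookup V i) (lookup κ i))
             × (∀ i j → Edge (List.lookup V i) (List.lookup V j) → lookup κ i ≢ lookup κ j)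
             × (∀ i → 2 ∣ List.lookup V i → lookup κ i ∉ S)

  good? : ∀ V S → Decidable (Good V S)
  good? V S κ = Fin.all? (λ i → allowed? (List.lookup V i) (lookup κ i))
          ×-dec Fin.all? (λ i → Fin.all? λ j → edge? (List.lookup V i) (List.lookup V j) →-dec ¬? (lookup κ i Fin.≟ lookup κ j))
          ×-dec Fin.all? (λ i → (2 ∣? List.lookup V i) →-dec ¬? (lookup κ i ∈? S))

  -- Counts the good colourings by colouring the vertices in order; S collects the colours
  -- of the odd vertices.
  run : List ℕ → Subset q → ℤ
  branch : ∀ {v} → Dec (2 ∣ v) → List ℕ → Subset q → Fin q → ℤ
  run []      S = 1ℤ
  run (v ∷ V) S = ∑ (allFin q) (λ x → 𝟙 (allowed? v x) ℤ.* branch (2 ∣? v) V S x)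
  branch (yes _) V S x = 𝟙 (¬? (x ∈? S)) ℤ.* run V S
  branch (no _)  V S x = run V (S ∪ ⁅ x ⁆)

  -- An edge leads from an odd vertex to a larger even one. In a sorted list the first vertex
  -- therefore constrains the later ones only if it is odd, and then only by forbidding its colour
  -- to all later even vertices, which is what `S` records.
  ∑-good : ∀ V → AllPairs ℕ._<_ V → ∀ S → ∑ (colourings q (length V)) (λ κ → 𝟙 (good? V S κ)) ≡ run V S
  ∑-good [] _ S = trans (ℤ.+-identityʳ (𝟙 (good? [] S []))) (𝟙-yes (good? [] S []) ((λ ()) , (λ ()) , λ ()))
  ∑-good (v ∷ V) (v< ∷ sorted) S =
    trans (∑-cartesianProductWith _∷_ (allFin q) (colourings q (length V)) (λ κ → 𝟙 (good? (v ∷ V) S κ)))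
      (∑-cong (allFin q) λ x → head x (2 ∣? v))
    where
    open ≡-Reasoning

    v<lookup : ∀ i → v ℕ.< List.lookup V i
    v<lookup i = All.lookup v< (∈-lookup i)

    head : ∀ x (d : Dec (2 ∣ v)) →
      ∑ (colourings q (length V)) (λ κ → 𝟙 (good? (v ∷ V) S (x ∷ κ))) ≡ 𝟙 (allowed? v x) ℤ.* branch d V S x
    head x (yes even) = begin
      ∑ (colourings q (length V)) (λ κ → 𝟙 (good? (v ∷ V) S (x ∷ κ)))
        ≡⟨ ∑-cong (colourings q (length V)) (λ κ → trans
             (𝟙-cong (good? (v ∷ V) S (x ∷ κ)) ((allowed? v x ×-dec ¬? (x ∈? S)) ×-dec good? V S κ)
               (λ { (a , e , s) → (a zero , s zero even) , a ∘ suc , (λ i j → e (suc i) (suc j)) , s ∘ suc })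
               (λ { ((a₀ , x∉S) , a , e , s) →
                    (λ { zero → a₀ ; (suc i) → a i })
                  , (λ { zero    j       (_ , odd , _) _ → odd even
                       ; (suc i) zero    (lt , _)      _ → ℕ.<-asym lt (v<lookup i)
                       ; (suc i) (suc j) edge            → e i j edge })
                  , (λ { zero _ → x∉S ; (suc i) → s i }) }))
             (𝟙-× (allowed? v x ×-dec ¬? (x ∈? S)) (good? V S κ))) ⟩
      ∑ (colourings q (length V)) (λ κ → 𝟙 (allowed? v x ×-dec ¬? (x ∈? S)) ℤ.* 𝟙 (good? V S κ))
        ≡⟨ ∑-*ˡ (colourings q (length V)) (𝟙 (allowed? v x ×-dec ¬? (x ∈? S))) (λ κ → 𝟙 (good? V S κ)) ⟩
      𝟙 (allowed? v x ×-dec ¬? (x ∈? S)) ℤ.* ∑ (colourings q (length V)) (λ κ → 𝟙 (good? V S κ))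
        ≡⟨ cong₂ ℤ._*_ (𝟙-× (allowed? v x) (¬? (x ∈? S))) (∑-good V sorted S) ⟩
      (𝟙 (allowed? v x) ℤ.* 𝟙 (¬? (x ∈? S))) ℤ.* run V S
        ≡⟨ ℤ.*-assoc (𝟙 (allowed? v x)) (𝟙 (¬? (x ∈? S))) (run V S) ⟩
      𝟙 (allowed? v x) ℤ.* (𝟙 (¬? (x ∈? S)) ℤ.* run V S) ∎
    head x (no odd) = begin
      ∑ (colourings q (length V)) (λ κ → 𝟙 (good? (v ∷ V) S (x ∷ κ)))
        ≡⟨ ∑-cong (colourings q (length V)) (λ κ → trans
             (𝟙-cong (good? (v ∷ V) S (x ∷ κ)) (allowed? v x ×-dec good? V (S ∪ ⁅ x ⁆) κ)
               (λ { (a , e , s) → a zero , a ∘ suc , (λ i j → e (suc i) (suc j))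
                  , λ i even κᵢ∈ → [ s (suc i) even
                                   , (λ κᵢ∈x → e zero (suc i) (v<lookup i , odd , even) (sym (x∈⁅y⁆⇒x≡y x κᵢ∈x))) ]′
                                   (x∈p∪q⁻ S ⁅ x ⁆ κᵢ∈) })
               (λ { (a₀ , a , e , s) →
                    (λ { zero → a₀ ; (suc i) → a i })
                  , (λ { zero    zero    (lt , _)       _  → ℕ.<-irrefl refl lt
                       ; zero    (suc j) (_ , _ , even) eq → s j even (x∈p∪q⁺ (inj₂ (subst (_∈ ⁅ x ⁆) eq (x∈⁅x⁆ x))))
                       ; (suc i) zero    (lt , _)       _  → ℕ.<-asym lt (v<lookup i)
                       ; (suc i) (suc j) edge              → e i j edge })
                  , (λ { zero even → contradiction even odd
                       ; (suc i) even κᵢ∈S → s i even (x∈p∪q⁺ (inj₁ κᵢ∈S)) }) }))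
             (𝟙-× (allowed? v x) (good? V (S ∪ ⁅ x ⁆) κ))) ⟩
      ∑ (colourings q (length V)) (λ κ → 𝟙 (allowed? v x) ℤ.* 𝟙 (good? V (S ∪ ⁅ x ⁆) κ))
        ≡⟨ ∑-*ˡ (colourings q (length V)) (𝟙 (allowed? v x)) (λ κ → 𝟙 (good? V (S ∪ ⁅ x ⁆) κ)) ⟩
      𝟙 (allowed? v x) ℤ.* ∑ (colourings q (length V)) (λ κ → 𝟙 (good? V (S ∪ ⁅ x ⁆) κ))
        ≡⟨ cong (𝟙 (allowed? v x) ℤ.*_) (∑-good V sorted (S ∪ ⁅ x ⁆)) ⟩
      𝟙 (allowed? v x) ℤ.* run V (S ∪ ⁅ x ⁆) ∎

  allowed-free : ∀ {v} → pin v ≡ nothing → ∀ x → 𝟙 (allowed? v x) ≡ 1ℤ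
  allowed-free {v} p x = 𝟙-yes (allowed? v x) λ c e → contradiction (trans (sym p) e) λ ()

  allowed-pinned : ∀ {v c} → pin v ≡ just c → ∀ x → 𝟙 (allowed? v x) ≡ 𝟙 (x Fin.≟ c)
  allowed-pinned {v} {c} p x = 𝟙-cong (allowed? v x) (x Fin.≟ c) (λ a → a c p) (λ { refl d e → just-injective (trans (sym p) e) })

  branch-odd : ∀ {v} → ¬ (2 ∣ v) → (d : Dec (2 ∣ v)) → ∀ V S x → branch d V S x ≡ run V (S ∪ ⁅ x ⁆)
  branch-odd odd (yes even) V S x = contradiction even odd
  branch-odd odd (no _)     V S x = refl

  branch-even : ∀ {v} → 2 ∣ v → (d : Dec (2 ∣ v)) → ∀ V S x → branch d V S x ≡ 𝟙 (¬? (x ∈? S)) ℤ.* run V S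
  branch-even even (yes _)  V S x = refl
  branch-even even (no odd) V S x = contradiction even odd

  run-odd : ∀ {v} V S → ¬ (2 ∣ v) → pin v ≡ nothing → run (v ∷ V) S ≡ ∑ (allFin q) (λ x → run V (S ∪ ⁅ x ⁆))
  run-odd {v} V S odd p = ∑-cong (allFin q) λ x →
    trans (cong₂ ℤ._*_ (allowed-free p x) (branch-odd odd (2 ∣? v) V S x)) (ℤ.*-identityˡ _)

  run-even : ∀ {v} V S → 2 ∣ v → pin v ≡ nothing → run (v ∷ V) S ≡ (+ q ℤ.- + ∣ S ∣) ℤ.* run V S
  run-even {v} V S even p = trans
    (∑-cong (allFin q) λ x → trans (cong₂ ℤ._*_ (allowed-free p x) (branch-even even (2 ∣? v) V S x)) (ℤ.*-identityˡ _))
    (trans (∑-*ʳ (allFin q) (run V S) (λ x → 𝟙 (¬? (x ∈? S)))) (cong (ℤ._* run V S) (∑-∉ S)))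

  run-odd-pinned : ∀ {v c} V S → ¬ (2 ∣ v) → pin v ≡ just c → run (v ∷ V) S ≡ run V (S ∪ ⁅ c ⁆)
  run-odd-pinned {v} {c} V S odd p = trans
    (∑-cong (allFin q) λ x → cong₂ ℤ._*_ (allowed-pinned p x) (branch-odd odd (2 ∣? v) V S x))
    (∑-allFin-delta q c (λ x → run V (S ∪ ⁅ x ⁆)))

  run-even-pinned : ∀ {v c} V S → 2 ∣ v → pin v ≡ just c → run (v ∷ V) S ≡ 𝟙 (¬? (c ∈? S)) ℤ.* run V S
  run-even-pinned {v} {c} V S even p = trans
    (∑-cong (allFin q) λ x → cong₂ ℤ._*_ (allowed-pinned p x) (branch-even even (2 ∣? v) V S x))
    (∑-allFin-delta q c (λ x → 𝟙 (¬? (x ∈? S)) ℤ.* run V S))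

  run-pair : ∀ {v w} V S → ¬ (2 ∣ v) → pin v ≡ nothing → 2 ∣ w → pin w ≡ nothing →
             run (v ∷ w ∷ V) S ≡ ∑ (allFin q) (λ x → (+ q ℤ.- + ∣ S ∪ ⁅ x ⁆ ∣) ℤ.* run V (S ∪ ⁅ x ⁆))
  run-pair {v} {w} V S odd pv even pw =
    trans (run-odd (w ∷ V) S odd pv) (∑-cong (allFin q) λ x → run-even V (S ∪ ⁅ x ⁆) even pw)

-- v, v+1, …, v+2n+1
fullList : ℕ → ℕ → List ℕ
fullList v zero    = v ∷ suc v ∷ []
fullList v (suc n) = v ∷ suc v ∷ fullList (2 ℕ.+ v) n

last : ℕ → ℕ → ℕ
last v zero    = suc v
last v (suc n) = last (2 ℕ.+ v) n

-- v, v+1, …, v+2n-1, v+2n+1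
gapList : ℕ → ℕ → List ℕ
gapList v zero    = suc v ∷ []
gapList v (suc n) = v ∷ suc v ∷ gapList (2 ℕ.+ v) n

<last : ∀ v n → v ℕ.< last v n
<last v zero    = ℕ.≤-refl
<last v (suc n) = ℕ.<-trans (ℕ.m<n+m v {2} (s≤s z≤n)) (<last (2 ℕ.+ v) n)

suc<last : ∀ v n → suc v ℕ.< last v (suc n)
suc<last v n = ℕ.<-trans ℕ.≤-refl (<last (2 ℕ.+ v) n)

module _ {q : ℕ} (pin : ℕ → Maybe (Fin q)) where
  open Colouring pin

  -- A pair keeps `k` in `k (q − k)` ways and raises it in `(q − k)(q − 1 − k)` ways. Dividing the
  -- count at level `k` by `q − k` turns the raising weight into the square `(q − 1 − k)²`. The last
  -- pair gives `k (q − k) + (q − k)(q − 1 − k) = (q − 1)(q − k)`, whence the factor `q − 1`.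
  run-full : ∀ n v → Odd v → (∀ w → v ℕ.≤ w → pin w ≡ nothing) → ∀ S →
    run (fullList v n) S ≡ (+ q ℤ.- 1ℤ) ℤ.* (+ q ℤ.- + ∣ S ∣) ℤ.* weight (+ q) (+ ∣ S ∣) n
  run-full zero v (odd , even) free S = begin
    run (v ∷ suc v ∷ []) S
      ≡⟨ run-pair [] S odd (free v ℕ.≤-refl) even (free (suc v) (ℕ.n≤1+n v)) ⟩
    ∑ (allFin q) (λ x → (+ q ℤ.- + ∣ S ∪ ⁅ x ⁆ ∣) ℤ.* 1ℤ)
      ≡⟨ ∑-insert (λ T → (+ q ℤ.- + ∣ T ∣) ℤ.* 1ℤ) S ((+ q ℤ.- k) ℤ.* 1ℤ) ((+ q ℤ.- (k ℤ.+ 1ℤ)) ℤ.* 1ℤ)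
           (λ x x∉S → cong (λ c → (+ q ℤ.- c) ℤ.* 1ℤ) (∣∪⁅⁆∣ x∉S)) refl ⟩
    k ℤ.* ((+ q ℤ.- k) ℤ.* 1ℤ) ℤ.+ (+ q ℤ.- k) ℤ.* ((+ q ℤ.- (k ℤ.+ 1ℤ)) ℤ.* 1ℤ)
      ≡⟨ Z.solve 2 (λ q k → k Z.:* ((q Z.:- k) Z.:* Z.con 1ℤ) Z.:+ (q Z.:- k) Z.:* ((q Z.:- (k Z.:+ Z.con 1ℤ)) Z.:* Z.con 1ℤ)
             Z.:= (q Z.:- Z.con 1ℤ) Z.:* (q Z.:- k) Z.:* Z.con 1ℤ) refl (+ q) k ⟩
    (+ q ℤ.- 1ℤ) ℤ.* (+ q ℤ.- k) ℤ.* 1ℤ ∎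
    where
    open ≡-Reasoning
    k = + ∣ S ∣
  run-full (suc n) v vOdd@(odd , even) free S = begin
    run (v ∷ suc v ∷ fullList (2 ℕ.+ v) n) S
      ≡⟨ run-pair (fullList (2 ℕ.+ v) n) S odd (free v ℕ.≤-refl) even (free (suc v) (ℕ.n≤1+n v)) ⟩
    ∑ (allFin q) (λ x → (+ q ℤ.- + ∣ S ∪ ⁅ x ⁆ ∣) ℤ.* run (fullList (2 ℕ.+ v) n) (S ∪ ⁅ x ⁆))
      ≡⟨ ∑-cong (allFin q) (λ x → cong ((+ q ℤ.- + ∣ S ∪ ⁅ x ⁆ ∣) ℤ.*_)
           (run-full n (2 ℕ.+ v) (odd-2+ vOdd) (λ w le → free w (ℕ.≤-trans (ℕ.m≤n+m v 2) le)) (S ∪ ⁅ x ⁆))) ⟩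
    ∑ (allFin q) (λ x → g (+ ∣ S ∪ ⁅ x ⁆ ∣))
      ≡⟨ ∑-insert (λ T → g (+ ∣ T ∣)) S (g k) (g (k ℤ.+ 1ℤ)) (λ x x∉S → cong g (∣∪⁅⁆∣ x∉S)) refl ⟩
    k ℤ.* g k ℤ.+ (+ q ℤ.- k) ℤ.* g (k ℤ.+ 1ℤ)
      ≡⟨ Z.solve 4 (λ q k a b →
             k Z.:* ((q Z.:- k) Z.:* ((q Z.:- Z.con 1ℤ) Z.:* (q Z.:- k) Z.:* a))
               Z.:+ (q Z.:- k) Z.:* ((q Z.:- (k Z.:+ Z.con 1ℤ)) Z.:* ((q Z.:- Z.con 1ℤ) Z.:* (q Z.:- (k Z.:+ Z.con 1ℤ)) Z.:* b))
             Z.:= (q Z.:- Z.con 1ℤ) Z.:* (q Z.:- k) Z.:*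
               (k Z.:* (q Z.:- k) Z.:* a Z.:+ (q Z.:- Z.con 1ℤ Z.:- k) Z.:* (q Z.:- Z.con 1ℤ Z.:- k) Z.:* b))
           refl (+ q) k (weight (+ q) k n) (weight (+ q) (k ℤ.+ 1ℤ) n) ⟩
    (+ q ℤ.- 1ℤ) ℤ.* (+ q ℤ.- k) ℤ.* weight (+ q) k (suc n) ∎
    where
    open ≡-Reasoning
    k = + ∣ S ∣
    g : ℤ → ℤ
    g m = (+ q ℤ.- m) ℤ.* ((+ q ℤ.- 1ℤ) ℤ.* (+ q ℤ.- m) ℤ.* weight (+ q) m n)

  module _ (b : Fin q) where

    -- The last vertex is even and must take the colour `b`, which an earlier odd vertex has already
    -- used.
    run-gap-∈ : ∀ n v → Odd v → (∀ w → v ℕ.≤ w → w ≢ last v n → pin w ≡ nothing) → pin (last v n) ≡ just b →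
                ∀ S → b ∈ S → run (gapList v n) S ≡ 0ℤ
    run-gap-∈ zero v (odd , even) free pb S b∈S =
      trans (run-even-pinned [] S even pb) (cong (ℤ._* 1ℤ) (𝟙-no (¬? (b ∈? S)) λ b∉S → b∉S b∈S))
    run-gap-∈ (suc n) v vOdd@(odd , even) free pb S b∈S = trans
      (run-pair (gapList (2 ℕ.+ v) n) S odd (free v ℕ.≤-refl (ℕ.<⇒≢ (<last v (suc n))))
         even (free (suc v) (ℕ.n≤1+n v) (ℕ.<⇒≢ (suc<last v n))))
      (trans (∑-cong (allFin q) λ x → trans
         (cong ((+ q ℤ.- + ∣ S ∪ ⁅ x ⁆ ∣) ℤ.*_)
           (run-gap-∈ n (2 ℕ.+ v) (odd-2+ vOdd) (λ w le → free w (ℕ.≤-trans (ℕ.m≤n+m v 2) le)) pb (S ∪ ⁅ x ⁆) (x∈p∪q⁺ (inj₁ b∈S))))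
         (ℤ.*-zeroʳ (+ q ℤ.- + ∣ S ∪ ⁅ x ⁆ ∣)))
       (∑-zero (allFin q)))

    -- By `run-gap-∈` a new colour for an odd vertex must also differ from `b`, which leaves
    -- `q − 1 − k` choices. The even vertex after it has as many, `b` being allowed there: hence the
    -- square.
    run-gap-∉ : ∀ n v → Odd v → (∀ w → v ℕ.≤ w → w ≢ last v n → pin w ≡ nothing) → pin (last v n) ≡ just b →
                ∀ S → b ∉ S → run (gapList v n) S ≡ weight (+ q) (+ ∣ S ∣) n
    run-gap-∉ zero v (odd , even) free pb S b∉S =
      trans (run-even-pinned [] S even pb) (cong (ℤ._* 1ℤ) (𝟙-yes (¬? (b ∈? S)) b∉S))
    run-gap-∉ (suc n) v vOdd@(odd , even) free pb S b∉S = begin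
      run (v ∷ suc v ∷ gapList (2 ℕ.+ v) n) S
        ≡⟨ run-pair (gapList (2 ℕ.+ v) n) S odd (free v ℕ.≤-refl (ℕ.<⇒≢ (<last v (suc n))))
             even (free (suc v) (ℕ.n≤1+n v) (ℕ.<⇒≢ (suc<last v n))) ⟩
      ∑ (allFin q) (λ x → g (S ∪ ⁅ x ⁆))
        ≡⟨ ∑-cong (allFin q) (λ x → split x (x ∈? S) (x Fin.≟ b)) ⟩
      -- `h` treats `b` like any other new colour, so that `∑-insert` applies; the correction takes
      -- back its contribution `B`, the true one being 0.
      ∑ (allFin q) (λ x → h (S ∪ ⁅ x ⁆) ℤ.+ (ℤ.- B) ℤ.* 𝟙 (x Fin.≟ b))
        ≡⟨ ∑-+ (allFin q) (λ x → h (S ∪ ⁅ x ⁆)) (λ x → (ℤ.- B) ℤ.* 𝟙 (x Fin.≟ b)) ⟩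
      ∑ (allFin q) (λ x → h (S ∪ ⁅ x ⁆)) ℤ.+ ∑ (allFin q) (λ x → (ℤ.- B) ℤ.* 𝟙 (x Fin.≟ b))
        ≡⟨ cong₂ ℤ._+_ (∑-insert h S A B (λ x x∉S → cong (λ m → (+ q ℤ.- m) ℤ.* weight (+ q) m n) (∣∪⁅⁆∣ x∉S)) refl)
                       (∑-allFin-pick q b (ℤ.- B)) ⟩
      (k ℤ.* A ℤ.+ (+ q ℤ.- k) ℤ.* B) ℤ.+ ℤ.- B
        ≡⟨ Z.solve 4 (λ q k a b →
               (k Z.:* ((q Z.:- k) Z.:* a) Z.:+ (q Z.:- k) Z.:* ((q Z.:- (k Z.:+ Z.con 1ℤ)) Z.:* b)) Z.:+ Z.:- ((q Z.:- (k Z.:+ Z.con 1ℤ)) Z.:* b)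
               Z.:= k Z.:* (q Z.:- k) Z.:* a Z.:+ (q Z.:- Z.con 1ℤ Z.:- k) Z.:* (q Z.:- Z.con 1ℤ Z.:- k) Z.:* b)
             refl (+ q) k (weight (+ q) k n) (weight (+ q) (k ℤ.+ 1ℤ) n) ⟩
      weight (+ q) k (suc n) ∎
      where
      open ≡-Reasoning
      k A B : ℤ
      k = + ∣ S ∣
      A = (+ q ℤ.- k) ℤ.* weight (+ q) k n
      B = (+ q ℤ.- (k ℤ.+ 1ℤ)) ℤ.* weight (+ q) (k ℤ.+ 1ℤ) n
      g h : Subset q → ℤ
      g T = (+ q ℤ.- + ∣ T ∣) ℤ.* run (gapList (2 ℕ.+ v) n) T
      h T = (+ q ℤ.- + ∣ T ∣) ℤ.* weight (+ q) (+ ∣ T ∣) n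
      free′ : ∀ w → 2 ℕ.+ v ℕ.≤ w → w ≢ last v (suc n) → pin w ≡ nothing
      free′ w le = free w (ℕ.≤-trans (ℕ.m≤n+m v 2) le)
      g≡h : ∀ T → b ∉ T → g T ≡ h T
      g≡h T b∉T = cong ((+ q ℤ.- + ∣ T ∣) ℤ.*_) (run-gap-∉ n (2 ℕ.+ v) (odd-2+ vOdd) free′ pb T b∉T)
      plain : ∀ x → x ≢ b → g (S ∪ ⁅ x ⁆) ≡ h (S ∪ ⁅ x ⁆) ℤ.+ (ℤ.- B) ℤ.* 0ℤ
      plain x x≢b = trans
        (g≡h (S ∪ ⁅ x ⁆) λ b∈ → [ b∉S , x≢b ∘ sym ∘ x∈⁅y⁆⇒x≡y x ]′ (x∈p∪q⁻ S ⁅ x ⁆ b∈))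
        (sym (trans (cong (λ z → h (S ∪ ⁅ x ⁆) ℤ.+ z) (ℤ.*-zeroʳ (ℤ.- B))) (ℤ.+-identityʳ _)))
      split : ∀ x → Dec (x ∈ S) → (d : Dec (x ≡ b)) → g (S ∪ ⁅ x ⁆) ≡ h (S ∪ ⁅ x ⁆) ℤ.+ (ℤ.- B) ℤ.* 𝟙 d
      split x (yes x∈S) (yes refl) = contradiction x∈S b∉S
      split x (no x∉S)  (yes refl) = trans
        (trans (cong ((+ q ℤ.- + ∣ S ∪ ⁅ b ⁆ ∣) ℤ.*_)
                 (run-gap-∈ n (2 ℕ.+ v) (odd-2+ vOdd) free′ pb (S ∪ ⁅ b ⁆) (x∈p∪q⁺ (inj₂ (x∈⁅x⁆ b)))))
               (ℤ.*-zeroʳ (+ q ℤ.- + ∣ S ∪ ⁅ b ⁆ ∣)))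
        (trans (Z.solve 1 (λ b → Z.con 0ℤ Z.:= b Z.:+ (Z.:- b) Z.:* Z.con 1ℤ) refl B)
               (cong (λ z → z ℤ.+ (ℤ.- B) ℤ.* 1ℤ) (sym (cong (λ m → (+ q ℤ.- m) ℤ.* weight (+ q) m n) (∣∪⁅⁆∣ b∉S)))))
      split x _ (no x≢b) = plain x x≢b
-- The graphs of the theorem

odd-1 : Odd 1
odd-1 = (λ d → contradiction (∣1⇒≡1 d) λ ()) , ∣-refl

odd-3 : Odd 3
odd-3 = odd-2+ odd-1

last-even : ∀ {v} n → Odd v → 2 ∣ last v n
last-even zero    (_ , even) = even
last-even (suc n) o          = last-even n (odd-2+ o)

full-bounds : ∀ v n → All (λ w → v ℕ.≤ w × w ℕ.≤ last v n) (fullList v n)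
full-bounds v zero    = (ℕ.≤-refl , ℕ.n≤1+n v) ∷ (ℕ.n≤1+n v , ℕ.≤-refl) ∷ []
full-bounds v (suc n) =
  (ℕ.≤-refl , ℕ.<⇒≤ (<last v (suc n))) ∷ (ℕ.n≤1+n v , ℕ.<⇒≤ (suc<last v n)) ∷
  All.map (λ (le , le′) → ℕ.≤-trans (ℕ.m≤n+m v 2) le , le′) (full-bounds (2 ℕ.+ v) n)

gap-bounds : ∀ v n → All (λ w → v ℕ.≤ w × w ℕ.≤ last v n) (gapList v n)
gap-bounds v zero    = (ℕ.n≤1+n v , ℕ.≤-refl) ∷ []
gap-bounds v (suc n) =
  (ℕ.≤-refl , ℕ.<⇒≤ (<last v (suc n))) ∷ (ℕ.n≤1+n v , ℕ.<⇒≤ (suc<last v n)) ∷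
  All.map (λ (le , le′) → ℕ.≤-trans (ℕ.m≤n+m v 2) le , le′) (gap-bounds (2 ℕ.+ v) n)

full-sorted : ∀ v n → AllPairs ℕ._<_ (fullList v n)
full-sorted v zero    = (ℕ.≤-refl ∷ []) ∷ [] ∷ []
full-sorted v (suc n) =
  (ℕ.≤-refl ∷ All.map (λ (le , _) → ℕ.<⇒≤ le) (full-bounds (2 ℕ.+ v) n)) ∷
  All.map proj₁ (full-bounds (2 ℕ.+ v) n) ∷ full-sorted (2 ℕ.+ v) n

gap-sorted : ∀ v n → AllPairs ℕ._<_ (gapList v n)
gap-sorted v zero    = [] ∷ []
gap-sorted v (suc n) =
  (ℕ.≤-refl ∷ All.map (λ (le , _) → ℕ.<⇒≤ le) (gap-bounds (2 ℕ.+ v) n)) ∷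
  All.map proj₁ (gap-bounds (2 ℕ.+ v) n) ∷ gap-sorted (2 ℕ.+ v) n

last∈full : ∀ v n → last v n ListMem.∈ fullList v n
last∈full v zero    = there (here refl)
last∈full v (suc n) = there (there (last∈full (2 ℕ.+ v) n))

last∈gap : ∀ v n → last v n ListMem.∈ gapList v n
last∈gap v zero    = here refl
last∈gap v (suc n) = there (there (last∈gap (2 ℕ.+ v) n))

first∈gap : ∀ v n {w} → w ListMem.∈ gapList v n → w ≢ last v n → v ListMem.∈ gapList v n
first∈gap v zero    (here w≡) w≢ = contradiction w≡ w≢
first∈gap v (suc n) w∈ w≢        = here refl

lookup-injective : ∀ {V} → AllPairs ℕ._<_ V → ∀ i j → List.lookup V i ≡ List.lookup V j → i ≡ j
lookup-injective (_ ∷ _)  zero    zero    eq = refl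
lookup-injective (v< ∷ _) zero    (suc j) eq = contradiction eq (ℕ.<⇒≢ (All.lookup v< (∈-lookup j)))
lookup-injective (v< ∷ _) (suc i) zero    eq = contradiction (sym eq) (ℕ.<⇒≢ (All.lookup v< (∈-lookup i)))
lookup-injective (_ ∷ s)  (suc i) (suc j) eq = cong suc (lookup-injective s i j eq)

module _ {q : ℕ} (pin : ℕ → Maybe (Fin q)) where
  open Colouring pin using (good?; run; ∑-good)

  ∑-proper : ∀ {V} → AllPairs ℕ._<_ V →
    (d : Decidable {A = Vec (Fin q) (length V)} λ κ →
           (∀ i c → pin (List.lookup V i) ≡ just c → lookup κ i ≡ c)
         × (∀ i j → Graph.Adj (Γ V) i j → lookup κ i ≢ lookup κ j)) →
    ∑ (colourings q (length V)) (λ κ → 𝟙 (d κ)) ≡ run V ⊥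
  ∑-proper {V} sorted d = trans
    (∑-cong (colourings q (length V)) λ κ → 𝟙-cong (d κ) (good? V ⊥ κ)
      (λ (p , e) → p , (λ i j → e i j ∘ inj₁) , λ _ _ → ∉⊥)
      (λ (p , e , _) → p , λ i j → [ e i j , (λ edge → e j i edge ∘ sym) ]′))
    (∑-good V sorted ⊥)

isBond : ∀ {n} (G : Graph n) (x : FinitePoset.Carrier (bondLattice G)) → IsBond G (value x)
isBond G (π , [ b ]) = recompute (isBond? G π) b

∣⊥∪⁅⁆∣ : ∀ {q} (c : Fin q) → + ∣ ⊥ ∪ ⁅ c ⁆ ∣ ≡ 1ℤ
∣⊥∪⁅⁆∣ {q} c = trans (∣∪⁅⁆∣ {S = ⊥} {c} ∉⊥) (cong (λ k → + k ℤ.+ 1ℤ) (∣⊥∣≡0 q))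

-- Opaque because conversion checking would otherwise unfold the elements of concrete bond lattices.
opaque
  ∑μ : FinitePoset → ℤ → ℤ
  ∑μ P z = ∑ elements (λ x → μ 0̂ x ℤ.* z ℤ.^ (len ∸ rk x))
    where open FinitePoset P

  ∑μ-unfold : ∀ P z → let open FinitePoset P in ∑μ P z ≡ ∑ elements (λ x → μ 0̂ x ℤ.* z ℤ.^ (len ∸ rk x))
  ∑μ-unfold P z = refl

module FullGraph (n m : ℕ) where

  V : List ℕ
  V = fullList 1 (suc n)

  e : ℕ
  e = last 1 (suc n)

  # : Fin (length V) → ℕ
  # = List.lookup V

  open Graph (Γ V) using (Adj; adj?; symmetric)

  sorted : AllPairs ℕ._<_ V
  sorted = full-sorted 1 (suc n)

  pick : ∀ {w} → Dec (w ≡ 1) → Maybe (Fin (suc m))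
  pick (yes _) = just zero
  pick (no _)  = nothing

  pin : ℕ → Maybe (Fin (suc m))
  pin w = pick (w ℕ.≟ 1)

  pin-just : ∀ {w c} → pin w ≡ just c → w ≡ 1
  pin-just {w} eq with w ℕ.≟ 1
  ... | yes w≡1 = w≡1

  pin-nothing : ∀ {w} → w ≢ 1 → pin w ≡ nothing
  pin-nothing {w} w≢1 with w ℕ.≟ 1
  ... | yes w≡1 = contradiction w≡1 w≢1
  ... | no _    = refl

  pin-unique : ∀ {i j c d} → pin (# i) ≡ just c → pin (# j) ≡ just d → i ≡ j
  pin-unique {i} {j} pᵢ pⱼ = lookup-injective sorted i j (trans (pin-just {# i} pᵢ) (sym (pin-just {# j} pⱼ)))

  open Components {R = Adj} adj? (λ {i} {j} → symmetric {i} {j})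

  -- The vertex 1 is adjacent to all even vertices, and the greatest vertex, being even, to all odd
  -- ones. So all vertices form one block, the top of the bond lattice, which contains the pinned
  -- vertex.
  reach : ∀ i → Star Adj i zero
  reach i with # i ℕ.≟ 1 | 2 ∣? # i
  ... | yes i≡1 | _ = subst (λ k → Star Adj k zero) (lookup-injective sorted zero i (sym i≡1)) ε
  ... | no i≢1  | yes even = inj₂ (ℕ.≤∧≢⇒< (proj₁ bounds) (i≢1 ∘ sym) , proj₁ odd-1 , even) ◅ ε
    where bounds = All.lookup (full-bounds 1 (suc n)) (∈-lookup i)
  ... | no _ | no odd = _◅_ {j = e-index}
    (inj₁ (subst (Edge (# i)) #e (ℕ.≤∧≢⇒< (proj₂ bounds) (λ i≡e → odd (subst (2 ∣_) (sym i≡e) e-even)) , odd , e-even)))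
    (inj₂ (subst (Edge 1) #e (<last 1 (suc n) , proj₁ odd-1 , e-even)) ◅ ε)
    where
    bounds = All.lookup (full-bounds 1 (suc n)) (∈-lookup i)
    e-even = last-even (suc n) odd-1
    e-index : Fin (length V)
    e-index = Any.index (last∈full 1 (suc n))
    #e : e ≡ # e-index
    #e = lookup-index (last∈full 1 (suc n))

  open BondPoset (Γ V) (bondLattice (Γ V)) value id id refl (isBond (Γ V)) (pin ∘ #)
    (λ {i} {j} → pin-unique {i} {j})
    (λ x {i} {j} pᵢ pⱼ _ → pin-unique {i} {j} pᵢ pⱼ)
    (λ π b _ → (π , [ b ]) , refl)
    ((components , [ components-isBond (Γ V) id ]) , λ i → zero , zero , star⇒block (reach i) , refl)

  open Colouring pin

  -- Of the three factors `q − 1`, one counts the colours of vertex 2, which must differ from that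
  -- of vertex 1, and two come from `run-full` at level 1.
  ∑μ-full : ∀ {W} → W ≡ V → ∑μ (bondLattice (Γ W)) (+ suc m)
            ≡ (+ suc m ℤ.- 1ℤ) ℤ.* ((+ suc m ℤ.- 1ℤ) ℤ.* (+ suc m ℤ.- 1ℤ) ℤ.* weight (+ suc m) 1ℤ n)
  ∑μ-full refl = begin
    ∑μ (bondLattice (Γ V)) (+ suc m)
      ≡⟨ trans (∑μ-unfold (bondLattice (Γ V)) (+ suc m)) ∑-μ ⟩
    ∑ (colourings (suc m) (length V)) (λ κ → 𝟙 (pinned? κ ×-dec proper? κ))
      ≡⟨ ∑-proper pin sorted (λ κ → pinned? κ ×-dec proper? κ) ⟩
    run (1 ∷ 2 ∷ fullList 3 n) ⊥
      ≡⟨ run-odd-pinned (2 ∷ fullList 3 n) ⊥ (proj₁ odd-1) refl ⟩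
    run (2 ∷ fullList 3 n) S₁
      ≡⟨ run-even (fullList 3 n) S₁ ∣-refl refl ⟩
    (+ suc m ℤ.- + ∣ S₁ ∣) ℤ.* run (fullList 3 n) S₁
      ≡⟨ cong ((+ suc m ℤ.- + ∣ S₁ ∣) ℤ.*_)
           (run-full pin n 3 odd-3 (λ w 3≤w → pin-nothing λ w≡1 → contradiction (subst (3 ℕ.≤_) w≡1 3≤w) λ { (s≤s ()) }) S₁) ⟩
    g (+ ∣ S₁ ∣)
      ≡⟨ cong g {+ ∣ S₁ ∣} {1ℤ} (∣⊥∪⁅⁆∣ {suc m} zero) ⟩
    g 1ℤ ∎
    where
    open ≡-Reasoning
    S₁ : Subset (suc m)
    S₁ = ⊥ ∪ ⁅ zero ⁆
    g : ℤ → ℤ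
    g k = (+ suc m ℤ.- k) ℤ.* ((+ suc m ℤ.- 1ℤ) ℤ.* (+ suc m ℤ.- k) ℤ.* weight (+ suc m) k n)

-- The list and its greatest vertex stay variables tied by equations, since the type of the
-- partitions depends on the list. Thus facts about `gapList` are transported to `V`, and no poset
-- is.
module GapGraph (n m : ℕ) {V : List ℕ} {e : ℕ} (V≡ : V ≡ 1 ∷ gapList 3 n) (e≡ : e ≡ last 3 n) where

  # : Fin (length V) → ℕ
  # = List.lookup V

  open Graph (Γ V) using (Adj; adj?; symmetric)

  1<e : 1 ℕ.< e
  1<e = subst (1 ℕ.<_) (sym e≡) (ℕ.<-trans (s≤s (s≤s z≤n)) (<last 3 n))

  e-even : 2 ∣ e
  e-even = subst (2 ∣_) (sym e≡) (last-even n odd-3)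

  sorted : AllPairs ℕ._<_ V
  sorted = subst (AllPairs ℕ._<_) (sym V≡)
    (All.map (λ (le , _) → ℕ.<-≤-trans (s≤s (s≤s z≤n)) le) (gap-bounds 3 n) ∷ gap-sorted 3 n)

  bounds : ∀ i → # i ≢ 1 → 3 ℕ.≤ # i × # i ℕ.≤ e
  bounds i i≢1 = [ (λ i≡1 → contradiction i≡1 i≢1) , id ]′ (All.lookup all (∈-lookup i))
    where
    all : All (λ w → w ≡ 1 ⊎ (3 ℕ.≤ w × w ℕ.≤ e)) V
    all = subst (All _) (sym V≡) (inj₁ refl ∷ All.map inj₂
      (subst (λ k → All (λ w → 3 ℕ.≤ w × w ℕ.≤ k) (gapList 3 n)) (sym e≡) (gap-bounds 3 n)))

  e∈V : e ListMem.∈ V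
  e∈V = subst₂ ListMem._∈_ (sym e≡) (sym V≡) (there (last∈gap 3 n))

  3∈V : ∀ {w} → w ListMem.∈ V → w ≢ 1 → w ≢ e → 3 ListMem.∈ V
  3∈V {w} w∈ w≢1 w≢e = subst (3 ListMem.∈_) (sym V≡) (go (subst (w ListMem.∈_) V≡ w∈))
    where
    go : w ListMem.∈ (1 ∷ gapList 3 n) → 3 ListMem.∈ (1 ∷ gapList 3 n)
    go (here w≡1)  = contradiction w≡1 w≢1
    go (there w∈′) = there (first∈gap 3 n w∈′ (w≢e ∘ (λ eq → trans eq (sym e≡))))

  pick : ∀ {w} → Dec (w ≡ 1) → Dec (w ≡ e) → Maybe (Fin (2 ℕ.+ m))
  pick (yes _) _       = just zero
  pick (no _)  (yes _) = just (suc zero)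
  pick (no _)  (no _)  = nothing

  pin : ℕ → Maybe (Fin (2 ℕ.+ m))
  pin w = pick (w ℕ.≟ 1) (w ℕ.≟ e)

  pin-just : ∀ {w c} → pin w ≡ just c → (w ≡ 1 × c ≡ zero) ⊎ (w ≡ e × c ≡ suc zero)
  pin-just {w} = go (w ℕ.≟ 1) (w ℕ.≟ e)
    where
    go : ∀ {c} (a : Dec (w ≡ 1)) (b : Dec (w ≡ e)) → pick a b ≡ just c → (w ≡ 1 × c ≡ zero) ⊎ (w ≡ e × c ≡ suc zero)
    go (yes w≡1) _         refl = inj₁ (w≡1 , refl)
    go (no _)    (yes w≡e) refl = inj₂ (w≡e , refl)

  pin-e : pin e ≡ just (suc zero)
  pin-e = go (e ℕ.≟ 1) (e ℕ.≟ e)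
    where
    go : (a : Dec (e ≡ 1)) (b : Dec (e ≡ e)) → pick a b ≡ just (suc zero)
    go (yes e≡1) _        = contradiction (sym e≡1) (ℕ.<⇒≢ 1<e)
    go (no _)    (yes _)  = refl
    go (no _)    (no e≢e) = contradiction refl e≢e

  pin-nothing : ∀ {w} → w ≢ 1 → w ≢ e → pin w ≡ nothing
  pin-nothing {w} w≢1 w≢e = go (w ℕ.≟ 1) (w ℕ.≟ e)
    where
    go : (a : Dec (w ≡ 1)) (b : Dec (w ≡ e)) → pick a b ≡ nothing
    go (yes w≡1) _         = contradiction w≡1 w≢1
    go (no _)    (yes w≡e) = contradiction w≡e w≢e
    go (no _)    (no _)    = refl

  #-injective : ∀ {i j w} → # i ≡ w → # j ≡ w → i ≡ j
  #-injective {i} {j} p q = lookup-injective sorted i j (trans p (sym q))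

  pin-injective : ∀ {i j c} → pin (# i) ≡ just c → pin (# j) ≡ just c → i ≡ j
  pin-injective {i} {j} pᵢ pⱼ with pin-just {# i} pᵢ | pin-just {# j} pⱼ
  ... | inj₁ (i≡1 , _)    | inj₁ (j≡1 , _)   = #-injective i≡1 j≡1
  ... | inj₂ (i≡e , _)    | inj₂ (j≡e , _)   = #-injective i≡e j≡e
  ... | inj₁ (_   , refl) | inj₂ (_   , ())
  ... | inj₂ (_   , refl) | inj₁ (_   , ())

  Separated : Partition (length V) → Set
  Separated π = ∀ {i j c d} → pin (# i) ≡ just c → pin (# j) ≡ just d → j ∈ block π i → i ≡ j

  distinct⇒separated : ∀ {π} → DistinctBlocks V 1 e π → Separated π
  distinct⇒separated {π} distinct {i} {j} pᵢ pⱼ i∼j with pin-just {# i} pᵢ | pin-just {# j} pⱼ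
  ... | inj₁ (i≡1 , _) | inj₁ (j≡1 , _) = #-injective i≡1 j≡1
  ... | inj₂ (i≡e , _) | inj₂ (j≡e , _) = #-injective i≡e j≡e
  ... | inj₁ (i≡1 , _) | inj₂ (j≡e , _) = contradiction (sym (block-≡ π i∼j)) (distinct i j i≡1 j≡e)
  ... | inj₂ (i≡e , _) | inj₁ (j≡1 , _) = contradiction (block-≡ π i∼j) (distinct j i j≡1 i≡e)

  separated⇒distinct : ∀ {π} → Separated π → DistinctBlocks V 1 e π
  separated⇒distinct {π} separated i j i≡1 j≡e same =
    ℕ.<⇒≢ 1<e (trans (sym i≡1) (trans (cong # i≡j) j≡e))
    where
    i≡j : i ≡ j
    i≡j = separated {i} {j} (cong pin i≡1) (trans (cong pin j≡e) pin-e) (subst (j ∈_) (sym same) (block-refl π j))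

  -- With the edges at 1 deleted, the components are the block of 1 alone and the block of all other
  -- vertices. Each contains a pinned vertex, as `top` demands.
  Link : Rel (Fin (length V)) 0ℓ
  Link i j = Adj i j × # i ≢ 1 × # j ≢ 1

  link? : B.Decidable Link
  link? i j = adj? i j ×-dec ¬? (# i ℕ.≟ 1) ×-dec ¬? (# j ℕ.≟ 1)

  link-sym : B.Symmetric Link
  link-sym {i} {j} (a , p , q) = symmetric {i} {j} a , q , p

  open Components {R = Link} link? (λ {i} {j} → link-sym {i} {j})

  isolated : ∀ {i j} → # i ≡ 1 → Star Link i j → i ≡ j
  isolated i≡1 ε                   = refl
  isolated i≡1 ((_ , i≢1 , _) ◅ _) = contradiction i≡1 i≢1

  components-separated : Separated components
  components-separated {i} {j} pᵢ pⱼ i∼j with pin-just {# i} pᵢ | pin-just {# j} pⱼ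
  ... | inj₁ (i≡1 , _) | _              = isolated i≡1 (block⇒star i∼j)
  ... | inj₂ _         | inj₁ (j≡1 , _) = sym (isolated j≡1 (block⇒star (block-sym components i∼j)))
  ... | inj₂ (i≡e , _) | inj₂ (j≡e , _) = #-injective i≡e j≡e

  e-index : Fin (length V)
  e-index = Any.index e∈V

  #e : e ≡ # e-index
  #e = lookup-index e∈V

  link-e : ∀ i → # i ≢ 1 → # i ℕ.< e → ¬ (2 ∣ # i) → Link i e-index
  link-e i i≢1 i<e odd = inj₁ (subst (Edge (# i)) #e (i<e , odd , e-even)) , i≢1 , (λ e≡1 → ℕ.<⇒≢ 1<e (sym (trans #e e≡1)))

  -- An odd vertex is adjacent to `e`; an even one other than `e` gets there through 3, now that 1
  -- is excluded. The list contains 3 as soon as it has a vertex besides 1 and `e`, that is, unless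
  -- `n` is 0.
  reach : ∀ i → # i ≢ 1 → # i ≢ e → Dec (2 ∣ # i) → Star Link i e-index
  reach i i≢1 i≢e (no odd)   = link-e i i≢1 (ℕ.≤∧≢⇒< (proj₂ (bounds i i≢1)) i≢e) odd ◅ ε
  reach i i≢1 i≢e (yes even) = _◅_ {j = 3-index}
    (inj₂ (subst (λ w → Edge w (# i)) #3
        (ℕ.≤∧≢⇒< (proj₁ (bounds i i≢1)) (λ 3≡i → proj₁ odd-3 (subst (2 ∣_) (sym 3≡i) even)) , proj₁ odd-3 , even))
      , i≢1 , 3≢1)
    (link-e 3-index 3≢1 (subst₂ ℕ._<_ #3 (sym e≡) (<last 3 n)) (subst (λ w → ¬ (2 ∣ w)) #3 (proj₁ odd-3)) ◅ ε)
    where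
    3∈ = 3∈V (∈-lookup i) i≢1 i≢e
    3-index : Fin (length V)
    3-index = Any.index 3∈
    #3 : 3 ≡ # 3-index
    #3 = lookup-index 3∈
    3≢1 : # 3-index ≢ 1
    3≢1 eq = contradiction (trans #3 eq) λ ()

  hits : ∀ i → ∃ λ j → ∃ λ c → j ∈ block components i × pin (# j) ≡ just c
  hits i with # i ℕ.≟ 1 | # i ℕ.≟ e
  ... | yes i≡1 | _       = i , zero , block-refl components i , cong pin i≡1
  ... | no _    | yes i≡e = i , suc zero , block-refl components i , trans (cong pin i≡e) pin-e
  ... | no i≢1  | no i≢e  = e-index , suc zero , star⇒block (reach i i≢1 i≢e (2 ∣? # i)) , trans (cong pin (sym #e)) pin-e

  module _
    (P : FinitePoset)
    (part : FinitePoset.Carrier P → Partition (length V))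
    (≤⇒⊑ : ∀ {x y} → FinitePoset._≤_ P x y → part x ⊑ part y)
    (⊑⇒≤ : ∀ {x y} → part x ⊑ part y → FinitePoset._≤_ P x y)
    (part-0̂ : part (FinitePoset.0̂ P) ≡ discrete (length V))
    (bond : ∀ x → IsBond (Γ V) (part x))
    (distinct : ∀ x → DistinctBlocks V 1 e (part x))
    (lift : ∀ π → IsBond (Γ V) π → DistinctBlocks V 1 e π → ∃ λ x → part x ≡ π)
    where

    private
      top : ∃ λ x → ∀ i → ∃ λ j → ∃ λ c → j ∈ block (part x) i × pin (# j) ≡ just c
      top = let x , x≡ = lift components (components-isBond (Γ V) proj₁)
                              (separated⇒distinct {components} components-separated)
            in x , subst (λ π → ∀ i → ∃ λ j → ∃ λ c → j ∈ block π i × pin (# j) ≡ just c) (sym x≡) hits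

    open BondPoset (Γ V) P part ≤⇒⊑ ⊑⇒≤ part-0̂ bond (pin ∘ #)
      (λ {i} {j} → pin-injective {i} {j})
      (λ x {i} {j} → distinct⇒separated {part x} (distinct x) {i} {j})
      (λ π b s → lift π b (separated⇒distinct {π} s))
      top

    open Colouring pin

    ∑μ-gap : ∑μ P (+ (2 ℕ.+ m)) ≡ weight (+ (2 ℕ.+ m)) 1ℤ n
    ∑μ-gap = begin
      ∑μ P (+ (2 ℕ.+ m))
        ≡⟨ trans (∑μ-unfold P (+ (2 ℕ.+ m))) ∑-μ ⟩
      ∑ (colourings (2 ℕ.+ m) (length V)) (λ κ → 𝟙 (pinned? κ ×-dec proper? κ))
        ≡⟨ ∑-proper pin sorted (λ κ → pinned? κ ×-dec proper? κ) ⟩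
      run V ⊥
        ≡⟨ cong (λ W → run W ⊥) V≡ ⟩
      run (1 ∷ gapList 3 n) ⊥
        ≡⟨ run-odd-pinned (gapList 3 n) ⊥ (proj₁ odd-1) refl ⟩
      run (gapList 3 n) S₁
        ≡⟨ run-gap-∉ pin (suc zero) n 3 odd-3
             (λ w 3≤w w≢last → pin-nothing (λ w≡1 → contradiction (subst (3 ℕ.≤_) w≡1 3≤w) λ { (s≤s ()) }) λ w≡e → w≢last (trans w≡e e≡))
             (trans (cong pin (sym e≡)) pin-e) S₁
             (λ b∈ → [ ∉⊥ , (λ b∈0 → contradiction (x∈⁅y⁆⇒x≡y zero b∈0) λ ()) ]′ (x∈p∪q⁻ ⊥ ⁅ zero ⁆ b∈)) ⟩
      weight (+ (2 ℕ.+ m)) (+ ∣ S₁ ∣) n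
        ≡⟨ cong (λ k → weight (+ (2 ℕ.+ m)) k n) (∣⊥∪⁅⁆∣ {2 ℕ.+ m} zero) ⟩
      weight (+ (2 ℕ.+ m)) 1ℤ n ∎
      where
      open ≡-Reasoning
      S₁ : Subset (2 ℕ.+ m)
      S₁ = ⊥ ∪ ⁅ zero ⁆
-- Comparison of the two sides

-- The length is written `suc n *ⁿ 2` because this form exposes two successors at once, one pair of
-- the list.
applyUpTo-full : ∀ n v f → (∀ i → f i ≡ i +ⁿ v) → applyUpTo f (suc n *ⁿ 2) ≡ fullList v n
applyUpTo-full zero    v f eq = cong₂ (λ a b → a ∷ b ∷ []) (eq 0) (eq 1)
applyUpTo-full (suc n) v f eq = cong₂ _∷_ (eq 0) (cong₂ _∷_ (eq 1)
  (applyUpTo-full n (2 +ⁿ v) (λ i → f (2 +ⁿ i)) λ i → trans (eq (2 +ⁿ i))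
    (sym (trans (ℕ.+-suc i (suc v)) (cong suc (ℕ.+-suc i v))))))

⟦⟧-full : ∀ n k → k ≡ suc (suc n) *ⁿ 2 → ⟦ k ⟧ ≡ fullList 1 (suc n)
⟦⟧-full n k refl = trans (map-applyUpTo id suc (suc (suc n) *ⁿ 2))
  (applyUpTo-full (suc n) 1 suc λ i → sym (ℕ.+-comm i 1))

last-formula : ∀ v n → last v n ≡ suc (n *ⁿ 2 +ⁿ v)
last-formula v zero    = refl
last-formula v (suc n) = trans (last-formula (2 +ⁿ v) n)
  (cong suc (trans (ℕ.+-suc (n *ⁿ 2) (suc v)) (cong suc (ℕ.+-suc (n *ⁿ 2) v))))

filter-gap : ∀ n v b → 2 ℕ.< v → suc b ≡ last v n →
  filter (λ w → ¬? (w ℕ.≟ 2) ×-dec ¬? (w ℕ.≟ b)) (fullList v n) ≡ gapList v n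
filter-gap zero v b 2<v refl =
  trans (filter-reject keep? λ (_ , v≢v) → v≢v refl)
        (filter-accept keep? (ℕ.<⇒≢ (ℕ.<-trans 2<v ℕ.≤-refl) ∘ sym , ℕ.1+n≢n))
  where keep? = λ w → ¬? (w ℕ.≟ 2) ×-dec ¬? (w ℕ.≟ v)
filter-gap (suc n) v b 2<v eq =
  trans (filter-accept keep? (ℕ.<⇒≢ 2<v ∘ sym , ℕ.<⇒≢ (ℕ.<-trans ℕ.≤-refl sv<b)))
    (cong (v ∷_) (trans (filter-accept keep? (ℕ.<⇒≢ (ℕ.<-trans 2<v ℕ.≤-refl) ∘ sym , ℕ.<⇒≢ sv<b))
      (cong (suc v ∷_) (filter-gap n (2 +ⁿ v) b (ℕ.<-trans 2<v (ℕ.m<n+m v {2} (s≤s z≤n))) eq))))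
  where
  keep? = λ w → ¬? (w ℕ.≟ 2) ×-dec ¬? (w ℕ.≟ b)
  sv<b : suc v ℕ.< b
  sv<b = ℕ.≤-pred (subst (2 +ⁿ v ℕ.<_) (sym eq) (<last (2 +ⁿ v) n))

last-twice : ∀ n → last 3 n ≡ 2 *ⁿ suc (suc n)
last-twice n = trans (last-formula 3 n) (trans (cong suc (ℕ.+-comm (n *ⁿ 2) 3)) (ℕ.*-comm (2 +ⁿ n) 2))

⟦⟧∖-gap : ∀ n → ⟦ 2 *ⁿ suc (suc n) ⟧∖[ 2 , 2 *ⁿ suc (suc n) ∸ 1 ] ≡ 1 ∷ gapList 3 n
⟦⟧∖-gap n = begin
  filter keep? ⟦ 2 *ⁿ suc (suc n) ⟧   ≡⟨ cong (filter keep?) (⟦⟧-full n (2 *ⁿ suc (suc n)) (ℕ.*-comm 2 (2 +ⁿ n))) ⟩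
  filter keep? (1 ∷ 2 ∷ fullList 3 n) ≡⟨ filter-accept keep? ((λ ()) , ℕ.<⇒≢ 1<b) ⟩
  1 ∷ filter keep? (2 ∷ fullList 3 n) ≡⟨ cong (1 ∷_) (filter-reject keep? {xs = fullList 3 n} λ (2≢2 , _) → 2≢2 refl) ⟩
  1 ∷ filter keep? (fullList 3 n)     ≡⟨ cong (1 ∷_) (filter-gap n 3 b ℕ.≤-refl sb≡last) ⟩
  1 ∷ gapList 3 n                     ∎
  where
  open ≡-Reasoning
  b = 2 *ⁿ suc (suc n) ∸ 1
  keep? = λ w → ¬? (w ℕ.≟ 2) ×-dec ¬? (w ℕ.≟ b)
  sb≡last : suc b ≡ last 3 n
  sb≡last = sym (last-twice n)
  1<b : 1 ℕ.< b
  1<b = ℕ.<-trans (s≤s (s≤s z≤n)) (ℕ.≤-pred (subst (3 ℕ.<_) (sym sb≡last) (<last 3 n)))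

-- Values of characteristic polynomials and comparison of weights

eval-^ : ∀ p k x z → eval p x ≡ ι z → eval (p ^ᵗ k) x ≡ ι (z ℤ.^ k)
eval-^ p zero    x z eq = eval-1 x
eval-^ p (suc k) x z eq =
  trans (eval-* x p (p ^ᵗ k)) (trans (cong₂ ℚ._*_ eq (eval-^ p k x z eq)) (sym (ι-* z (z ℤ.^ k))))

eval-foldr : ∀ {A : Set} (xs : List A) f g x → (∀ a → eval (f a) x ≡ ι (g a)) →
             eval (foldr _+ᵗ_ 0ᵗ (map f xs)) x ≡ ι (∑ xs g)
eval-foldr []       f g x eq = refl
eval-foldr (a ∷ xs) f g x eq =
  trans (eval-+ x (f a) (foldr _+ᵗ_ 0ᵗ (map f xs)))
    (trans (cong₂ ℚ._+_ (eq a) (eval-foldr xs f g x eq)) (sym (ι-+ (g a) (∑ xs g))))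

eval-χ : ∀ P z → eval (χ P) (ι z) ≡ ι (∑μ P z)
eval-χ P z = trans
  (eval-foldr elements (λ x → fromℤ (μ 0̂ x) *ᵗ (t ^ᵗ (len ∸ rk x))) (λ x → μ 0̂ x ℤ.* z ℤ.^ (len ∸ rk x)) (ι z) λ x →
    trans (eval-* (ι z) (fromℤ (μ 0̂ x)) (t ^ᵗ (len ∸ rk x)))
      (trans (cong₂ ℚ._*_ (eval-fromℤ (ι z) (μ 0̂ x)) (eval-^ t (len ∸ rk x) (ι z) z (eval-t (ι z))))
             (sym (ι-* (μ 0̂ x) (z ℤ.^ (len ∸ rk x))))))
  (cong ι (sym (∑μ-unfold P z)))
  where open FinitePoset P

ι-- : ∀ a b → ι (a ℤ.- b) ≡ ι a ℚ.- ι b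
ι-- a b = begin
  ι (a ℤ.- b)                        ≡⟨ Q.solve 2 (λ x y → x Q.:= (x Q.:+ y) Q.:- y) refl (ι (a ℤ.- b)) (ι b) ⟩
  (ι (a ℤ.- b) ℚ.+ ι b) ℚ.- ι b      ≡⟨ cong (λ y → y ℚ.- ι b) (ι-+ (a ℤ.- b) b) ⟨
  ι (a ℤ.- b ℤ.+ b) ℚ.- ι b          ≡⟨ cong (λ y → ι y ℚ.- ι b) (trans (ℤ.+-assoc a (ℤ.- b) b) (trans (cong (λ y → a ℤ.+ y) (ℤ.+-inverseˡ b)) (ℤ.+-identityʳ a))) ⟩
  ι a ℚ.- ι b                        ∎
  where open ≡-Reasoning

-- `weight` climbs by raising its level, `walks` by shifting its families of weights; the offset
-- `k ℤ.+ + i` in the hypotheses translates one into the other and is stable under the induction.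
weight-walks : ∀ n z k (y s : ℕ → ℚ) → (∀ i → y i ≡ ι (k ℤ.+ + i) ℚ.* (ι z ℚ.- ι (k ℤ.+ + i))) →
  (∀ i → s i ≡ ι z ℚ.- 1ℚ ℚ.- ι (k ℤ.+ + i)) → ι (weight z k n) ≡ walks y (λ i → s i ℚ.* s i) n
weight-walks zero    z k y s p r = refl
weight-walks (suc n) z k y s p r = begin
  ι (k ℤ.* (z ℤ.- k) ℤ.* w ℤ.+ d ℤ.* d ℤ.* w′)
    ≡⟨ ι-+ (k ℤ.* (z ℤ.- k) ℤ.* w) (d ℤ.* d ℤ.* w′) ⟩
  ι (k ℤ.* (z ℤ.- k) ℤ.* w) ℚ.+ ι (d ℤ.* d ℤ.* w′)
    ≡⟨ cong₂ ℚ._+_ (ι-* (k ℤ.* (z ℤ.- k)) w) (ι-* (d ℤ.* d) w′) ⟩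
  ι (k ℤ.* (z ℤ.- k)) ℚ.* ι w ℚ.+ ι (d ℤ.* d) ℚ.* ι w′
    ≡⟨ cong₂ ℚ._+_ (cong₂ ℚ._*_ y₀ (weight-walks n z k y s p r))
                   (cong₂ ℚ._*_ s₀ (weight-walks n z (k ℤ.+ 1ℤ) (y ∘ suc) (s ∘ suc)
                     (λ i → trans (p (suc i)) (cong (λ j → ι j ℚ.* (ι z ℚ.- ι j)) (shift i)))
                     (λ i → trans (r (suc i)) (cong (λ j → ι z ℚ.- 1ℚ ℚ.- ι j) (shift i))))) ⟩
  walks y (λ i → s i ℚ.* s i) (suc n) ∎
  where
  open ≡-Reasoning
  d = z ℤ.- 1ℤ ℤ.- k
  w = weight z k n
  w′ = weight z (k ℤ.+ 1ℤ) n
  shift : ∀ i → k ℤ.+ + suc i ≡ k ℤ.+ 1ℤ ℤ.+ + i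
  shift i = sym (ℤ.+-assoc k 1ℤ (+ i))
  y₀ : ι (k ℤ.* (z ℤ.- k)) ≡ y 0
  y₀ = trans (ι-* k (z ℤ.- k)) (trans (cong (ι k ℚ.*_) (ι-- z k))
         (trans (cong (λ j → ι j ℚ.* (ι z ℚ.- ι j)) (sym (ℤ.+-identityʳ k))) (sym (p 0))))
  d≡s₀ : ι d ≡ s 0
  d≡s₀ = trans (ι-- (z ℤ.- 1ℤ) k) (trans (cong (λ y → y ℚ.- ι k) (ι-- z 1ℤ))
           (trans (cong (λ j → ι z ℚ.- 1ℚ ℚ.- ι j) (sym (ℤ.+-identityʳ k))) (sym (r 0))))
  s₀ : ι (d ℤ.* d) ≡ s 0 ℚ.* s 0
  s₀ = trans (ι-* d d) (cong₂ ℚ._*_ d≡s₀ d≡s₀)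

∑<-constant : ∀ n (c : ℕ → ℚ) → ∑< (suc n) (λ i → constant (c i) (n ∸ i)) ≡ c n
∑<-constant n c = begin
  ∑< (suc n) (λ i → constant (c i) (n ∸ i))
    ≡⟨ ∑<-last n (λ i → constant (c i) (n ∸ i)) ⟩
  ∑< n (λ i → constant (c i) (n ∸ i)) ℚ.+ constant (c n) (n ∸ n)
    ≡⟨ cong₂ ℚ._+_ (trans (∑<-cong n vanish) (∑<-0* n c)) (cong (constant (c n)) (ℕ.n∸n≡0 n)) ⟩
  0ℚ ℚ.+ c n
    ≡⟨ ℚ.+-identityˡ (c n) ⟩
  c n ∎
  where
  open ≡-Reasoning
  vanish : ∀ i → i ℕ.< n → constant (c i) (n ∸ i) ≡ 0ℚ ℚ.* c i
  vanish i i<n with n ∸ i | ℕ.m<n⇒0<n∸m i<n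
  ... | suc _ | _ = sym (ℚ.*-zeroˡ (c i))

prefixProduct-cong : ∀ n {s s′} → (∀ i → s i ≡ s′ i) → prefixProduct s n ≡ prefixProduct s′ n
prefixProduct-cong zero    eq = refl
prefixProduct-cong (suc n) eq = cong₂ ℚ._*_ (eq 0) (prefixProduct-cong n (eq ∘ suc))

∑μ-Γ : ∀ n m → ∑μ (bondLattice (Γ ⟦ 2 *ⁿ suc n +ⁿ 2 ⟧)) (+ (2 +ⁿ m))
       ≡ (+ (2 +ⁿ m) ℤ.- 1ℤ) ℤ.* ((+ (2 +ⁿ m) ℤ.- 1ℤ) ℤ.* (+ (2 +ⁿ m) ℤ.- 1ℤ) ℤ.* weight (+ (2 +ⁿ m)) 1ℤ n)
∑μ-Γ n m = FullGraph.∑μ-full n (suc m) {⟦ 2 *ⁿ suc n +ⁿ 2 ⟧}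
  (⟦⟧-full n (2 *ⁿ suc n +ⁿ 2) (trans (ℕ.+-comm (2 *ⁿ suc n) 2) (cong (2 +ⁿ_) (ℕ.*-comm 2 (suc n)))))

∑μ-L : ∀ n m → ∑μ (L (suc (suc n))) (+ (2 +ⁿ m)) ≡ weight (+ (2 +ⁿ m)) 1ℤ n
∑μ-L n m = GapGraph.∑μ-gap n m (⟦⟧∖-gap n) (sym (last-twice n)) (L (suc (suc n)))
  (λ (π , _) → value π) id id refl (λ (π , _) → isBond (Γ V) π)
  (λ (π , [ s ]) → recompute (distinctBlocks? V 1 e (value π)) s)
  (λ π b s → ((π , [ b ]) , [ s ]) , refl)
  where
  e = 2 *ⁿ suc (suc n)
  V = ⟦ e ⟧∖[ 2 , e ∸ 1 ]

module AtPoint (m : ℕ) where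
  z : ℤ
  z = + (2 +ⁿ m)

  x : ℚ
  x = ι z

  open Evaluation x
  open ≡-Reasoning

  -- At the level `k = i + 1` this is `q − 1 − k`, whose square is the raising weight. Its prefix
  -- products are the values of the falling factorials of `t − 2`.
  s : ℕ → ℚ
  s i = eval (t -ᵗ fromℕ 2) x ℚ.- ι (+ i)

  eval-t-- : ∀ k → eval (t -ᵗ fromℕ k) x ≡ x ℚ.- ι (+ k)
  eval-t-- k = trans (eval-- x t (fromℕ k)) (cong₂ ℚ._-_ (eval-t x) (eval-fromℤ x (+ k)))

  ι-weight : ∀ n → ι (weight z 1ℤ n) ≡ walks node (λ i → s i ℚ.* s i) n
  ι-weight n = weight-walks n z 1ℤ node s (λ i → refl) λ i → begin
    eval (t -ᵗ fromℕ 2) x ℚ.- ι (+ i)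
      ≡⟨ cong (λ y → y ℚ.- ι (+ i)) (eval-t-- 2) ⟩
    x ℚ.- ι (+ 2) ℚ.- ι (+ i)
      ≡⟨ Q.solve 2 (λ x i → x Q.:- Q.con (ι (+ 2)) Q.:- i Q.:= x Q.:- Q.con 1ℚ Q.:- (Q.con 1ℚ Q.:+ i)) refl x (ι (+ i)) ⟩
    x ℚ.- 1ℚ ℚ.- (ι 1ℤ ℚ.+ ι (+ i))
      ≡⟨ cong (λ y → x ℚ.- 1ℚ ℚ.- y) (ι-+ 1ℤ (+ i)) ⟨
    x ℚ.- 1ℚ ℚ.- ι (1ℤ ℤ.+ + i) ∎

  evalˢ-∑-const : ∀ (a : ℕ → Poly) N → evalˢ (∑≥1 (λ n → const (a n))) (suc N) ≡ eval (a (suc N)) x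
  evalˢ-∑-const a N = begin
    evalˢ (∑≥1 (λ n → const (a n))) (suc N)
      ≡⟨ evalˢ-∑≥1 (λ n → const (a n)) (suc N) ⟩
    ∑< (suc N) (λ i → evalˢ (const (a (suc i))) (N ∸ i))
      ≡⟨ ∑<-cong (suc N) (λ i _ → evalˢ-const (a (suc i)) (N ∸ i)) ⟩
    ∑< (suc N) (λ i → constant (eval (a (suc i)) x) (N ∸ i))
      ≡⟨ ∑<-constant N (λ i → eval (a (suc i)) x) ⟩
    eval (a (suc N)) x ∎

  evalˢ-∑-const-χ : ∀ (P : ℕ → FinitePoset) N {w} → ∑μ (P (suc N)) z ≡ w →
                    evalˢ (∑≥1 (λ n → const (χ (P n)))) (suc N) ≡ ι w
  evalˢ-∑-const-χ P N eq =
    trans (evalˢ-∑-const (λ n → χ (P n)) N) (trans (eval-χ (P (suc N)) z) (cong ι eq))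

  evalˢ-∑-quotient : ∀ (c : ℕ → Poly) (C : ℕ → ℚ) N → (∀ i → eval (c (suc i)) x ≡ C i) →
    evalˢ (∑≥1 (λ n → const (c n) * recip (denominator n))) (suc N)
      ≡ ∑< (suc N) (λ i → C i ℚ.* homogeneous node (suc i) (N ∸ i))
  evalˢ-∑-quotient c C N eq = trans
    (evalˢ-∑≥1 (λ n → const (c n) * recip (denominator n)) (suc N))
    (∑<-cong (suc N) λ i _ → trans
      (evalˢ-const-* (c (suc i)) (recip (denominator (suc i))) (N ∸ i))
      (cong₂ ℚ._*_ (eq i) (evalˢ-recip-denominator (suc i) (N ∸ i))))

  rhsᴸ : ∀ N → evalˢ (∑≥1 (λ n → const (falling (t -ᵗ fromℕ 2) (n ∸ 1) ^ᵗ 2) * recip (denominator n))) (suc N)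
               ≡ ι (weight z 1ℤ N)
  rhsᴸ N = begin
    evalˢ (∑≥1 (λ n → const (falling (t -ᵗ fromℕ 2) (n ∸ 1) ^ᵗ 2) * recip (denominator n))) (suc N)
      ≡⟨ evalˢ-∑-quotient (λ n → falling (t -ᵗ fromℕ 2) (n ∸ 1) ^ᵗ 2) (λ i → prefixProduct s i ℚ.* prefixProduct s i) N
           (λ i → trans (eval-square (falling (t -ᵗ fromℕ 2) i))
                        (cong₂ ℚ._*_ (eval-falling (t -ᵗ fromℕ 2) i) (eval-falling (t -ᵗ fromℕ 2) i))) ⟩
    ∑< (suc N) (λ i → (prefixProduct s i ℚ.* prefixProduct s i) ℚ.* homogeneous node (suc i) (N ∸ i))
      ≡⟨ walks-expansion node s N ⟩
    walks node (λ i → s i ℚ.* s i) N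
      ≡⟨ ι-weight N ⟨
    ι (weight z 1ℤ N) ∎

  lhsᴸ : ∀ N → evalˢ (∑≥1 (λ n → const (χ (L (suc n))))) (suc N) ≡ ι (weight z 1ℤ N)
  lhsᴸ N = evalˢ-∑-const-χ (λ n → L (suc n)) N (∑μ-L N m)

  y : ℚ
  y = x ℚ.- 1ℚ

  -- Since `(t − 1)_n = (t − 1) (t − 2)_{n−1}`, the squared falling factorial yields two factors `y`
  -- beside the sum of `rhsᴸ`, and the outer factor of the series yields the third.
  rhsᴳ : ∀ N → evalˢ (const (t -ᵗ fromℕ 1) * ∑≥1 (λ n → const (falling (t -ᵗ fromℕ 1) n ^ᵗ 2) * recip (denominator n))) (suc N)
               ≡ y ℚ.* (y ℚ.* y ℚ.* ι (weight z 1ℤ N))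
  rhsᴳ N = begin
    evalˢ (const (t -ᵗ fromℕ 1) * G) (suc N)
      ≡⟨ evalˢ-const-* (t -ᵗ fromℕ 1) G (suc N) ⟩
    eval (t -ᵗ fromℕ 1) x ℚ.* evalˢ G (suc N)
      ≡⟨ cong₂ ℚ._*_ (eval-t-- 1) (evalˢ-∑-quotient (λ n → falling (t -ᵗ fromℕ 1) n ^ᵗ 2) (λ i → y ℚ.* y ℚ.* (prefixProduct s i ℚ.* prefixProduct s i)) N square) ⟩
    y ℚ.* ∑< (suc N) (λ i → y ℚ.* y ℚ.* (prefixProduct s i ℚ.* prefixProduct s i) ℚ.* homogeneous node (suc i) (N ∸ i))
      ≡⟨ cong (y ℚ.*_) (trans (∑<-cong (suc N) (λ i _ → ℚ.*-assoc (y ℚ.* y) (prefixProduct s i ℚ.* prefixProduct s i) (homogeneous node (suc i) (N ∸ i))))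
                              (∑<-* (suc N) (y ℚ.* y) (λ i → (prefixProduct s i ℚ.* prefixProduct s i) ℚ.* homogeneous node (suc i) (N ∸ i)))) ⟩
    y ℚ.* (y ℚ.* y ℚ.* ∑< (suc N) (λ i → (prefixProduct s i ℚ.* prefixProduct s i) ℚ.* homogeneous node (suc i) (N ∸ i)))
      ≡⟨ cong (λ v → y ℚ.* (y ℚ.* y ℚ.* v)) (trans (walks-expansion node s N) (sym (ι-weight N))) ⟩
    y ℚ.* (y ℚ.* y ℚ.* ι (weight z 1ℤ N)) ∎
    where
    G = ∑≥1 (λ n → const (falling (t -ᵗ fromℕ 1) n ^ᵗ 2) * recip (denominator n))
    shift : ∀ i → eval (t -ᵗ fromℕ 1) x ℚ.- ι (+ suc i) ≡ s i
    shift i = begin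
      eval (t -ᵗ fromℕ 1) x ℚ.- ι (+ suc i)     ≡⟨ cong₂ ℚ._-_ (eval-t-- 1) (ι-+ 1ℤ (+ i)) ⟩
      x ℚ.- ι 1ℤ ℚ.- (ι 1ℤ ℚ.+ ι (+ i))         ≡⟨ Q.solve 2 (λ x i → x Q.:- Q.con 1ℚ Q.:- (Q.con 1ℚ Q.:+ i) Q.:= x Q.:- Q.con (ι (+ 2)) Q.:- i) refl x (ι (+ i)) ⟩
      x ℚ.- ι (+ 2) ℚ.- ι (+ i)                 ≡⟨ cong (λ v → v ℚ.- ι (+ i)) (eval-t-- 2) ⟨
      s i                                       ∎
    falling-suc : ∀ i → eval (falling (t -ᵗ fromℕ 1) (suc i)) x ≡ y ℚ.* prefixProduct s i
    falling-suc i = trans (eval-falling (t -ᵗ fromℕ 1) (suc i))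
      (cong₂ ℚ._*_ (trans (ℚ.+-identityʳ _) (eval-t-- 1)) (prefixProduct-cong i shift))
    square : ∀ i → eval (falling (t -ᵗ fromℕ 1) (suc i) ^ᵗ 2) x ≡ y ℚ.* y ℚ.* (prefixProduct s i ℚ.* prefixProduct s i)
    square i = trans (eval-square (falling (t -ᵗ fromℕ 1) (suc i))) (trans (cong₂ ℚ._*_ (falling-suc i) (falling-suc i))
      (Q.solve 2 (λ y p → (y Q.:* p) Q.:* (y Q.:* p) Q.:= y Q.:* y Q.:* (p Q.:* p)) refl y (prefixProduct s i)))

  lhsᴳ : ∀ N → evalˢ (∑≥1 (λ n → const (χ (bondLattice (Γ ⟦ 2 *ⁿ n +ⁿ 2 ⟧))))) (suc N) ≡ y ℚ.* (y ℚ.* y ℚ.* ι (weight z 1ℤ N))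
  lhsᴳ N = trans
    (evalˢ-∑-const-χ (λ n → bondLattice (Γ ⟦ 2 *ⁿ n +ⁿ 2 ⟧)) N
      (∑μ-Γ N m))
    (begin
      ι (w ℤ.* (w ℤ.* w ℤ.* weight z 1ℤ N))
        ≡⟨ trans (ι-* w (w ℤ.* w ℤ.* weight z 1ℤ N)) (cong (ι w ℚ.*_) (trans (ι-* (w ℤ.* w) (weight z 1ℤ N)) (cong (ℚ._* ι (weight z 1ℤ N)) (ι-* w w)))) ⟩
      ι w ℚ.* (ι w ℚ.* ι w ℚ.* ι (weight z 1ℤ N))
        ≡⟨ cong (λ v → v ℚ.* (v ℚ.* v ℚ.* ι (weight z 1ℤ N))) (ι-- z 1ℤ) ⟩
      y ℚ.* (y ℚ.* y ℚ.* ι (weight z 1ℤ N)) ∎)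
    where
    w : ℤ
    w = z ℤ.- 1ℤ

series-≈ : ∀ f g → (∀ m n → Evaluation.evalˢ (ι (+ (2 +ⁿ m))) f n ≡ Evaluation.evalˢ (ι (+ (2 +ⁿ m))) g n) → f ≈ g
series-≈ f g eq n = eval-injective (f n) (g n) 2 λ m →
  subst (λ k → eval (f n) (ι (+ k)) ≡ eval (g n) (ι (+ k))) (ℕ.+-comm 2 m) (eq m n)

theorem5p7 : (∑≥1 (λ n → const (χ (bondLattice (Γ ⟦ 2 *ⁿ n +ⁿ 2 ⟧))))
    ≈ const (t -ᵗ fromℕ 1) * ∑≥1 (λ n → const (falling (t -ᵗ fromℕ 1) n ^ᵗ 2) * recip (denominator n)))
    ×
    (∑≥1 (λ n → const (χ (L (suc n))))
    ≈ ∑≥1 (λ n → const (falling (t -ᵗ fromℕ 2) (n ∸ 1) ^ᵗ 2) * recip (denominator n)))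
theorem5p7 =
    series-≈ (∑≥1 (λ n → const (χ (bondLattice (Γ ⟦ 2 *ⁿ n +ⁿ 2 ⟧))))) (const (t -ᵗ fromℕ 1) * G) (λ m → λ where
      -- Both sums start at `n = 1`, so the constant coefficients are empty sums.
      zero    → sym (trans (Evaluation.evalˢ-const-* (ι (+ (2 +ⁿ m))) (t -ᵗ fromℕ 1) G 0) (ℚ.*-zeroʳ (eval (t -ᵗ fromℕ 1) (ι (+ (2 +ⁿ m))))))
      (suc N) → trans (AtPoint.lhsᴳ m N) (sym (AtPoint.rhsᴳ m N)))
  , series-≈ (∑≥1 (λ n → const (χ (L (suc n))))) (∑≥1 (λ n → const (falling (t -ᵗ fromℕ 2) (n ∸ 1) ^ᵗ 2) * recip (denominator n))) (λ m → λ where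
      zero    → refl
      (suc N) → trans (AtPoint.lhsᴸ m N) (sym (AtPoint.rhsᴸ m N)))
  where
  G = ∑≥1 (λ n → const (falling (t -ᵗ fromℕ 1) n ^ᵗ 2) * recip (denominator n))
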